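{- Let $\epsilon, \epsilon' > 0$ and $N \geq 1$ be real numbers. Let $\alpha$ be a real number and suppose there are integers $a$ and $q$ with $1 \leq q \leq N^{2 - \epsilon'}$, $\gcd(a,q) = 1$, and $\left|\alpha - \frac{a}{q}\right| \leq \frac{1}{q N^{2 - \epsilon'}}$. Then there exist integers $a_1, a_2, a_3$ and integers $1 \leq q_1, q_2, q_3 \leq N$ such that $$\left|\alpha - \frac{a_1}{q_1} - \frac{a_2}{q_2} - \frac{a_3}{q_3}\right| \leq \frac{C_\epsilon}{q N^{2 - \epsilon' - \epsilon}},$$ where $C_\epsilon>0$ is a constant depending only on $\epsilon$. -}

module Defs where

open import Data.Empty using (⊥; ⊥-elim)
open import Data.Integer.Base as ℤ using (ℤ; +_; _⊖_)
import Data.Integer.Properties as ℤ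
open import Data.Integer.Tactic.RingSolver using (solve-∀)
open import Data.Nat.Base as ℕ using (ℕ; zero; suc)
import Data.Nat.Properties as ℕ
open import Data.Product using (∃; ∃₂; _×_; _,_; proj₁; proj₂)
open import Data.Rational.Base as ℚ using (ℚ; mkℚ; 0ℚ; 1ℚ; ½; toℚᵘ; *<*)
import Data.Rational.Properties as ℚ
open import Data.Rational.Solver using (module +-*-Solver)
import Data.Rational.Unnormalised.Base as ℚᵘ
import Data.Rational.Unnormalised.Properties as ℚᵘ
open import Data.Sum using (_⊎_; inj₁; inj₂; [_,_]′)
import Algebra.Properties.CommutativeSemiring.Exp as Exp
open import Algebra.Bundles using (CommutativeRing)
open import Relation.Binary.Definitions using (tri<; tri≈; tri>)
open import Relation.Binary.PropositionalEquality
open import Relation.Nullary using (Dec; yes; no)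

module Rational where

  open import Data.Rational.Base using (_+_; _*_; _-_; -_; _<_; _≤_; _⊓_; _⊔_; _/_)
  open +-*-Solver using (solve; _:+_; _:*_; _:=_; :-_; con; _:-_)
  open Exp (CommutativeRing.commutativeSemiring ℚ.+-*-commutativeRing) public
    using (_^_; ^-homo-*; ^-assocʳ; ^-distrib-*)

  private variable
    a b c d p q r : ℚ

  0<1 : 0ℚ < 1ℚ
  0<1 = *<* (ℤ.+<+ (ℕ.s≤s ℕ.z≤n))

  0<½ : 0ℚ < ½
  0<½ = *<* (ℤ.+<+ (ℕ.s≤s ℕ.z≤n))

  ½<1 : ½ < 1ℚ
  ½<1 = *<* (ℤ.+<+ (ℕ.s≤s (ℕ.s≤s ℕ.z≤n)))

  p<p+d : 0ℚ < d → p < p + d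
  p<p+d {d} {p} 0<d = subst (_< p + d) (ℚ.+-identityʳ p) (ℚ.+-monoʳ-< p 0<d)

  p-d<p : 0ℚ < d → p - d < p
  p-d<p {d} {p} 0<d =
    subst (p - d <_) (solve 2 (λ p d → p :- d :+ d := p) refl p d) (p<p+d 0<d)

  p<q⇒0<q-p : p < q → 0ℚ < q - p
  p<q⇒0<q-p {p} {q} p<q =
    subst (_< q - p) (ℚ.+-inverseʳ p) (ℚ.+-monoˡ-< (- p) p<q)

  neg-involutive : ∀ p → - (- p) ≡ p
  neg-involutive = solve 1 (λ p → :- (:- p) := p) refl

  neg-swapˡ : - p < q → - q < p
  neg-swapˡ {p} {q} h = subst (- q <_) (neg-involutive p) (ℚ.neg-antimono-< h)

  neg-swapʳ : p < - q → q < - p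
  neg-swapʳ {p} {q} h = subst (_< - p) (neg-involutive q) (ℚ.neg-antimono-< h)

  neg-swap≤ : - p ≤ q → - q ≤ p
  neg-swap≤ {p} {q} h = subst (- q ≤_) (neg-involutive p) (ℚ.neg-antimono-≤ h)

  dense : p < q → ∃ λ r → p < r × r < q
  dense = ℚ.<-dense

  <⊓ : r < p → r < q → r < p ⊓ q
  <⊓ {r} {p} {q} r<p r<q with ℚ.⊓-sel p q
  ... | inj₁ e = subst (r <_) (sym e) r<p
  ... | inj₂ e = subst (r <_) (sym e) r<q

  ⊔< : p < r → q < r → p ⊔ q < r
  ⊔< {p} {r} {q} p<r q<r with ℚ.⊔-sel p q
  ... | inj₁ e = subst (_< r) (sym e) p<r
  ... | inj₂ e = subst (_< r) (sym e) q<r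

  *-pos : 0ℚ < p → 0ℚ < q → 0ℚ < p * q
  *-pos {p} {q} 0<p 0<q =
    ℚ.positive⁻¹ (p * q) {{ℚ.pos*pos⇒pos p {{ℚ.positive 0<p}} q {{ℚ.positive 0<q}}}}

  *ʳ-< : 0ℚ < c → p < q → p * c < q * c
  *ʳ-< {c} 0<c = ℚ.*-monoˡ-<-pos c {{ℚ.positive 0<c}}

  *ʳ-≤ : 0ℚ ≤ c → p ≤ q → p * c ≤ q * c
  *ʳ-≤ {c} 0≤c = ℚ.*-monoʳ-≤-nonNeg c {{ℚ.nonNegative 0≤c}}

  *ʳ-≥ : c ≤ 0ℚ → p ≤ q → q * c ≤ p * c
  *ʳ-≥ {c} c≤0 = ℚ.*-monoʳ-≤-nonPos c {{ℚ.nonPositive c≤0}}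

  *-mono-≤ : 0ℚ ≤ p → 0ℚ ≤ r → p ≤ q → r ≤ d → p * r ≤ q * d
  *-mono-≤ {p} {r} {q} {d} 0≤p 0≤r p≤q r≤d = ℚ.≤-trans (*ʳ-≤ 0≤r p≤q)
    (subst₂ _≤_ (ℚ.*-comm r q) (ℚ.*-comm d q) (*ʳ-≤ (ℚ.≤-trans 0≤p p≤q) r≤d))

  cancel-≤ : 0ℚ < c → p * c ≤ q * c → p ≤ q
  cancel-≤ {c} 0<c = ℚ.*-cancelʳ-≤-pos c {{ℚ.positive 0<c}}

  cancel-< : 0ℚ < c → p * c < q * c → p < q
  cancel-< {c} 0<c = ℚ.*-cancelʳ-<-nonNeg c {{ℚ.pos⇒nonNeg c {{ℚ.positive 0<c}}}}

  quot : ∀ p {c} → 0ℚ < c → ∃ λ u → u * c ≡ p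
  quot p {c} 0<c = p * (ℚ.1/ c) , (begin
    p * (ℚ.1/ c) * c    ≡⟨ ℚ.*-assoc p (ℚ.1/ c) c ⟩
    p * ((ℚ.1/ c) * c)  ≡⟨ cong (p *_) (ℚ.*-inverseˡ c) ⟩
    p * 1ℚ              ≡⟨ ℚ.*-identityʳ p ⟩
    p                   ∎)
    where
    open ≡-Reasoning
    instance _ = ℚ.>-nonZero 0<c

  quot-pos : 0ℚ < c → ∀ {u} → u * c ≡ p → 0ℚ < p → 0ℚ < u
  quot-pos {c} 0<c e 0<p = cancel-< 0<c (subst₂ _<_ (sym (ℚ.*-zeroˡ c)) (sym e) 0<p)

  ^-pos : 0ℚ < p → ∀ n → 0ℚ < p ^ n
  ^-pos 0<p zero    = 0<1
  ^-pos 0<p (suc n) = *-pos 0<p (^-pos 0<p n)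

  ^-monoˡ-≤ : 0ℚ < p → p ≤ q → ∀ n → p ^ n ≤ q ^ n
  ^-monoˡ-≤ 0<p p≤q zero    = ℚ.≤-refl
  ^-monoˡ-≤ 0<p p≤q (suc n) =
    *-mono-≤ (ℚ.<⇒≤ 0<p) (ℚ.<⇒≤ (^-pos 0<p n)) p≤q (^-monoˡ-≤ 0<p p≤q n)

  ^-monoˡ-< : 0ℚ < p → p < q → ∀ n → p ^ suc n < q ^ suc n
  ^-monoˡ-< {p} {q} 0<p p<q n = ℚ.<-≤-trans (*ʳ-< (^-pos 0<p n) p<q)
    (*-mono-≤ (ℚ.<⇒≤ (ℚ.<-trans 0<p p<q)) (ℚ.<⇒≤ (^-pos 0<p n)) ℚ.≤-refl
      (^-monoˡ-≤ 0<p (ℚ.<⇒≤ p<q) n))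

  1≤^ : 1ℚ ≤ p → ∀ n → 1ℚ ≤ p ^ n
  1≤^ 1≤p zero    = ℚ.≤-refl
  1≤^ 1≤p (suc n) = *-mono-≤ {1ℚ} {1ℚ} (ℚ.<⇒≤ 0<1) (ℚ.<⇒≤ 0<1) 1≤p (1≤^ 1≤p n)

  ^-monoʳ-≤ : 1ℚ ≤ p → ∀ {m n} → m ℕ.≤ n → p ^ m ≤ p ^ n
  ^-monoʳ-≤ {p} 1≤p {n = n} ℕ.z≤n = 1≤^ 1≤p n
  ^-monoʳ-≤ {p} 1≤p (ℕ.s≤s {m} m≤n) = *-mono-≤ (ℚ.<⇒≤ 0<p) (ℚ.<⇒≤ (^-pos 0<p m))
    ℚ.≤-refl (^-monoʳ-≤ 1≤p m≤n)
    where
    0<p = ℚ.<-≤-trans 0<1 1≤p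

  fromℕ : ℕ → ℚ
  fromℕ n = + n / 1

  /-+ : ∀ p q m → (p / suc m) + (q / suc m) ≡ (p ℤ.+ q) / suc m
  /-+ p q m = ℚ.toℚᵘ-injective (begin
    toℚᵘ (p / suc m + q / suc m)              ≈⟨ ℚ.toℚᵘ-homo-+ (p / suc m) (q / suc m) ⟩
    toℚᵘ (p / suc m) ℚᵘ.+ toℚᵘ (q / suc m)    ≈⟨ ℚᵘ.+-cong (ℚ.toℚᵘ-fromℚᵘ (ℚᵘ.mkℚᵘ p m)) (ℚ.toℚᵘ-fromℚᵘ (ℚᵘ.mkℚᵘ q m)) ⟩
    ℚᵘ.mkℚᵘ p m ℚᵘ.+ ℚᵘ.mkℚᵘ q m              ≈⟨ ℚᵘ.*≡* (trans (cong (ℤ._* + suc m) (sym (ℤ.*-distribʳ-+ (+ suc m) p q)))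
                                                        (trans (ℤ.*-assoc (p ℤ.+ q) (+ suc m) (+ suc m)) (cong ((p ℤ.+ q) ℤ.*_) (sym (ℤ.pos-* (suc m) (suc m)))))) ⟩
    ℚᵘ.mkℚᵘ (p ℤ.+ q) m                       ≈⟨ ℚ.toℚᵘ-fromℚᵘ (ℚᵘ.mkℚᵘ (p ℤ.+ q) m) ⟨
    toℚᵘ ((p ℤ.+ q) / suc m)                  ∎)
    where open ℚᵘ.≃-Reasoning

  /-<⇒ : ∀ p q m n → p / suc m < q / suc n → p ℤ.* + suc n ℤ.< q ℤ.* + suc m
  /-<⇒ p q m n h = ℚᵘ.drop-*<* (ℚᵘ.<-respʳ-≃ (ℚ.toℚᵘ-fromℚᵘ (ℚᵘ.mkℚᵘ q n))
    (ℚᵘ.<-respˡ-≃ (ℚ.toℚᵘ-fromℚᵘ (ℚᵘ.mkℚᵘ p m)) (ℚ.toℚᵘ-mono-< h)))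

  /-<⇐ : ∀ p q m n → p ℤ.* + suc n ℤ.< q ℤ.* + suc m → p / suc m < q / suc n
  /-<⇐ p q m n h = ℚ.toℚᵘ-cancel-< (ℚᵘ.<-respʳ-≃ (ℚᵘ.≃-sym (ℚ.toℚᵘ-fromℚᵘ (ℚᵘ.mkℚᵘ q n)))
    (ℚᵘ.<-respˡ-≃ (ℚᵘ.≃-sym (ℚ.toℚᵘ-fromℚᵘ (ℚᵘ.mkℚᵘ p m))) (ℚᵘ.*<* h)))

  /-mono-< : ∀ p q m → p ℤ.< q → p / suc m < q / suc m
  /-mono-< p q m p<q = /-<⇐ p q m m (ℤ.*-monoʳ-<-pos (+ suc m) p<q)

  fromℕ-+ : ∀ m n → fromℕ (m ℕ.+ n) ≡ fromℕ m + fromℕ n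
  fromℕ-+ m n = sym (/-+ (+ m) (+ n) 0)

  0<fromℕ : ∀ n → 0ℚ < fromℕ (suc n)
  0<fromℕ n = /-mono-< (+ 0) (+ suc n) 0 (ℤ.+<+ (ℕ.s≤s ℕ.z≤n))

  0≤fromℕ : ∀ n → 0ℚ ≤ fromℕ n
  0≤fromℕ zero    = ℚ.≤-refl
  0≤fromℕ (suc n) = ℚ.<⇒≤ (0<fromℕ n)

  archimedean : ∀ p → ∃ λ n → p < fromℕ (suc n)
  archimedean p = ℤ.∣ ℚ.↥ p ∣ , bound p
    where
    bound : ∀ p → p < fromℕ (suc ℤ.∣ ℚ.↥ p ∣)
    bound p@(mkℚ n d _) = subst (_< fromℕ (suc ℤ.∣ n ∣)) (ℚ.fromℚᵘ-toℚᵘ p)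
      (/-<⇐ n (+ suc ℤ.∣ n ∣) d 0 (begin-strict
        n ℤ.* + 1                     ≡⟨ ℤ.*-identityʳ n ⟩
        n                             ≤⟨ i≤∣i∣ n ⟩
        + ℤ.∣ n ∣                     <⟨ ℤ.+<+ ℕ.≤-refl ⟩
        + suc ℤ.∣ n ∣                 ≤⟨ ℤ.+≤+ (ℕ.m≤m*n (suc ℤ.∣ n ∣) (suc d)) ⟩
        + (suc ℤ.∣ n ∣ ℕ.* suc d)     ≡⟨ ℤ.pos-* (suc ℤ.∣ n ∣) (suc d) ⟩
        + suc ℤ.∣ n ∣ ℤ.* + suc d     ∎))
      where
      open ℤ.≤-Reasoning
      i≤∣i∣ : ∀ i → i ℤ.≤ + ℤ.∣ i ∣
      i≤∣i∣ (+ n)      = ℤ.≤-refl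
      i≤∣i∣ ℤ.-[1+ n ] = ℤ.-≤+

  bernoulli : 0ℚ < p → 0ℚ < q → ∀ n → p ^ n * (p + fromℕ n * (q - p)) ≤ q ^ n * p
  bernoulli {p} {q} 0<p 0<q zero = ℚ.≤-reflexive
    (solve 2 (λ p q → con 1ℚ :* (p :+ con 0ℚ :* (q :- p)) := con 1ℚ :* p) refl p q)
  bernoulli {p} {q} 0<p 0<q (suc n) = begin
    p * pⁿ * (p + fromℕ (suc n) * δ)                 ≡⟨ cong (λ z → p * pⁿ * (p + z * δ)) (fromℕ-+ 1 n) ⟩
    p * pⁿ * (p + (1ℚ + ν) * δ)                      ≤⟨ p≤p+nonNeg ⟩
    p * pⁿ * (p + (1ℚ + ν) * δ) + pⁿ * (ν * (δ * δ)) ≡⟨ solve 4 (λ p q pⁿ ν →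
      p :* pⁿ :* (p :+ (con 1ℚ :+ ν) :* (q :- p)) :+ pⁿ :* (ν :* ((q :- p) :* (q :- p)))
        := pⁿ :* (p :+ ν :* (q :- p)) :* q) refl p q pⁿ ν ⟩
    pⁿ * (p + ν * δ) * q                             ≤⟨ *ʳ-≤ (ℚ.<⇒≤ 0<q) (bernoulli 0<p 0<q n) ⟩
    q ^ n * p * q                                    ≡⟨ solve 3 (λ qⁿ p q → qⁿ :* p :* q := q :* qⁿ :* p) refl (q ^ n) p q ⟩
    q * q ^ n * p                                    ∎
    where
    open ℚ.≤-Reasoning
    pⁿ = p ^ n
    ν = fromℕ n
    δ = q - p
    square : ∀ x → 0ℚ ≤ x * x
    square x with ℚ.≤-total 0ℚ x
    ... | inj₁ 0≤x = subst (_≤ x * x) (ℚ.*-zeroˡ x) (*ʳ-≤ 0≤x 0≤x)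
    ... | inj₂ x≤0 = subst (_≤ x * x) (ℚ.*-zeroˡ x) (*ʳ-≥ x≤0 x≤0)
    *-nonNeg : ∀ {x y} → 0ℚ ≤ x → 0ℚ ≤ y → 0ℚ ≤ x * y
    *-nonNeg {x} {y} 0≤x 0≤y = subst (_≤ x * y) (ℚ.*-zeroˡ y) (*ʳ-≤ 0≤y 0≤x)
    p≤p+nonNeg : p * pⁿ * (p + (1ℚ + ν) * δ) ≤ p * pⁿ * (p + (1ℚ + ν) * δ) + pⁿ * (ν * (δ * δ))
    p≤p+nonNeg = subst (_≤ p * pⁿ * (p + (1ℚ + ν) * δ) + pⁿ * (ν * (δ * δ))) (ℚ.+-identityʳ _)
      (ℚ.+-monoʳ-≤ (p * pⁿ * (p + (1ℚ + ν) * δ))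
        (*-nonNeg (ℚ.<⇒≤ (^-pos 0<p n)) (*-nonNeg (0≤fromℕ n) (square δ))))

  ^-outgrows : 0ℚ < p → p < q → ∀ K → ∃ λ m → K * p ^ suc m ≤ q ^ suc m
  ^-outgrows {p} {q} 0<p p<q K with quot (K * p) (p<q⇒0<q-p p<q)
  ... | u , u*d≡K*p with archimedean u
  ...   | m , u<m = m , cancel-≤ 0<p (begin
    K * pᵐ * p                                ≡⟨ solve 3 (λ K pᵐ p → K :* pᵐ :* p := pᵐ :* (K :* p)) refl K pᵐ p ⟩
    pᵐ * (K * p)                              ≡⟨ cong (pᵐ *_) (sym u*d≡K*p) ⟩
    pᵐ * (u * (q - p))                        ≤⟨ *ˡ-≤ (ℚ.<⇒≤ (*ʳ-< (p<q⇒0<q-p p<q) u<m)) ⟩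
    pᵐ * (fromℕ (suc m) * (q - p))            ≤⟨ *ˡ-≤ (ℚ.<⇒≤ (subst (g <_) (ℚ.+-comm g p) (p<p+d 0<p))) ⟩
    pᵐ * (p + fromℕ (suc m) * (q - p))        ≤⟨ bernoulli 0<p (ℚ.<-trans 0<p p<q) (suc m) ⟩
    q ^ suc m * p                             ∎)
    where
    open ℚ.≤-Reasoning
    pᵐ = p ^ suc m
    g = fromℕ (suc m) * (q - p)
    *ˡ-≤ : ∀ {x y} → x ≤ y → pᵐ * x ≤ pᵐ * y
    *ˡ-≤ {x} {y} x≤y = subst₂ _≤_ (ℚ.*-comm x pᵐ) (ℚ.*-comm y pᵐ) (*ʳ-≤ (ℚ.<⇒≤ (^-pos 0<p (suc m))) x≤y)

  ^-continuous : ∀ e → ∃ λ δ → 0ℚ < δ ×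
    (∀ {a b} → 0ℚ < a → 1ℚ ≤ b → a < b → b < a + δ → b ^ e ≤ (1ℚ + 1ℚ) * a ^ e)
  ^-continuous e = δ , 0<δ , bound
    where
    ν = fromℕ e
    0<k : 0ℚ < fromℕ (suc (e ℕ.+ e))
    0<k = 0<fromℕ (e ℕ.+ e)
    δ = proj₁ (quot 1ℚ 0<k)
    δ*k≡1 = proj₂ (quot 1ℚ 0<k)
    0<δ = quot-pos 0<k δ*k≡1 0<1
    2δν≤1 : δ * (ν + ν) ≤ 1ℚ
    2δν≤1 = begin
      δ * (ν + ν)              ≡⟨ cong (δ *_) (sym (fromℕ-+ e e)) ⟩
      δ * fromℕ (e ℕ.+ e)      ≤⟨ *-mono-≤ (ℚ.<⇒≤ 0<δ) (0≤fromℕ (e ℕ.+ e)) ℚ.≤-refl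
                                    (ℚ.<⇒≤ (/-mono-< (+ (e ℕ.+ e)) (+ suc (e ℕ.+ e)) 0 (ℤ.+<+ ℕ.≤-refl))) ⟩
      δ * fromℕ (suc (e ℕ.+ e)) ≡⟨ δ*k≡1 ⟩
      1ℚ                       ∎
      where open ℚ.≤-Reasoning
    bound : ∀ {a b} → 0ℚ < a → 1ℚ ≤ b → a < b → b < a + δ → b ^ e ≤ (1ℚ + 1ℚ) * a ^ e
    bound {a} {b} 0<a 1≤b a<b b<a+δ = cancel-≤ 0<b (begin
      bᵉ * b                                       ≡⟨ solve 4 (λ a b bᵉ ν → bᵉ :* b :=
          bᵉ :* (b :+ ν :* (a :- b)) :+ bᵉ :* (ν :* (b :- a))) refl a b bᵉ ν ⟩
      X + bᵉ * (ν * (b - a))                       ≤⟨ ℚ.+-monoʳ-≤ X step ⟩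
      X + X                                        ≤⟨ ℚ.+-mono-≤ bern bern ⟩
      aᵉ * b + aᵉ * b                              ≡⟨ solve 2 (λ aᵉ b → aᵉ :* b :+ aᵉ :* b := (con 1ℚ :+ con 1ℚ) :* aᵉ :* b) refl aᵉ b ⟩
      (1ℚ + 1ℚ) * aᵉ * b                           ∎)
      where
      open ℚ.≤-Reasoning
      0<b = ℚ.<-trans 0<a a<b
      bᵉ = b ^ e
      aᵉ = a ^ e
      X = bᵉ * (b + ν * (a - b))
      bern : X ≤ aᵉ * b
      bern = bernoulli 0<b 0<a e
      gap : b - a < δ
      gap = subst (b - a <_) (solve 2 (λ a δ → a :+ δ :- a := δ) refl a δ) (ℚ.+-monoˡ-< (- a) b<a+δ)
      small : (b - a) * (ν + ν) ≤ b
      small = ℚ.≤-trans (*ʳ-≤ (subst (0ℚ ≤_) (fromℕ-+ e e) (0≤fromℕ (e ℕ.+ e))) (ℚ.<⇒≤ gap)) (ℚ.≤-trans 2δν≤1 1≤b)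
      half : ν * (b - a) ≤ b + ν * (a - b)
      half = subst₂ _≤_
        (solve 3 (λ a b ν → (b :- a) :* (ν :+ ν) :+ ν :* (a :- b) := ν :* (b :- a)) refl a b ν)
        refl (ℚ.+-monoˡ-≤ (ν * (a - b)) small)
      step : bᵉ * (ν * (b - a)) ≤ X
      step = subst₂ _≤_ (ℚ.*-comm (ν * (b - a)) bᵉ) (ℚ.*-comm (b + ν * (a - b)) bᵉ) (*ʳ-≤ (ℚ.<⇒≤ (^-pos 0<b e)) half)
  /-≡ : ∀ p q m n → p ℤ.* + suc n ≡ q ℤ.* + suc m → p / suc m ≡ q / suc n
  /-≡ p q m n e = ℚ.fromℚᵘ-cong {ℚᵘ.mkℚᵘ p m} {ℚᵘ.mkℚᵘ q n} (ℚᵘ.*≡* e)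

  /-*-cancel : ∀ p m → (p / suc m) * fromℕ (suc m) ≡ p / 1
  /-*-cancel p m = ℚ.toℚᵘ-injective (begin
    toℚᵘ (p / suc m * fromℕ (suc m))                ≈⟨ ℚ.toℚᵘ-homo-* (p / suc m) (fromℕ (suc m)) ⟩
    toℚᵘ (p / suc m) ℚᵘ.* toℚᵘ (fromℕ (suc m))      ≈⟨ ℚᵘ.*-cong (ℚ.toℚᵘ-fromℚᵘ (ℚᵘ.mkℚᵘ p m)) (ℚ.toℚᵘ-fromℚᵘ (ℚᵘ.mkℚᵘ (+ suc m) 0)) ⟩
    ℚᵘ.mkℚᵘ p m ℚᵘ.* ℚᵘ.mkℚᵘ (+ suc m) 0            ≈⟨ ℚᵘ.*≡* (trans (ℤ.*-identityʳ _) (cong (λ k → p ℤ.* + k) (sym (ℕ.*-identityʳ (suc m))))) ⟩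
    ℚᵘ.mkℚᵘ p 0                                     ≈⟨ ℚ.toℚᵘ-fromℚᵘ (ℚᵘ.mkℚᵘ p 0) ⟨
    toℚᵘ (p / 1)                                    ∎)
    where open ℚᵘ.≃-Reasoning

  linear-⊓ : ∀ v {u} → a ≤ u → u ≤ b → (a * v) ⊓ (b * v) ≤ u * v
  linear-⊓ {a} {b} v {u} a≤u u≤b with ℚ.≤-total 0ℚ v
  ... | inj₁ 0≤v = ℚ.≤-trans (ℚ.p⊓q≤p (a * v) (b * v)) (*ʳ-≤ 0≤v a≤u)
  ... | inj₂ v≤0 = ℚ.≤-trans (ℚ.p⊓q≤q (a * v) (b * v)) (*ʳ-≥ v≤0 u≤b)

  linear-⊔ : ∀ v {u} → a ≤ u → u ≤ b → u * v ≤ a * v ⊔ b * v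
  linear-⊔ {a} {b} v {u} a≤u u≤b with ℚ.≤-total 0ℚ v
  ... | inj₁ 0≤v = ℚ.≤-trans (*ʳ-≤ 0≤v u≤b) (ℚ.p≤q⊔p (a * v) (b * v))
  ... | inj₂ v≤0 = ℚ.≤-trans (*ʳ-≥ v≤0 a≤u) (ℚ.p≤p⊔q (a * v) (b * v))

  /-<⇒ℕ : ∀ i j m i′ j′ m′ → (i ⊖ j) / suc m < (i′ ⊖ j′) / suc m′ →
    i ℕ.* suc m′ ℕ.+ j′ ℕ.* suc m ℕ.< j ℕ.* suc m′ ℕ.+ i′ ℕ.* suc m
  /-<⇒ℕ i j m i′ j′ m′ h = ℤ.drop‿+<+ (subst₂ ℤ._<_ left right
    (ℤ.+-monoˡ-< (+ j ℤ.* + suc m′ ℤ.+ + j′ ℤ.* + suc m)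
      (/-<⇒ (i ⊖ j) (i′ ⊖ j′) m m′ h)))
    where
    open ≡-Reasoning
    cross : ∀ a b c d → + (a ℕ.* b ℕ.+ c ℕ.* d) ≡ + a ℤ.* + b ℤ.+ + c ℤ.* + d
    cross a b c d = trans (ℤ.pos-+ (a ℕ.* b) (c ℕ.* d)) (cong₂ ℤ._+_ (ℤ.pos-* a b) (ℤ.pos-* c d))
    left : (i ⊖ j) ℤ.* + suc m′ ℤ.+ (+ j ℤ.* + suc m′ ℤ.+ + j′ ℤ.* + suc m) ≡ + (i ℕ.* suc m′ ℕ.+ j′ ℕ.* suc m)
    left = begin
      (i ⊖ j) ℤ.* + suc m′ ℤ.+ (+ j ℤ.* + suc m′ ℤ.+ + j′ ℤ.* + suc m)        ≡⟨ cong (λ z → z ℤ.* + suc m′ ℤ.+ _) (sym (ℤ.[+m]-[+n]≡m⊖n i j)) ⟩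
      (+ i ℤ.- + j) ℤ.* + suc m′ ℤ.+ (+ j ℤ.* + suc m′ ℤ.+ + j′ ℤ.* + suc m)  ≡⟨ ring (+ i) (+ j) (+ j′) (+ suc m) (+ suc m′) ⟩
      + i ℤ.* + suc m′ ℤ.+ + j′ ℤ.* + suc m                                   ≡⟨ sym (cross i (suc m′) j′ (suc m)) ⟩
      + (i ℕ.* suc m′ ℕ.+ j′ ℕ.* suc m)                                       ∎
      where
      ring : ∀ i j j′ m m′ → (i ℤ.- j) ℤ.* m′ ℤ.+ (j ℤ.* m′ ℤ.+ j′ ℤ.* m) ≡ i ℤ.* m′ ℤ.+ j′ ℤ.* m
      ring = solve-∀
    right : (i′ ⊖ j′) ℤ.* + suc m ℤ.+ (+ j ℤ.* + suc m′ ℤ.+ + j′ ℤ.* + suc m) ≡ + (j ℕ.* suc m′ ℕ.+ i′ ℕ.* suc m)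
    right = begin
      (i′ ⊖ j′) ℤ.* + suc m ℤ.+ (+ j ℤ.* + suc m′ ℤ.+ + j′ ℤ.* + suc m)        ≡⟨ cong (λ z → z ℤ.* + suc m ℤ.+ _) (sym (ℤ.[+m]-[+n]≡m⊖n i′ j′)) ⟩
      (+ i′ ℤ.- + j′) ℤ.* + suc m ℤ.+ (+ j ℤ.* + suc m′ ℤ.+ + j′ ℤ.* + suc m)  ≡⟨ ring (+ j) (+ i′) (+ j′) (+ suc m) (+ suc m′) ⟩
      + j ℤ.* + suc m′ ℤ.+ + i′ ℤ.* + suc m                                    ≡⟨ sym (cross j (suc m′) i′ (suc m)) ⟩
      + (j ℕ.* suc m′ ℕ.+ i′ ℕ.* suc m)                                        ∎
      where
      ring : ∀ j i′ j′ m m′ → (i′ ℤ.- j′) ℤ.* m ℤ.+ (j ℤ.* m′ ℤ.+ j′ ℤ.* m) ≡ j ℤ.* m′ ℤ.+ i′ ℤ.* m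
      ring = solve-∀

open Rational renaming (_^_ to _^ℚ_)
open +-*-Solver using (solve; _:+_; _:*_; _:=_; :-_; con; _:-_)

-- Two-sided Dedekind cuts of ℚ.  Reals are only ever compared by _<_ and _≤_,
-- so no quotient is taken and extensionality of cuts is not needed.
record ℝ : Set₁ where
  no-eta-equality
  field
    Lower Upper     : ℚ → Set
    lower-inhabited : ∃ Lower
    upper-inhabited : ∃ Upper
    lower-closed    : ∀ {q r} → q ℚ.< r → Lower r → Lower q
    upper-closed    : ∀ {q r} → q ℚ.< r → Upper q → Upper r
    lower-open      : ∀ {q} → Lower q → ∃ λ r → q ℚ.< r × Lower r
    upper-open      : ∀ {r} → Upper r → ∃ λ q → q ℚ.< r × Upper q
    disjoint        : ∀ {q} → Lower q → Upper q → ⊥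
    located         : ∀ {q r} → q ℚ.< r → Lower q ⊎ Upper r

open ℝ public

infix 4 _<_ _≤_

record _<_ (x y : ℝ) : Set where
  constructor between
  field
    {point} : ℚ
    upper   : Upper x point
    lower   : Lower y point

record _≤_ (x y : ℝ) : Set where
  constructor lower-⊆
  field
    ⊆ : ∀ {r} → Lower x r → Lower y r

fromℚ : ℚ → ℝ
fromℚ q .Lower r          = r ℚ.< q
fromℚ q .Upper r          = q ℚ.< r
fromℚ q .lower-inhabited  = q ℚ.- 1ℚ , p-d<p 0<1
fromℚ q .upper-inhabited  = q ℚ.+ 1ℚ , p<p+d 0<1
fromℚ q .lower-closed     = ℚ.<-trans
fromℚ q .upper-closed h k = ℚ.<-trans k h
fromℚ q .lower-open       = dense
fromℚ q .upper-open h     = let r , q<r , r<p = dense h in r , r<p , q<r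
fromℚ q .disjoint         = ℚ.<-asym
fromℚ q .located {r} {r′} r<r′ with r ℚ.<? q
... | yes r<q = inj₁ r<q
... | no  r≮q = inj₂ (ℚ.≤-<-trans (ℚ.≮⇒≥ r≮q) r<r′)

-- Given by copatterns so that fromℤ n does not unfold during instance search.
fromℤ : ℤ → ℝ
fromℤ n .Lower           = fromℚ (n ℚ./ 1) .Lower
fromℤ n .Upper           = fromℚ (n ℚ./ 1) .Upper
fromℤ n .lower-inhabited = fromℚ (n ℚ./ 1) .lower-inhabited
fromℤ n .upper-inhabited = fromℚ (n ℚ./ 1) .upper-inhabited
fromℤ n .lower-closed    = fromℚ (n ℚ./ 1) .lower-closed
fromℤ n .upper-closed    = fromℚ (n ℚ./ 1) .upper-closed
fromℤ n .lower-open      = fromℚ (n ℚ./ 1) .lower-open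
fromℤ n .upper-open      = fromℚ (n ℚ./ 1) .upper-open
fromℤ n .disjoint        = fromℚ (n ℚ./ 1) .disjoint
fromℤ n .located         = fromℚ (n ℚ./ 1) .located

0ℝ 1ℝ 2ℝ : ℝ
0ℝ = fromℤ (+ 0)
1ℝ = fromℤ (+ 1)
2ℝ = fromℤ (+ 2)

module _ (x : ℝ) where

  lower<upper : ∀ {a b} → Lower x a → Upper x b → a ℚ.< b
  lower<upper {a} {b} a<x x<b with ℚ.<-cmp a b
  ... | tri< a<b _ _  = a<b
  ... | tri≈ _ refl _ = ⊥-elim (disjoint x a<x x<b)
  ... | tri> _ _ b<a  = ⊥-elim (disjoint x (lower-closed x b<a a<x) x<b)

  lower-⊔ : ∀ {a b} → Lower x a → Lower x b → Lower x (a ℚ.⊔ b)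
  lower-⊔ {a} {b} a<x b<x with ℚ.⊔-sel a b
  ... | inj₁ e = subst (Lower x) (sym e) a<x
  ... | inj₂ e = subst (Lower x) (sym e) b<x

  upper-⊓ : ∀ {a b} → Upper x a → Upper x b → Upper x (a ℚ.⊓ b)
  upper-⊓ {a} {b} x<a x<b with ℚ.⊓-sel a b
  ... | inj₁ e = subst (Upper x) (sym e) x<a
  ... | inj₂ e = subst (Upper x) (sym e) x<b

  lower-≤ : ∀ {a b} → a ℚ.≤ b → Lower x b → Lower x a
  lower-≤ {a} {b} a≤b b<x = let c , b<c , c<x = lower-open x b<x in
    lower-closed x (ℚ.≤-<-trans a≤b b<c) c<x

  upper-≤ : ∀ {a b} → a ℚ.≤ b → Upper x a → Upper x b
  upper-≤ {a} {b} a≤b x<a = let c , c<a , x<c = upper-open x x<a in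
    upper-closed x (ℚ.<-≤-trans c<a a≤b) x<c

  grid : ∀ m → ∃₂ λ i j → Lower x ((i ⊖ j) ℚ./ suc m) × Upper x ((2 ℕ.+ i ⊖ j) ℚ./ suc m)
  grid m = let i , l , u = walk N 0 start end in i , j , l , u
    where
    a = proj₁ (lower-inhabited x)
    b = proj₁ (upper-inhabited x)
    n = proj₁ (archimedean (ℚ.- a))
    n′ = proj₁ (archimedean b)
    j = suc n ℕ.* suc m
    N = suc n′ ℕ.* suc m ℕ.+ j

    node : ℕ → ℚ
    node k = (k ⊖ j) ℚ./ suc m

    walk : ∀ n k → Lower x (node k) → Upper x (node (n ℕ.+ k)) →
           ∃ λ k → Lower x (node k) × Upper x (node (2 ℕ.+ k))
    walk zero    k l u = ⊥-elim (disjoint x l u)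
    walk (suc n) k l u =
      [ (λ l′ → walk n (suc k) l′ (subst (λ k → Upper x (node k)) (sym (ℕ.+-suc n k)) u))
      , (λ u′ → k , l , u′)
      ]′ (located x (/-mono-< (suc k ⊖ j) (2 ℕ.+ k ⊖ j) m (ℤ.⊖-monoˡ-< j ℕ.≤-refl)))

    start : Lower x (node 0)
    start = lower-closed x (subst (ℚ._< a)
      (/-≡ (ℤ.-[1+ n ]) (0 ⊖ j) 0 m (sym (ℤ.*-identityʳ (0 ⊖ j))))
      (neg-swapˡ (proj₂ (archimedean (ℚ.- a))))) (proj₂ (lower-inhabited x))

    end : Upper x (node (N ℕ.+ 0))
    end = upper-closed x (subst (b ℚ.<_) (/-≡ (+ suc n′) (N ℕ.+ 0 ⊖ j) 0 m (begin
      + suc n′ ℤ.* + suc m           ≡⟨ ℤ.pos-* (suc n′) (suc m) ⟨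
      + (suc n′ ℕ.* suc m)           ≡⟨ cong +_ (sym (ℕ.m+n∸n≡m (suc n′ ℕ.* suc m) j)) ⟩
      + (N ℕ.∸ j)                    ≡⟨ sym (ℤ.⊖-≥ (ℕ.m≤n+m j (suc n′ ℕ.* suc m))) ⟩
      N ⊖ j                          ≡⟨ cong (_⊖ j) (sym (ℕ.+-identityʳ N)) ⟩
      N ℕ.+ 0 ⊖ j                    ≡⟨ ℤ.*-identityʳ _ ⟨
      (N ℕ.+ 0 ⊖ j) ℤ.* + 1          ∎)) (proj₂ (archimedean b))) (proj₂ (upper-inhabited x))
      where open ≡-Reasoning

  Approximation : (δ a₀ b₀ : ℚ) → Set
  Approximation δ a₀ b₀ =
    ∃₂ λ a b → Lower x a × Upper x b × b ℚ.< a ℚ.+ δ × a₀ ℚ.≤ a × b ℚ.≤ b₀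

  approx : ∀ {δ a₀ b₀} → 0ℚ ℚ.< δ → Lower x a₀ → Upper x b₀ → Approximation δ a₀ b₀
  approx {δ} {a₀} {b₀} 0<δ a₀<x x<b₀ =
    a ℚ.⊔ a₀ , b ℚ.⊓ b₀ , lower-⊔ a<x a₀<x , upper-⊓ x<b x<b₀ ,
    ℚ.≤-<-trans (ℚ.p⊓q≤p b b₀) (ℚ.<-≤-trans b<a+δ (ℚ.+-monoˡ-≤ δ (ℚ.p≤p⊔q a a₀))) ,
    ℚ.p≤q⊔p a a₀ , ℚ.p⊓q≤q b b₀
    where
    v = proj₁ (quot (1ℚ ℚ.+ 1ℚ) 0<δ)
    vδ≡2 = proj₂ (quot (1ℚ ℚ.+ 1ℚ) 0<δ)
    m = proj₁ (archimedean v)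
    i = proj₁ (grid m)
    j = proj₁ (proj₂ (grid m))
    a = (i ⊖ j) ℚ./ suc m
    b = (2 ℕ.+ i ⊖ j) ℚ./ suc m
    a<x : Lower x a
    a<x = proj₁ (proj₂ (proj₂ (grid m)))
    x<b : Upper x b
    x<b = proj₂ (proj₂ (proj₂ (grid m)))
    h = + 2 ℚ./ suc m
    a+h≡b : a ℚ.+ h ≡ b
    a+h≡b = trans (/-+ (i ⊖ j) (+ 2) m) (cong (ℚ._/ suc m)
      (trans (ℤ.+-comm (i ⊖ j) (+ 2)) (ℤ.distribʳ-⊖-+-pos 2 i j)))
    h*m≡2 : h ℚ.* fromℕ (suc m) ≡ 1ℚ ℚ.+ 1ℚ
    h*m≡2 = /-*-cancel (+ 2) m
    h<δ : h ℚ.< δ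
    h<δ = cancel-< {fromℕ (suc m)} (0<fromℕ m)
      (subst₂ ℚ._<_ (trans vδ≡2 (sym h*m≡2)) (ℚ.*-comm (fromℕ (suc m)) δ)
        (*ʳ-< 0<δ (proj₂ (archimedean v))))
    b<a+δ : b ℚ.< a ℚ.+ δ
    b<a+δ = subst (ℚ._< a ℚ.+ δ) a+h≡b (ℚ.+-monoʳ-< a h<δ)

infix  8 -_
infixl 6 _+_ _-_

_+_ : ℝ → ℝ → ℝ
(x + y) .Lower r = ∃₂ λ a b → Lower x a × Lower y b × r ℚ.< a ℚ.+ b
(x + y) .Upper r = ∃₂ λ a b → Upper x a × Upper y b × a ℚ.+ b ℚ.< r
(x + y) .lower-inhabited =
  let a , a<x = lower-inhabited x ; b , b<y = lower-inhabited y
  in a ℚ.+ b ℚ.- 1ℚ , a , b , a<x , b<y , p-d<p 0<1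
(x + y) .upper-inhabited =
  let a , x<a = upper-inhabited x ; b , y<b = upper-inhabited y
  in a ℚ.+ b ℚ.+ 1ℚ , a , b , x<a , y<b , p<p+d 0<1
(x + y) .lower-closed q<r (a , b , l , l′ , r<) = a , b , l , l′ , ℚ.<-trans q<r r<
(x + y) .upper-closed q<r (a , b , u , u′ , <q) = a , b , u , u′ , ℚ.<-trans <q q<r
(x + y) .lower-open (a , b , l , l′ , q<) = let r , q<r , r< = dense q< in r , q<r , a , b , l , l′ , r<
(x + y) .upper-open (a , b , u , u′ , <r) = let q , <q , q<r = dense <r in q , q<r , a , b , u , u′ , <q
(x + y) .disjoint (a , b , l , l′ , q<) (a′ , b′ , u , u′ , <q) = ℚ.<-asym
  (ℚ.<-trans q< (ℚ.+-mono-< (lower<upper x l u) (lower<upper y l′ u′))) <q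
(x + y) .located {r} {r′} r<r′ = decide (approx x 0<δ l₀ u₀) (approx y 0<δ l₁ u₁)
  where
  δ = ½ ℚ.* (r′ ℚ.- r)
  0<δ : 0ℚ ℚ.< δ
  0<δ = *-pos 0<½ (p<q⇒0<q-p r<r′)
  l₀ = proj₂ (lower-inhabited x)
  u₀ = proj₂ (upper-inhabited x)
  l₁ = proj₂ (lower-inhabited y)
  u₁ = proj₂ (upper-inhabited y)
  decide : ∀ {a₀ b₀ a₁ b₁} → Approximation x δ a₀ b₀ → Approximation y δ a₁ b₁ → (x + y) .Lower r ⊎ (x + y) .Upper r′
  decide (a , b , l , u , b<a+δ , _) (a′ , b′ , l′ , u′ , b′<a′+δ , _) with r ℚ.<? a ℚ.+ a′
  ... | yes r< = inj₁ (a , a′ , l , l′ , r<)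
  ... | no  r≮ = inj₂ (b , b′ , u , u′ , (begin-strict
    b ℚ.+ b′                          <⟨ ℚ.+-mono-< b<a+δ b′<a′+δ ⟩
    (a ℚ.+ δ) ℚ.+ (a′ ℚ.+ δ)          ≡⟨ solve 4 (λ a a′ r r′ →
      (a :+ con ½ :* (r′ :- r)) :+ (a′ :+ con ½ :* (r′ :- r)) := (a :+ a′) :+ (r′ :- r)) refl a a′ r r′ ⟩
    (a ℚ.+ a′) ℚ.+ (r′ ℚ.- r)         ≤⟨ ℚ.+-monoˡ-≤ (r′ ℚ.- r) (ℚ.≮⇒≥ r≮) ⟩
    r ℚ.+ (r′ ℚ.- r)                  ≡⟨ solve 2 (λ r r′ → r :+ (r′ :- r) := r′) refl r r′ ⟩
    r′                                ∎))
    where open ℚ.≤-Reasoning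

-_ : ℝ → ℝ
(- x) .Lower r = Upper x (ℚ.- r)
(- x) .Upper r = Lower x (ℚ.- r)
(- x) .lower-inhabited = let a , x<a = upper-inhabited x in ℚ.- a , subst (Upper x) (sym (neg-involutive a)) x<a
(- x) .upper-inhabited = let a , a<x = lower-inhabited x in ℚ.- a , subst (Lower x) (sym (neg-involutive a)) a<x
(- x) .lower-closed q<r = upper-closed x (ℚ.neg-antimono-< q<r)
(- x) .upper-closed q<r = lower-closed x (ℚ.neg-antimono-< q<r)
(- x) .lower-open u = let s , s<-q , x<s = upper-open x u in
  ℚ.- s , neg-swapʳ s<-q , subst (Upper x) (sym (neg-involutive s)) x<s
(- x) .upper-open l = let s , -r<s , s<x = lower-open x l in
  ℚ.- s , neg-swapˡ -r<s , subst (Lower x) (sym (neg-involutive s)) s<x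
(- x) .disjoint u l = disjoint x l u
(- x) .located q<r with located x (ℚ.neg-antimono-< q<r)
... | inj₁ l = inj₂ l
... | inj₂ u = inj₁ u

_-_ : ℝ → ℝ → ℝ
x - y = x + (- y)

∣_∣ : ℝ → ℝ
∣ x ∣ .Lower r = Lower x r ⊎ Lower (- x) r
∣ x ∣ .Upper r = Upper x r × Upper (- x) r
∣ x ∣ .lower-inhabited = let a , a<x = lower-inhabited x in a , inj₁ a<x
∣ x ∣ .upper-inhabited =
  let a , x<a = upper-inhabited x ; b , -x<b = upper-inhabited (- x)
  in a ℚ.⊔ b , upper-≤ x (ℚ.p≤p⊔q a b) x<a , upper-≤ (- x) (ℚ.p≤q⊔p a b) -x<b
∣ x ∣ .lower-closed q<r (inj₁ l) = inj₁ (lower-closed x q<r l)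
∣ x ∣ .lower-closed q<r (inj₂ l) = inj₂ (lower-closed (- x) q<r l)
∣ x ∣ .upper-closed q<r (u , u′) = upper-closed x q<r u , upper-closed (- x) q<r u′
∣ x ∣ .lower-open (inj₁ l) = let r , q<r , l′ = lower-open x l in r , q<r , inj₁ l′
∣ x ∣ .lower-open (inj₂ l) = let r , q<r , l′ = lower-open (- x) l in r , q<r , inj₂ l′
∣ x ∣ .upper-open (u , u′) =
  let q , q<r , x<q = upper-open x u ; q′ , q′<r , -x<q′ = upper-open (- x) u′
  in q ℚ.⊔ q′ , ⊔< q<r q′<r , upper-≤ x (ℚ.p≤p⊔q q q′) x<q , upper-≤ (- x) (ℚ.p≤q⊔p q q′) -x<q′
∣ x ∣ .disjoint (inj₁ l) (u , _) = disjoint x l u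
∣ x ∣ .disjoint (inj₂ l) (_ , u) = disjoint (- x) l u
∣ x ∣ .located q<r with located x q<r | located (- x) q<r
... | inj₁ l | _      = inj₁ (inj₁ l)
... | inj₂ u | inj₁ l = inj₁ (inj₂ l)
... | inj₂ u | inj₂ v = inj₂ (u , v)

-- Rational intervals a < x < b and c < y < d: whatever the signs, r < x * y
-- exactly when r is below all four corner products of some such pair.
record Box (x y : ℝ) : Set where
  constructor box
  field
    {a b c d} : ℚ
    a<x : Lower x a
    x<b : Upper x b
    c<y : Lower y c
    y<d : Upper y d

  min max : ℚ
  min = ((a ℚ.* c) ℚ.⊓ (b ℚ.* c)) ℚ.⊓ ((a ℚ.* d) ℚ.⊓ (b ℚ.* d))
  max = ((a ℚ.* c) ℚ.⊔ (b ℚ.* c)) ℚ.⊔ ((a ℚ.* d) ℚ.⊔ (b ℚ.* d))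

  min≤ : ∀ {u v} → a ℚ.≤ u → u ℚ.≤ b → c ℚ.≤ v → v ℚ.≤ d → min ℚ.≤ u ℚ.* v
  min≤ {u} {v} a≤u u≤b c≤v v≤d = begin
    min                       ≤⟨ ℚ.⊓-mono-≤ (linear-⊓ c a≤u u≤b) (linear-⊓ d a≤u u≤b) ⟩
    (u ℚ.* c) ℚ.⊓ (u ℚ.* d)   ≡⟨ cong₂ ℚ._⊓_ (ℚ.*-comm u c) (ℚ.*-comm u d) ⟩
    (c ℚ.* u) ℚ.⊓ (d ℚ.* u)   ≤⟨ linear-⊓ u c≤v v≤d ⟩
    v ℚ.* u                   ≡⟨ ℚ.*-comm v u ⟩
    u ℚ.* v                   ∎
    where open ℚ.≤-Reasoning

  ≤max : ∀ {u v} → a ℚ.≤ u → u ℚ.≤ b → c ℚ.≤ v → v ℚ.≤ d → u ℚ.* v ℚ.≤ max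
  ≤max {u} {v} a≤u u≤b c≤v v≤d = begin
    u ℚ.* v                   ≡⟨ ℚ.*-comm u v ⟩
    v ℚ.* u                   ≤⟨ linear-⊔ u c≤v v≤d ⟩
    (c ℚ.* u) ℚ.⊔ (d ℚ.* u)   ≡⟨ cong₂ ℚ._⊔_ (ℚ.*-comm c u) (ℚ.*-comm d u) ⟩
    (u ℚ.* c) ℚ.⊔ (u ℚ.* d)   ≤⟨ ℚ.⊔-mono-≤ (linear-⊔ c a≤u u≤b) (linear-⊔ d a≤u u≤b) ⟩
    max                       ∎
    where open ℚ.≤-Reasoning

infixl 7 _*_

_*_ : ℝ → ℝ → ℝ
(x * y) .Lower r = ∃ λ (B : Box x y) → r ℚ.< Box.min B
(x * y) .Upper r = ∃ λ (B : Box x y) → Box.max B ℚ.< r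
(x * y) .lower-inhabited = Box.min B ℚ.- 1ℚ , B , p-d<p 0<1
  where
  B = box (proj₂ (lower-inhabited x)) (proj₂ (upper-inhabited x))
          (proj₂ (lower-inhabited y)) (proj₂ (upper-inhabited y))
(x * y) .upper-inhabited = Box.max B ℚ.+ 1ℚ , B , p<p+d 0<1
  where
  B = box (proj₂ (lower-inhabited x)) (proj₂ (upper-inhabited x))
          (proj₂ (lower-inhabited y)) (proj₂ (upper-inhabited y))
(x * y) .lower-closed q<r (B , r<) = B , ℚ.<-trans q<r r<
(x * y) .upper-closed q<r (B , <q) = B , ℚ.<-trans <q q<r
(x * y) .lower-open (B , q<) = let r , q<r , r< = dense q< in r , q<r , B , r<
(x * y) .upper-open (B , <r) = let q , <q , q<r = dense <r in q , q<r , B , <q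
(x * y) .disjoint (B , r<) (B′ , <r) = ℚ.<-irrefl refl (begin-strict
  _            <⟨ r< ⟩
  Box.min B    ≤⟨ Box.min≤ B (ℚ.p≤p⊔q M.a N.a) (ℚ.<⇒≤ (lower<upper x a<x M.x<b))
                             (ℚ.p≤p⊔q M.c N.c) (ℚ.<⇒≤ (lower<upper y c<y M.y<d)) ⟩
  a ℚ.* c      ≤⟨ Box.≤max B′ (ℚ.p≤q⊔p M.a N.a) (ℚ.<⇒≤ (lower<upper x a<x N.x<b))
                             (ℚ.p≤q⊔p M.c N.c) (ℚ.<⇒≤ (lower<upper y c<y N.y<d)) ⟩
  Box.max B′   <⟨ <r ⟩
  _            ∎)
  where
  open ℚ.≤-Reasoning
  module M = Box B
  module N = Box B′
  a = M.a ℚ.⊔ N.a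
  c = M.c ℚ.⊔ N.c
  a<x = lower-⊔ x M.a<x N.a<x
  c<y = lower-⊔ y M.c<y N.c<y
(x * y) .located {r} {r′} r<r′ = decide (approx x 0<δ l₀ u₀) (approx y 0<δ l₁ u₁)
  where
  a₀ = proj₁ (lower-inhabited x)
  b₀ = proj₁ (upper-inhabited x)
  c₀ = proj₁ (lower-inhabited y)
  d₀ = proj₁ (upper-inhabited y)
  l₀ = proj₂ (lower-inhabited x)
  u₀ = proj₂ (upper-inhabited x)
  l₁ = proj₂ (lower-inhabited y)
  u₁ = proj₂ (upper-inhabited y)

  bounds : ℚ
  bounds = (ℚ.- a₀ ℚ.⊔ b₀) ℚ.⊔ (ℚ.- c₀ ℚ.⊔ d₀)
  K : ℚ
  K = fromℕ (suc (proj₁ (archimedean bounds)))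
  0<K : 0ℚ ℚ.< K
  0<K = 0<fromℕ (proj₁ (archimedean bounds))
  bounds≤K : bounds ℚ.≤ K
  bounds≤K = ℚ.<⇒≤ (proj₂ (archimedean bounds))
  -K≤a₀ : ℚ.- K ℚ.≤ a₀
  -K≤a₀ = neg-swap≤ (ℚ.≤-trans (ℚ.≤-trans (ℚ.p≤p⊔q (ℚ.- a₀) b₀) (ℚ.p≤p⊔q _ (ℚ.- c₀ ℚ.⊔ d₀))) bounds≤K)
  b₀≤K : b₀ ℚ.≤ K
  b₀≤K = ℚ.≤-trans (ℚ.≤-trans (ℚ.p≤q⊔p (ℚ.- a₀) b₀) (ℚ.p≤p⊔q _ (ℚ.- c₀ ℚ.⊔ d₀))) bounds≤K
  -K≤c₀ : ℚ.- K ℚ.≤ c₀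
  -K≤c₀ = neg-swap≤ (ℚ.≤-trans (ℚ.≤-trans (ℚ.p≤p⊔q (ℚ.- c₀) d₀) (ℚ.p≤q⊔p (ℚ.- a₀ ℚ.⊔ b₀) _)) bounds≤K)
  d₀≤K : d₀ ℚ.≤ K
  d₀≤K = ℚ.≤-trans (ℚ.≤-trans (ℚ.p≤q⊔p (ℚ.- c₀) d₀) (ℚ.p≤q⊔p (ℚ.- a₀ ℚ.⊔ b₀) _)) bounds≤K

  w e : ℚ
  w = r′ ℚ.- r
  e = ½ ℚ.* w
  0<e : 0ℚ ℚ.< e
  0<e = *-pos 0<½ (p<q⇒0<q-p r<r′)
  0<½e : 0ℚ ℚ.< ½ ℚ.* e
  0<½e = *-pos 0<½ 0<e
  δ : ℚ
  δ = proj₁ (quot (½ ℚ.* e) 0<K)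
  δK≡½e : δ ℚ.* K ≡ ½ ℚ.* e
  δK≡½e = proj₂ (quot (½ ℚ.* e) 0<K)
  0<δ : 0ℚ ℚ.< δ
  0<δ = quot-pos 0<K δK≡½e 0<½e

  small : ∀ {s v} → 0ℚ ℚ.≤ s → s ℚ.< δ → ℚ.- K ℚ.≤ v → v ℚ.≤ K →
          ℚ.- (½ ℚ.* e) ℚ.< s ℚ.* v × s ℚ.* v ℚ.< ½ ℚ.* e
  small {s} {v} 0≤s s<δ -K≤v v≤K = (begin-strict
    ℚ.- (½ ℚ.* e)    <⟨ ℚ.neg-antimono-< sK<½e ⟩
    ℚ.- (s ℚ.* K)    ≡⟨ solve 2 (λ s K → :- (s :* K) := :- K :* s) refl s K ⟩
    ℚ.- K ℚ.* s      ≤⟨ *ʳ-≤ 0≤s -K≤v ⟩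
    v ℚ.* s          ≡⟨ ℚ.*-comm v s ⟩
    s ℚ.* v          ∎) , (begin-strict
    s ℚ.* v          ≡⟨ ℚ.*-comm s v ⟩
    v ℚ.* s          ≤⟨ *ʳ-≤ 0≤s v≤K ⟩
    K ℚ.* s          ≡⟨ ℚ.*-comm K s ⟩
    s ℚ.* K          <⟨ sK<½e ⟩
    ½ ℚ.* e          ∎)
    where
    open ℚ.≤-Reasoning
    sK<½e : s ℚ.* K ℚ.< ½ ℚ.* e
    sK<½e = subst (s ℚ.* K ℚ.<_) δK≡½e (*ʳ-< 0<K s<δ)

  decide : Approximation x δ a₀ b₀ → Approximation y δ c₀ d₀ → (x * y) .Lower r ⊎ (x * y) .Upper r′
  decide (a , b , a<x , x<b , b<a+δ , a₀≤a , b≤b₀) (c , d , c<y , y<d , d<c+δ , c₀≤c , d≤d₀) =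
    conclude (ℚ.≤-total (r ℚ.+ e) (a ℚ.* c))
    where
    a≤b = ℚ.<⇒≤ (lower<upper x a<x x<b)
    c≤d = ℚ.<⇒≤ (lower<upper y c<y y<d)
    c≤K = ℚ.≤-trans c≤d (ℚ.≤-trans d≤d₀ d₀≤K)
    a≤K = ℚ.≤-trans a≤b (ℚ.≤-trans b≤b₀ b₀≤K)
    -K≤a = ℚ.≤-trans -K≤a₀ a₀≤a
    -K≤c = ℚ.≤-trans -K≤c₀ c₀≤c
    shift : ∀ {p q} → p ℚ.≤ q → q ℚ.< p ℚ.+ δ → 0ℚ ℚ.≤ q ℚ.- p × q ℚ.- p ℚ.< δ
    shift {p} {q} p≤q q<p+δ =
      subst (ℚ._≤ q ℚ.- p) (ℚ.+-inverseʳ p) (ℚ.+-monoˡ-≤ (ℚ.- p) p≤q) ,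
      subst (q ℚ.- p ℚ.<_) (solve 2 (λ p δ → p :+ δ :- p := δ) refl p δ) (ℚ.+-monoˡ-< (ℚ.- p) q<p+δ)
    near : ∀ {u v} → a ℚ.≤ u → u ℚ.< a ℚ.+ δ → c ℚ.≤ v → v ℚ.< c ℚ.+ δ → v ℚ.≤ K →
           a ℚ.* c ℚ.- e ℚ.< u ℚ.* v × u ℚ.* v ℚ.< a ℚ.* c ℚ.+ e
    near {u} {v} a≤u u<a+δ c≤v v<c+δ v≤K =
      let s≥0 , s<δ = shift a≤u u<a+δ
          t≥0 , t<δ = shift c≤v v<c+δ
          lo , hi   = small s≥0 s<δ (ℚ.≤-trans -K≤c c≤v) v≤K
          lo′ , hi′ = small t≥0 t<δ -K≤a a≤K
      in subst₂ ℚ._<_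
           (solve 2 (λ p e → p :+ (:- (con ½ :* e) :+ :- (con ½ :* e)) := p :- e) refl (a ℚ.* c) e)
           expand (ℚ.+-monoʳ-< (a ℚ.* c) (ℚ.+-mono-< lo lo′)) ,
         subst₂ ℚ._<_ expand
           (solve 2 (λ p e → p :+ (con ½ :* e :+ con ½ :* e) := p :+ e) refl (a ℚ.* c) e)
           (ℚ.+-monoʳ-< (a ℚ.* c) (ℚ.+-mono-< hi hi′))
      where
      expand : a ℚ.* c ℚ.+ ((u ℚ.- a) ℚ.* v ℚ.+ (v ℚ.- c) ℚ.* a) ≡ u ℚ.* v
      expand = solve 4 (λ a c u v → a :* c :+ ((u :- a) :* v :+ (v :- c) :* a) := u :* v) refl a c u v
    d≤K = ℚ.≤-trans d≤d₀ d₀≤K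
    ac = near ℚ.≤-refl (p<p+d 0<δ) ℚ.≤-refl (p<p+d 0<δ) c≤K
    bc = near a≤b b<a+δ ℚ.≤-refl (p<p+d 0<δ) c≤K
    ad = near ℚ.≤-refl (p<p+d 0<δ) c≤d d<c+δ d≤K
    bd = near a≤b b<a+δ c≤d d<c+δ d≤K
    B : Box x y
    B = box a<x x<b c<y y<d
    conclude : (r ℚ.+ e ℚ.≤ a ℚ.* c) ⊎ (a ℚ.* c ℚ.≤ r ℚ.+ e) → (x * y) .Lower r ⊎ (x * y) .Upper r′
    conclude (inj₁ r+e≤) = inj₁ (B , ℚ.≤-<-trans r≤
      (<⊓ (<⊓ (proj₁ ac) (proj₁ bc)) (<⊓ (proj₁ ad) (proj₁ bd))))
      where
      r≤ : r ℚ.≤ a ℚ.* c ℚ.- e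
      r≤ = subst (ℚ._≤ a ℚ.* c ℚ.- e) (solve 2 (λ r e → r :+ e :- e := r) refl r e) (ℚ.+-monoˡ-≤ (ℚ.- e) r+e≤)
    conclude (inj₂ ≤r+e) = inj₂ (B , ℚ.<-≤-trans
      (⊔< (⊔< (proj₂ ac) (proj₂ bc)) (⊔< (proj₂ ad) (proj₂ bd))) ≤r′)
      where
      ≤r′ : a ℚ.* c ℚ.+ e ℚ.≤ r′
      ≤r′ = subst (a ℚ.* c ℚ.+ e ℚ.≤_) (solve 2 (λ r r′ →
        r :+ con ½ :* (r′ :- r) :+ con ½ :* (r′ :- r) := r′) refl r r′) (ℚ.+-monoˡ-≤ e ≤r+e)

positive-point : ∀ {x} → 0ℝ < x → ∃ λ a → 0ℚ ℚ.< a × Lower x a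
positive-point (between 0<a a<x) = _ , 0<a , a<x

module _ (y : ℝ) {{0<y : 0ℝ < y}} where

  private
    a₀ = proj₁ (positive-point 0<y)
    0<a₀ = proj₁ (proj₂ (positive-point 0<y))
    a₀<y = proj₂ (proj₂ (positive-point 0<y))

    upper-pos : ∀ {b} → Upper y b → 0ℚ ℚ.< b
    upper-pos y<b = ℚ.<-trans 0<a₀ (lower<upper y a₀<y y<b)

  reciprocal : ℝ
  reciprocal .Lower r = ∃ λ b → Upper y b × r ℚ.* b ℚ.< 1ℚ
  reciprocal .Upper r = ∃ λ a → 0ℚ ℚ.< a × Lower y a × 1ℚ ℚ.< r ℚ.* a
  reciprocal .lower-inhabited = let b , y<b = upper-inhabited y in
    0ℚ , b , y<b , subst (ℚ._< 1ℚ) (sym (ℚ.*-zeroˡ b)) 0<1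
  reciprocal .upper-inhabited = let r , ra≡2 = quot (1ℚ ℚ.+ 1ℚ) 0<a₀ in
    r , a₀ , 0<a₀ , a₀<y , subst (1ℚ ℚ.<_) (sym ra≡2) (p<p+d 0<1)
  reciprocal .lower-closed q<r (b , y<b , rb<1) = b , y<b , ℚ.<-trans (*ʳ-< (upper-pos y<b) q<r) rb<1
  reciprocal .upper-closed q<r (a , 0<a , a<y , 1<qa) = a , 0<a , a<y , ℚ.<-trans 1<qa (*ʳ-< 0<a q<r)
  reciprocal .lower-open {q} (b , y<b , qb<1) =
    let t , qb<t , t<1 = dense qb<1
        r , rb≡t       = quot t (upper-pos y<b)
    in r , cancel-< (upper-pos y<b) (subst (q ℚ.* b ℚ.<_) (sym rb≡t) qb<t) , b , y<b , subst (ℚ._< 1ℚ) (sym rb≡t) t<1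
  reciprocal .upper-open {r} (a , 0<a , a<y , 1<ra) =
    let t , 1<t , t<ra = dense 1<ra
        q , qa≡t       = quot t 0<a
    in q , cancel-< 0<a (subst (ℚ._< r ℚ.* a) (sym qa≡t) t<ra) , a , 0<a , a<y , subst (1ℚ ℚ.<_) (sym qa≡t) 1<t
  reciprocal .disjoint {r} (b , y<b , rb<1) (a , 0<a , a<y , 1<ra) =
    ℚ.<-asym 1<ra (ℚ.<-trans ra<rb rb<1)
    where
    0<r : 0ℚ ℚ.< r
    0<r = cancel-< 0<a (subst (ℚ._< r ℚ.* a) (sym (ℚ.*-zeroˡ a)) (ℚ.<-trans 0<1 1<ra))
    ra<rb : r ℚ.* a ℚ.< r ℚ.* b
    ra<rb = subst₂ ℚ._<_ (ℚ.*-comm a r) (ℚ.*-comm b r) (*ʳ-< 0<r (lower<upper y a<y y<b))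
  reciprocal .located {r} {r′} r<r′ = sign (0ℚ ℚ.<? r)
    where
    sign : Dec (0ℚ ℚ.< r) → reciprocal .Lower r ⊎ reciprocal .Upper r′
    sign (no 0≮r) = let b , y<b = upper-inhabited y in inj₁ (b , y<b , ℚ.≤-<-trans
      (subst (r ℚ.* b ℚ.≤_) (ℚ.*-zeroˡ b) (*ʳ-≤ (ℚ.<⇒≤ (upper-pos y<b)) (ℚ.≮⇒≥ 0≮r))) 0<1)
    sign (yes 0<r) = [ above , below ]′ (located y v<u)
      where
      0<r′ = ℚ.<-trans 0<r r<r′
      u = proj₁ (quot 1ℚ 0<r)
      ur≡1 = proj₂ (quot 1ℚ 0<r)
      v = proj₁ (quot 1ℚ 0<r′)
      vr′≡1 = proj₂ (quot 1ℚ 0<r′)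
      0<v : 0ℚ ℚ.< v
      0<v = quot-pos 0<r′ vr′≡1 0<1
      v<u : v ℚ.< u
      v<u = cancel-< 0<r (begin-strict
        v ℚ.* r     ≡⟨ ℚ.*-comm v r ⟩
        r ℚ.* v     <⟨ *ʳ-< 0<v r<r′ ⟩
        r′ ℚ.* v    ≡⟨ ℚ.*-comm r′ v ⟩
        v ℚ.* r′    ≡⟨ vr′≡1 ⟩
        1ℚ          ≡⟨ ur≡1 ⟨
        u ℚ.* r     ∎)
        where open ℚ.≤-Reasoning
      above : Lower y v → reciprocal .Lower r ⊎ reciprocal .Upper r′
      above v<y = let a , v<a , a<y = lower-open y v<y in
        inj₂ (a , ℚ.<-trans 0<v v<a , a<y , subst₂ ℚ._<_ vr′≡1 (ℚ.*-comm a r′) (*ʳ-< 0<r′ v<a))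
      below : Upper y u → reciprocal .Lower r ⊎ reciprocal .Upper r′
      below y<u = let b , b<u , y<b = upper-open y y<u in
        inj₁ (b , y<b , subst₂ ℚ._<_ (ℚ.*-comm b r) ur≡1 (*ʳ-< 0<r b<u))

infixl 7 _/_

_/_ : ℝ → (y : ℝ) {{0<y : 0ℝ < y}} → ℝ
x / y = x * reciprocal y

-- For x ≥ 1 the exponential is increasing, so r < x ^ s exactly when r < t for
-- some positive rational t with t ^ (1 + m) ≤ x ^ (i - j) for some rational
-- exponent (i - j) / (1 + m) < s; dually for x ^ s < r.  Clearing x ^ (- j) and
-- replacing x by rational bounds a < x < b leaves only natural powers of
-- rationals.
record Below (x s : ℝ) (t : ℚ) : Set where
  constructor below
  field
    {i j m}    : ℕ
    {a b}      : ℚ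
    0<t        : 0ℚ ℚ.< t
    exponent<s : Lower s ((i ⊖ j) ℚ./ suc m)
    0<a        : 0ℚ ℚ.< a
    a<x        : Lower x a
    x<b        : Upper x b
    power≤     : t ^ℚ suc m ℚ.* b ^ℚ j ℚ.≤ a ^ℚ i

record Above (x s : ℝ) (t : ℚ) : Set where
  constructor above
  field
    {i j m}    : ℕ
    {a b}      : ℚ
    0<t        : 0ℚ ℚ.< t
    s<exponent : Upper s ((i ⊖ j) ℚ./ suc m)
    0<a        : 0ℚ ℚ.< a
    a<x        : Lower x a
    x<b        : Upper x b
    ≤power     : b ^ℚ i ℚ.≤ t ^ℚ suc m ℚ.* a ^ℚ j

module _ (x : ℝ) {{1≤x : 1ℝ ≤ x}} where

  private
    ½<x : Lower x ½
    ½<x = _≤_.⊆ 1≤x ½<1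

    1≤upper : ∀ {b} → Upper x b → 1ℚ ℚ.≤ b
    1≤upper {b} x<b = ℚ.≮⇒≥ λ b<1 → disjoint x (_≤_.⊆ 1≤x b<1) x<b

    upper-pos : ∀ {b} → Upper x b → 0ℚ ℚ.< b
    upper-pos x<b = ℚ.<-≤-trans 0<1 (1≤upper x<b)

    b₀ = proj₁ (upper-inhabited x)
    x<b₀ = proj₂ (upper-inhabited x)

  power : ℝ → ℝ
  power s .Lower r = ∃ λ t → r ℚ.< t × Below x s t
  power s .Upper r = ∃ λ t → t ℚ.< r × Above x s t
  power s .lower-inhabited =
    let i , j , l , _ = grid s 0
        t , tbʲ≡aⁱ    = quot (½ ^ℚ i) (^-pos (upper-pos x<b₀) j)
        0<t           = quot-pos (^-pos (upper-pos x<b₀) j) tbʲ≡aⁱ (^-pos 0<½ i)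
    in 0ℚ , t , 0<t , below {i = i} {j} {0} 0<t l 0<½ ½<x x<b₀
         (ℚ.≤-reflexive (trans (cong (ℚ._* b₀ ^ℚ j) (ℚ.*-identityʳ t)) tbʲ≡aⁱ))
  power s .upper-inhabited =
    let i , j , _ , u = grid s 0
        t , taʲ≡bⁱ    = quot (b₀ ^ℚ (2 ℕ.+ i)) (^-pos 0<½ j)
        0<t           = quot-pos (^-pos 0<½ j) taʲ≡bⁱ (^-pos (upper-pos x<b₀) (2 ℕ.+ i))
    in t ℚ.+ 1ℚ , t , p<p+d 0<1 , above {i = 2 ℕ.+ i} {j} {0} 0<t u 0<½ ½<x x<b₀
         (ℚ.≤-reflexive (sym (trans (cong (ℚ._* ½ ^ℚ j) (ℚ.*-identityʳ t)) taʲ≡bⁱ)))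
  power s .lower-closed q<r (t , r<t , h) = t , ℚ.<-trans q<r r<t , h
  power s .upper-closed q<r (t , t<q , h) = t , ℚ.<-trans t<q q<r , h
  power s .lower-open (t , q<t , h) = let r , q<r , r<t = dense q<t in r , q<r , t , r<t , h
  power s .upper-open (t , t<r , h) = let q , t<q , q<r = dense t<r in q , q<r , t , t<q , h
  power s .disjoint {r} (t , r<t , T) (t′ , t′<r , T′) =
    ℚ.<-irrefl refl (ℚ.<-≤-trans (^-monoˡ-< T′.0<t (ℚ.<-trans t′<r r<t) (T′.m ℕ.+ T.m ℕ.* M′)) tᵏ≤t′ᵏ)
    where
    open ℚ.≤-Reasoning
    module T = Below T
    module T′ = Above T′
    M = suc T.m
    M′ = suc T′.m
    α = T.a ℚ.⊔ T′.a
    β = T.b ℚ.⊓ T′.b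
    α<x = lower-⊔ x T.a<x T′.a<x
    x<β = upper-⊓ x T.x<b T′.x<b
    0<α : 0ℚ ℚ.< α
    0<α = ℚ.<-≤-trans T.0<a (ℚ.p≤p⊔q T.a T′.a)
    0<β = upper-pos x<β
    e₁ e₂ : ℕ
    e₁ = T.i ℕ.* M′ ℕ.+ T′.j ℕ.* M
    e₂ = T.j ℕ.* M′ ℕ.+ T′.i ℕ.* M
    e₁<e₂ : e₁ ℕ.< e₂
    e₁<e₂ = /-<⇒ℕ T.i T.j T.m T′.i T′.j T′.m (lower<upper s T.exponent<s T′.s<exponent)

    lo : t ^ℚ (M ℕ.* M′) ℚ.* β ^ℚ (T.j ℕ.* M′) ℚ.≤ α ^ℚ (T.i ℕ.* M′)
    lo = begin
      t ^ℚ (M ℕ.* M′) ℚ.* β ^ℚ (T.j ℕ.* M′)    ≡⟨ cong₂ ℚ._*_ (sym (^-assocʳ t M M′)) (sym (^-assocʳ β T.j M′)) ⟩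
      (t ^ℚ M) ^ℚ M′ ℚ.* (β ^ℚ T.j) ^ℚ M′      ≡⟨ sym (^-distrib-* (t ^ℚ M) (β ^ℚ T.j) M′) ⟩
      (t ^ℚ M ℚ.* β ^ℚ T.j) ^ℚ M′              ≤⟨ ^-monoˡ-≤ (*-pos (^-pos T.0<t M) (^-pos 0<β T.j)) base M′ ⟩
      (α ^ℚ T.i) ^ℚ M′                         ≡⟨ ^-assocʳ α T.i M′ ⟩
      α ^ℚ (T.i ℕ.* M′)                        ∎
      where
      base : t ^ℚ M ℚ.* β ^ℚ T.j ℚ.≤ α ^ℚ T.i
      base = begin
        t ^ℚ M ℚ.* β ^ℚ T.j      ≤⟨ *-mono-≤ (ℚ.<⇒≤ (^-pos T.0<t M)) (ℚ.<⇒≤ (^-pos 0<β T.j)) ℚ.≤-refl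
                                      (^-monoˡ-≤ 0<β (ℚ.p⊓q≤p T.b T′.b) T.j) ⟩
        t ^ℚ M ℚ.* T.b ^ℚ T.j    ≤⟨ T.power≤ ⟩
        T.a ^ℚ T.i               ≤⟨ ^-monoˡ-≤ T.0<a (ℚ.p≤p⊔q T.a T′.a) T.i ⟩
        α ^ℚ T.i                 ∎

    hi : β ^ℚ (T′.i ℕ.* M) ℚ.≤ t′ ^ℚ (M ℕ.* M′) ℚ.* α ^ℚ (T′.j ℕ.* M)
    hi = begin
      β ^ℚ (T′.i ℕ.* M)                          ≡⟨ sym (^-assocʳ β T′.i M) ⟩
      (β ^ℚ T′.i) ^ℚ M                           ≤⟨ ^-monoˡ-≤ (^-pos 0<β T′.i) base M ⟩
      (t′ ^ℚ M′ ℚ.* α ^ℚ T′.j) ^ℚ M              ≡⟨ ^-distrib-* (t′ ^ℚ M′) (α ^ℚ T′.j) M ⟩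
      (t′ ^ℚ M′) ^ℚ M ℚ.* (α ^ℚ T′.j) ^ℚ M       ≡⟨ cong₂ ℚ._*_ (^-assocʳ t′ M′ M) (^-assocʳ α T′.j M) ⟩
      t′ ^ℚ (M′ ℕ.* M) ℚ.* α ^ℚ (T′.j ℕ.* M)     ≡⟨ cong (λ k → t′ ^ℚ k ℚ.* α ^ℚ (T′.j ℕ.* M)) (ℕ.*-comm M′ M) ⟩
      t′ ^ℚ (M ℕ.* M′) ℚ.* α ^ℚ (T′.j ℕ.* M)     ∎
      where
      base : β ^ℚ T′.i ℚ.≤ t′ ^ℚ M′ ℚ.* α ^ℚ T′.j
      base = begin
        β ^ℚ T′.i                  ≤⟨ ^-monoˡ-≤ 0<β (ℚ.p⊓q≤q T.b T′.b) T′.i ⟩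
        T′.b ^ℚ T′.i               ≤⟨ T′.≤power ⟩
        t′ ^ℚ M′ ℚ.* T′.a ^ℚ T′.j  ≤⟨ *-mono-≤ (ℚ.<⇒≤ (^-pos T′.0<t M′)) (ℚ.<⇒≤ (^-pos T′.0<a T′.j)) ℚ.≤-refl
                                        (^-monoˡ-≤ T′.0<a (ℚ.p≤q⊔p T.a T′.a) T′.j) ⟩
        t′ ^ℚ M′ ℚ.* α ^ℚ T′.j     ∎

    tᵏ≤t′ᵏ : t ^ℚ (M ℕ.* M′) ℚ.≤ t′ ^ℚ (M ℕ.* M′)
    tᵏ≤t′ᵏ = cancel-≤ (^-pos 0<β e₂) (begin
      tᵏ ℚ.* β ^ℚ e₂                                               ≡⟨ cong (tᵏ ℚ.*_) (^-homo-* β (T.j ℕ.* M′) (T′.i ℕ.* M)) ⟩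
      tᵏ ℚ.* (β ^ℚ (T.j ℕ.* M′) ℚ.* β ^ℚ (T′.i ℕ.* M))             ≡⟨ ℚ.*-assoc tᵏ _ _ ⟨
      tᵏ ℚ.* β ^ℚ (T.j ℕ.* M′) ℚ.* β ^ℚ (T′.i ℕ.* M)               ≤⟨ *-mono-≤ (ℚ.<⇒≤ (*-pos (^-pos T.0<t (M ℕ.* M′)) (^-pos 0<β (T.j ℕ.* M′))))
                                                                        (ℚ.<⇒≤ (^-pos 0<β (T′.i ℕ.* M))) lo hi ⟩
      α ^ℚ (T.i ℕ.* M′) ℚ.* (t′ᵏ ℚ.* α ^ℚ (T′.j ℕ.* M))            ≡⟨ solve 3 (λ p q r → p :* (q :* r) := q :* (p :* r)) refl
                                                                        (α ^ℚ (T.i ℕ.* M′)) t′ᵏ (α ^ℚ (T′.j ℕ.* M)) ⟩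
      t′ᵏ ℚ.* (α ^ℚ (T.i ℕ.* M′) ℚ.* α ^ℚ (T′.j ℕ.* M))            ≡⟨ cong (t′ᵏ ℚ.*_) (sym (^-homo-* α (T.i ℕ.* M′) (T′.j ℕ.* M))) ⟩
      t′ᵏ ℚ.* α ^ℚ e₁                                              ≤⟨ *-mono-≤ (ℚ.<⇒≤ (^-pos T′.0<t (M ℕ.* M′))) (ℚ.<⇒≤ (^-pos 0<α e₁)) ℚ.≤-refl αᵉ≤βᵉ ⟩
      t′ᵏ ℚ.* β ^ℚ e₂                                              ∎)
      where
      tᵏ = t ^ℚ (M ℕ.* M′)
      t′ᵏ = t′ ^ℚ (M ℕ.* M′)
      αᵉ≤βᵉ : α ^ℚ e₁ ℚ.≤ β ^ℚ e₂
      αᵉ≤βᵉ = ℚ.≤-trans (^-monoˡ-≤ 0<α (ℚ.<⇒≤ (lower<upper x α<x x<β)) e₁)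
                        (^-monoʳ-≤ (1≤upper x<β) (ℕ.<⇒≤ e₁<e₂))
  power s .located {r} {r′} r<r′ = sign (0ℚ ℚ.<? r)
    where
    Goal = power s .Lower r ⊎ power s .Upper r′
    sign : Dec (0ℚ ℚ.< r) → Goal
    sign (no 0≮r) = let t₀ , 0<t₀ , T₀ = proj₂ (power s .lower-inhabited) in
      inj₁ (t₀ , ℚ.≤-<-trans (ℚ.≮⇒≥ 0≮r) 0<t₀ , T₀)
    sign (yes 0<r) = decide (approx x 0<δ ½<x x<b₀)
      where
      t₁ = proj₁ (dense r<r′)
      r<t₁ : r ℚ.< t₁
      r<t₁ = proj₁ (proj₂ (dense r<r′))
      t₁<r′ : t₁ ℚ.< r′
      t₁<r′ = proj₂ (proj₂ (dense r<r′))
      t₂ = proj₁ (dense t₁<r′)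
      t₁<t₂ : t₁ ℚ.< t₂
      t₁<t₂ = proj₁ (proj₂ (dense t₁<r′))
      t₂<r′ : t₂ ℚ.< r′
      t₂<r′ = proj₂ (proj₂ (dense t₁<r′))
      0<t₁ = ℚ.<-trans 0<r r<t₁
      0<t₂ = ℚ.<-trans 0<t₁ t₁<t₂
      K = (1ℚ ℚ.+ 1ℚ) ℚ.* (b₀ ℚ.* b₀)
      m = proj₁ (^-outgrows 0<t₁ t₁<t₂ K)
      Kt₁≤t₂ : K ℚ.* t₁ ^ℚ suc m ℚ.≤ t₂ ^ℚ suc m
      Kt₁≤t₂ = proj₂ (^-outgrows 0<t₁ t₁<t₂ K)
      i = proj₁ (grid s m)
      j = proj₁ (proj₂ (grid s m))
      l : Lower s ((i ⊖ j) ℚ./ suc m)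
      l = proj₁ (proj₂ (proj₂ (grid s m)))
      u : Upper s ((2 ℕ.+ i ⊖ j) ℚ./ suc m)
      u = proj₂ (proj₂ (proj₂ (grid s m)))
      δ = proj₁ (^-continuous (i ℕ.+ j))
      0<δ : 0ℚ ℚ.< δ
      0<δ = proj₁ (proj₂ (^-continuous (i ℕ.+ j)))
      decide : Approximation x δ ½ b₀ → Goal
      decide (a , b , a<x , x<b , b<a+δ , ½≤a , b≤b₀) = compare (P ℚ.* Bʲ ℚ.≤? Aⁱ)
        where
        open ℚ.≤-Reasoning
        P = t₁ ^ℚ suc m
        Q = t₂ ^ℚ suc m
        Aⁱ = a ^ℚ i
        Aʲ = a ^ℚ j
        Bⁱ = b ^ℚ i
        Bʲ = b ^ℚ j
        2ℚ = 1ℚ ℚ.+ 1ℚ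
        0<a = ℚ.<-≤-trans 0<½ ½≤a
        0<b = upper-pos x<b
        0<Aʲ = ^-pos 0<a j
        0<Bⁱ = ^-pos 0<b i
        0≤2 : 0ℚ ℚ.≤ 2ℚ
        0≤2 = ℚ.<⇒≤ (ℚ.<-trans 0<1 (p<p+d 0<1))
        compare : Dec (P ℚ.* Bʲ ℚ.≤ Aⁱ) → Goal
        compare (yes h) = inj₁ (t₁ , r<t₁ , below {i = i} {j} {m} 0<t₁ l 0<a a<x x<b h)
        compare (no ¬h) = inj₂ (t₂ , t₂<r′ , above {i = 2 ℕ.+ i} {j} {m} 0<t₂ u 0<a a<x x<b (begin
          b ℚ.* (b ℚ.* Bⁱ)                ≡⟨ ℚ.*-assoc b b Bⁱ ⟨
          b ℚ.* b ℚ.* Bⁱ                  ≤⟨ *-mono-≤ (ℚ.<⇒≤ (*-pos 0<b 0<b)) (ℚ.<⇒≤ 0<Bⁱ)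
                                               (*-mono-≤ (ℚ.<⇒≤ 0<b) (ℚ.<⇒≤ 0<b) b≤b₀ b≤b₀) Bⁱ≤ ⟩
          b₀ ℚ.* b₀ ℚ.* (2ℚ ℚ.* (P ℚ.* Aʲ)) ≡⟨ solve 4 (λ z d p q → z :* (d :* (p :* q)) := d :* z :* p :* q) refl (b₀ ℚ.* b₀) 2ℚ P Aʲ ⟩
          K ℚ.* P ℚ.* Aʲ                  ≤⟨ *ʳ-≤ (ℚ.<⇒≤ 0<Aʲ) Kt₁≤t₂ ⟩
          Q ℚ.* Aʲ                        ∎))
          where
          Bⁱ≤ : Bⁱ ℚ.≤ 2ℚ ℚ.* (P ℚ.* Aʲ)
          Bⁱ≤ = cancel-≤ (^-pos 0<b j) (begin
            Bⁱ ℚ.* Bʲ                        ≡⟨ sym (^-homo-* b i j) ⟩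
            b ^ℚ (i ℕ.+ j)                   ≤⟨ proj₂ (proj₂ (^-continuous (i ℕ.+ j))) 0<a (1≤upper x<b) (lower<upper x a<x x<b) b<a+δ ⟩
            2ℚ ℚ.* a ^ℚ (i ℕ.+ j)            ≡⟨ cong (2ℚ ℚ.*_) (^-homo-* a i j) ⟩
            2ℚ ℚ.* (Aⁱ ℚ.* Aʲ)               ≤⟨ *-mono-≤ 0≤2 (ℚ.<⇒≤ (*-pos (^-pos 0<a i) 0<Aʲ)) ℚ.≤-refl
                                                  (*ʳ-≤ (ℚ.<⇒≤ 0<Aʲ) (ℚ.<⇒≤ (ℚ.≰⇒> ¬h))) ⟩
            2ℚ ℚ.* (P ℚ.* Bʲ ℚ.* Aʲ)         ≡⟨ solve 4 (λ d p q r → d :* (p :* q :* r) := d :* (p :* r) :* q) refl 2ℚ P Bʲ Aʲ ⟩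
            2ℚ ℚ.* (P ℚ.* Aʲ) ℚ.* Bʲ         ∎)

infixr 8 _^_

_^_ : (x : ℝ) {{1≤x : 1ℝ ≤ x}} → ℝ → ℝ
x ^ s = power x s

instance
  ^-positive : ∀ {x s} {{1≤x : 1ℝ ≤ x}} → 0ℝ < x ^ s
  ^-positive {x} {s} =
    let _ , t , 0<t , T = power x s .lower-inhabited
        q , 0<q , q<t   = dense 0<t
    in between 0<q (t , q<t , T)

  *-positive : ∀ {x y} {{0<x : 0ℝ < x}} {{0<y : 0ℝ < y}} → 0ℝ < x * y
  *-positive {x} {y} {{0<x}} {{0<y}} =
    let a , 0<a , a<x = positive-point 0<x
        c , 0<c , c<y = positive-point 0<y
        b , x<b       = upper-inhabited x
        d , y<d       = upper-inhabited y
        0<b           = ℚ.<-trans 0<a (lower<upper x a<x x<b)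
        0<d           = ℚ.<-trans 0<c (lower<upper y c<y y<d)
        q , 0<q , q<  = dense (<⊓ (<⊓ (*-pos 0<a 0<c) (*-pos 0<b 0<c)) (<⊓ (*-pos 0<a 0<d) (*-pos 0<b 0<d)))
    in between 0<q (box a<x x<b c<y y<d , q<)

  fromℕ-positive : ∀ {n} {{_ : ℕ.NonZero n}} → 0ℝ < fromℤ (+ n)
  fromℕ-positive {suc n} = let q , 0<q , q<n = dense (0<fromℕ n) in between 0<q q<n

{-# OPTIONS --safe #-}

-- Let n ≤ N < 3 n, so that q ≤ 9 n², and let B be about n / (8 log n).  By Chebyshev's
-- argument there are more than B primes in (B , n].  For two of them, x ≠ y, Dirichlet's
-- theorem gives an approximation w / z of a x y / q with z ≤ B.  Then x, y, z are pairwise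
-- coprime, so that w / (x y z) is a sum of fractions with these denominators, and it differs
-- from a / q by r / (q x y z), where r = a x y z - w q and |r| < q / B.  This is small enough
-- as soon as |r| / z is bounded by a power of log n.  If it never is, then z is always small;
-- since r determines x y z modulo q, there are few possible products x y z, and x, y are among
-- the at most 3 log n prime factors of such a product, so there are too few pairs x, y.
-- The powers of log n are absorbed by N ^ ε, as C may depend on ε.

module Submission where

-- Up to powers of log n there are as many data as pairs, so a logarithmic factor has to be gained.
-- About B² pairs compete with about 2 q / B remainders r. Given r, the product x y z is fixed
-- modulo q and is at most n² z, which leaves about n² z / q values. If only z ≤ B is known, this
-- makes about n² possibilities, slightly too many. If |r| / z exceeds a threshold `H` for every
-- pair, then z < q / (B H), so that x y z / q is below n² / (B H); since q ≤ 9 n², the total is at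
-- most B² times a fixed power of log n, divided by `H`. A large enough power of log n as `H`
-- therefore gives a contradiction. The positions among the prime factors cost only two further
-- logarithms, and the loss `W` in the final estimate is polynomial in log n.

module Arithmetic where

  open import Data.Fin.Base using (Fin; zero; suc; toℕ; fromℕ<; inject≤; combine; remQuot; punchIn)
  open import Data.Fin.Properties using (any?; pigeonhole; toℕ<n; fromℕ<-injective; inject≤-injective; combine-injective;
    combine-remQuot; injective⇒≤; punchIn-injective; punchInᵢ≢i)
  open import Data.Integer.Base as ℤ using (ℤ; +_; -[1+_])
  import Data.Integer.DivMod as ℤ
  import Data.Integer.Properties as ℤ
  import Data.Integer.Tactic.RingSolver as ℤ-Solver
  open import Data.List.Base using (List; []; _∷_; _++_; map; filter; upTo; length; lookup)
  open import Data.List.Membership.Propositional using (_∈_)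
  open import Data.List.Membership.Propositional.Properties
  open import Data.List.Properties using (length-map; length-upTo; length-++)
  open import Data.List.Relation.Unary.All as All using (All; []; _∷_)
  open import Data.List.Relation.Unary.All.Properties using (map⁺; ++⁺)
  open import Data.List.Relation.Unary.AllPairs using ([]; _∷_)
  open import Data.List.Relation.Unary.Any using (here; there)
  open import Data.List.Relation.Unary.Unique.Propositional using (Unique)
  open import Data.List.Relation.Unary.Unique.Propositional.Properties using (upTo⁺) renaming (filter⁺ to unique-filter⁺)
  open import Data.Nat
  open import Data.Nat.Coprimality as Coprime using (Coprime; coprime-Bézout; prime⇒coprime; coprime-divisor)
  open import Data.Nat.DivMod
  open import Data.Nat.Divisibility
  open import Data.Nat.GCD using (module Bézout)
  open import Data.Nat.Induction using (<-rec)
  open import Data.Nat.ListAction using (product)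
  open import Data.Nat.ListAction.Properties using (∈⇒∣product; product≢0)
  open import Data.Nat.Primality
  open import Data.Nat.Primality.Factorisation
  open import Data.Nat.Properties
  open import Data.Nat.Tactic.RingSolver using (solve-∀)
  open import Data.Product using (∃; ∃₂; _×_; _,_; proj₁; proj₂; uncurry)
  open import Data.Sum using (inj₁; inj₂)
  open import Relation.Binary.Definitions using (tri<; tri≈; tri>)
  open import Relation.Binary.PropositionalEquality
  open import Relation.Nullary

  -- Chebyshev's lower bound

  module Binomial where

    open import Data.Nat.Combinatorics using (_C_; nCk+nC[k+1]≡[n+1]C[k+1])

    absorption : ∀ n k → suc k * (suc n C suc k) ≡ suc n * (n C k)
    absorption zero    zero    = refl
    absorption zero    (suc k) = *-zeroʳ k
    absorption (suc n) zero    = begin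
      1 * (suc (suc n) C 1)                ≡⟨ cong (1 *_) (nCk+nC[k+1]≡[n+1]C[k+1] (suc n) 0) ⟨
      1 * (1 + suc n C 1)                  ≡⟨ *-distribˡ-+ 1 1 (suc n C 1) ⟩
      1 + 1 * (suc n C 1)                  ≡⟨ cong suc (absorption n 0) ⟩
      1 + suc n * 1                        ∎
      where open ≡-Reasoning
    absorption (suc n) (suc k) = begin
      suc (suc k) * (suc (suc n) C suc (suc k))        ≡⟨ cong (suc (suc k) *_) (nCk+nC[k+1]≡[n+1]C[k+1] (suc n) (suc k)) ⟨
      suc (suc k) * (x + suc n C suc (suc k))          ≡⟨ *-distribˡ-+ (suc (suc k)) x _ ⟩
      (x + suc k * x) + suc (suc k) * (suc n C suc (suc k)) ≡⟨ cong₂ (λ u v → (x + u) + v) (absorption n k) (absorption n (suc k)) ⟩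
      (x + suc n * (n C k)) + suc n * (n C suc k)      ≡⟨ +-assoc x _ _ ⟩
      x + (suc n * (n C k) + suc n * (n C suc k))      ≡⟨ cong (λ u → x + u) (*-distribˡ-+ (suc n) (n C k) (n C suc k)) ⟨
      x + suc n * (n C k + n C suc k)                  ≡⟨ cong (λ u → x + suc n * u) (nCk+nC[k+1]≡[n+1]C[k+1] n k) ⟩
      x + suc n * x                                    ∎
      where
      open ≡-Reasoning
      x = suc n C suc k

    -- By Pascal's rule the next central coefficient is the sum of two entries of the row in
    -- between, each at least `(k + k) C k`. So the central coefficients at least double.
    2^k≤C : ∀ k → 2 ^ k ≤ (k + k) C k
    2^k≤C zero = ≤-refl
    2^k≤C (suc k) rewrite +-suc k k = begin
      2 * 2 ^ k                                              ≤⟨ *-monoʳ-≤ 2 (2^k≤C k) ⟩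
      2 * ((k + k) C k)                                      ≡⟨ cong (λ u → (k + k) C k + u) (+-identityʳ _) ⟩
      (k + k) C k + (k + k) C k                              ≤⟨ +-mono-≤ (lower k) upper ⟩
      suc (k + k) C k + suc (k + k) C suc k                  ≡⟨ nCk+nC[k+1]≡[n+1]C[k+1] (suc (k + k)) k ⟩
      suc (suc (k + k)) C suc k                              ∎
      where
      open ≤-Reasoning
      upper : (k + k) C k ≤ suc (k + k) C suc k
      upper = subst ((k + k) C k ≤_) (nCk+nC[k+1]≡[n+1]C[k+1] (k + k) k) (m≤m+n _ _)
      lower : ∀ j {n} → n C j ≤ suc n C j
      lower zero        = ≤-refl
      lower (suc j) {n} = subst (n C suc j ≤_) (nCk+nC[k+1]≡[n+1]C[k+1] n j) (m≤n+m _ _)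

    -- The hypothesis says 1 / w ≡ 1 / u - 1 / v.
    ∣-harmonic : ∀ {u v w D} .{{_ : NonZero D}} → w * v ≡ u * v + w * u → u ∣ D → v ∣ D → w ∣ D
    ∣-harmonic {u} {v} {w} {D} eq u∣D@(divides d D≡du) v∣D@(divides e D≡ev) =
      ∣m+n∣m⇒∣n (subst (w ∣_) wd≡we+D (m∣m*n d)) (m∣m*n e)
      where
      open ≡-Reasoning
      instance
        u≢0 : NonZero u
        u≢0 = ≢-nonZero λ { refl → ≢-nonZero⁻¹ D (0∣⇒≡0 u∣D) }
        v≢0 : NonZero v
        v≢0 = ≢-nonZero λ { refl → ≢-nonZero⁻¹ D (0∣⇒≡0 v∣D) }
        uv≢0 : NonZero (u * v)
        uv≢0 = m*n≢0 u v
      -- With d = D / u and e = D / v this is w (D / u - D / v) = D.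
      wd≡we+D : w * d ≡ w * e + D
      wd≡we+D = *-cancelʳ-≡ (w * d) (w * e + D) (u * v) (begin
        w * d * (u * v)                 ≡⟨ ring₀ w d u v ⟩
        w * v * (d * u)                 ≡⟨ cong₂ _*_ eq (sym D≡du) ⟩
        (u * v + w * u) * D             ≡⟨ *-distribʳ-+ D (u * v) (w * u) ⟩
        u * v * D + w * u * D           ≡⟨ cong (λ z → u * v * D + w * u * z) D≡ev ⟩
        u * v * D + w * u * (e * v)     ≡⟨ ring u v w e D ⟩
        (w * e + D) * (u * v)           ∎)
        where
        ring₀ : ∀ w d u v → w * d * (u * v) ≡ w * v * (d * u)
        ring₀ = solve-∀
        ring : ∀ u v w e D → u * v * D + w * u * (e * v) ≡ (w * e + D) * (u * v)
        ring = solve-∀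

    -- The numbers `suc n * (n C k)` are the denominators of Leibniz's harmonic triangle. Its edge k
    -- = 0 is 1, 1/2, 1/3, ..., and every other entry is an entry of the row above minus its left
    -- neighbour. This bounds common multiples from below without computing the exponents of primes
    -- in a binomial coefficient.
    leibniz-∣ : ∀ {D} .{{_ : NonZero D}} n k → k ≤ n → (∀ i → NonZero i → i ≤ suc n → i ∣ D) →
                suc n * (n C k) ∣ D
    leibniz-∣ {D} n zero _ common = subst (_∣ D) (sym (*-identityʳ (suc n))) (common (suc n) _ ≤-refl)
    leibniz-∣ {D} (suc n) (suc k) (s≤s k≤n) common = ∣-harmonic identity
      (leibniz-∣ n k k≤n λ i i≢0 i≤n → common i i≢0 (m≤n⇒m≤1+n i≤n))
      (leibniz-∣ (suc n) k (m≤n⇒m≤1+n k≤n) common)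
      where
      open ≡-Reasoning
      N = suc (suc n)
      X = suc n C k
      Y = suc n C suc k
      u = suc n * (n C k)
      N*X : N * X ≡ suc k * (X + Y)
      N*X = trans (sym (absorption (suc n) k)) (cong (suc k *_) (sym (nCk+nC[k+1]≡[n+1]C[k+1] (suc n) k)))
      ring₁ : ∀ N Y k X → N * Y * (k * (X + Y)) ≡ k * Y * (N * X) + N * Y * (k * Y)
      ring₁ = solve-∀
      identity : N * Y * (N * X) ≡ u * (N * X) + N * Y * u
      identity = begin
        N * Y * (N * X)                               ≡⟨ cong (N * Y *_) N*X ⟩
        N * Y * (suc k * (X + Y))                     ≡⟨ ring₁ N Y (suc k) X ⟩
        suc k * Y * (N * X) + N * Y * (suc k * Y)     ≡⟨ cong (λ z → z * (N * X) + N * Y * z) (absorption n k) ⟩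
        u * (N * X) + N * Y * u                       ∎

    2^k≤common-multiple : ∀ {D} .{{_ : NonZero D}} k → (∀ i → NonZero i → i ≤ suc (k + k) → i ∣ D) → 2 ^ k ≤ D
    2^k≤common-multiple {D} k common = begin
      2 ^ k                              ≤⟨ 2^k≤C k ⟩
      (k + k) C k                        ≤⟨ m≤n*m _ (suc (k + k)) ⟩
      suc (k + k) * ((k + k) C k)        ≤⟨ ∣⇒≤ (leibniz-∣ (k + k) k (m≤m+n k k) common) ⟩
      D                                  ∎
      where open ≤-Reasoning

  open Binomial using (2^k≤common-multiple)

  n<2^n : ∀ n → n < 2 ^ n
  n<2^n zero    = ≤-refl
  n<2^n (suc n) = begin-strict
    suc n                <⟨ s≤s (n<2^n n) ⟩
    1 + 2 ^ n            ≤⟨ +-monoˡ-≤ (2 ^ n) (m^n>0 2 n) ⟩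
    2 ^ n + 2 ^ n        ≡⟨ cong (λ u → 2 ^ n + u) (sym (+-identityʳ (2 ^ n))) ⟩
    2 * 2 ^ n            ∎
    where open ≤-Reasoning

  -- Prime powers up to n

  module TopPower (p n : ℕ) where

    upTo-exponent : ℕ → ℕ
    upTo-exponent zero = 1
    upTo-exponent (suc e) with p ^ suc e ≤? n
    ... | yes _ = p ^ suc e
    ... | no  _ = upTo-exponent e

    -- The downward search may start at exponent n: for p ≥ 2, `p ^ v ≤ n` forces v < 2 ^ v ≤ p ^ v
    -- ≤ n.
    topPower : ℕ
    topPower = upTo-exponent n

    topPower≤ : 1 ≤ n → topPower ≤ n
    topPower≤ 1≤n = go n
      where
      go : ∀ e → upTo-exponent e ≤ n
      go zero = 1≤n
      go (suc e) with p ^ suc e ≤? n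
      ... | yes h = h
      ... | no  _ = go e

    topPower≢0 : .{{_ : NonZero p}} → NonZero topPower
    topPower≢0 = go n
      where
      go : ∀ e → NonZero (upTo-exponent e)
      go zero = _
      go (suc e) with p ^ suc e ≤? n
      ... | yes _ = m^n≢0 p (suc e)
      ... | no  _ = go e

    ∣topPower : .{{_ : NonTrivial p}} → ∀ v → p ^ v ≤ n → p ^ v ∣ topPower
    ∣topPower v pᵛ≤n = go n (begin
      v         ≤⟨ <⇒≤ (n<2^n v) ⟩
      2 ^ v     ≤⟨ ^-monoˡ-≤ v (nonTrivial⇒n>1 p) ⟩
      p ^ v     ≤⟨ pᵛ≤n ⟩
      n         ∎)
      where
      open ≤-Reasoning
      go : ∀ e → v ≤ e → p ^ v ∣ upTo-exponent e
      go zero z≤n = ∣-refl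
      go (suc e) v≤ with p ^ suc e ≤? n | m≤n⇒m<n∨m≡n v≤
      ... | no  h | inj₁ (s≤s v≤e) = go e v≤e
      ... | no  h | inj₂ refl      = contradiction pᵛ≤n h
      ... | yes _ | _ = divides (p ^ (suc e ∸ v)) (begin-equality
        p ^ suc e                       ≡⟨ cong (p ^_) (m∸n+n≡m v≤) ⟨
        p ^ (suc e ∸ v + v)             ≡⟨ ^-distribˡ-+-* p (suc e ∸ v) v ⟩
        p ^ (suc e ∸ v) * p ^ v         ∎)

  open TopPower using (topPower; topPower≤; topPower≢0; ∣topPower)

  split-power : ∀ {p} .{{_ : NonTrivial p}} n → .{{_ : NonZero n}} → ∃₂ λ v m → n ≡ p ^ v * m × p ∤ m
  split-power {p} = <-rec _ λ n rec → go n rec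
    where
    go : ∀ n → (∀ {m} → m < n → .{{_ : NonZero m}} → ∃₂ λ v k → m ≡ p ^ v * k × p ∤ k) →
         .{{_ : NonZero n}} → ∃₂ λ v m → n ≡ p ^ v * m × p ∤ m
    go n rec with p ∣? n
    ... | no  p∤n = 0 , n , sym (+-identityʳ n) , p∤n
    ... | yes p∣n =
      let v , m , eq , p∤m = rec (quotient-< p∣n) {{quotient≢0 p∣n}}
      in suc v , m , trans (m∣n⇒n≡m*quotient p∣n) (trans (cong (p *_) eq) (sym (*-assoc p (p ^ v) m))) , p∤m

  prime-power-∣ : ∀ {p} → Prime p → ∀ v {m n} → p ∤ m → p ^ v ∣ m * n → p ^ v ∣ n
  prime-power-∣ pr zero _ _ = 1∣ _
  prime-power-∣ {p} pr (suc v) {m} {n} p∤m h with euclidsLemma m n pr (m*n∣⇒m∣ p (p ^ v) h)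
  ... | inj₁ p∣m = contradiction p∣m p∤m
  ... | inj₂ (divides k refl) = subst (p * p ^ v ∣_) (*-comm p k)
    (*-monoʳ-∣ p (prime-power-∣ pr v p∤m (*-cancelˡ-∣ p {{prime⇒nonZero pr}}
      (subst (p * p ^ v ∣_) (ring m k p) h))))
    where
    ring : ∀ m k p → m * (k * p) ≡ p * (m * k)
    ring = solve-∀

  prime-divisor : ∀ n → .{{NonTrivial n}} → ∃ λ p → Prime p × p ∣ n
  prime-divisor n = go (factorise n {{nonTrivial⇒nonZero n}})
    where
    go : PrimeFactorisation n → ∃ λ p → Prime p × p ∣ n
    go record { factors = [] ; isFactorisation = eq } = contradiction eq (nonTrivial⇒≢1)
    go record { factors = p ∷ ps ; isFactorisation = eq ; factorsPrime = pr ∷ _ } =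
      p , pr , subst (p ∣_) (sym eq) (m∣m*n (product ps))

  -- Strong induction on i: take a prime factor p and write i = p ^ v m with p not dividing m. The
  -- smaller number m divides D, and since m is prime to p, the cofactor D / m still contains all of
  -- p ^ v.
  ∣-from-prime-powers : ∀ {D} N → (∀ p v → Prime p → p ^ v ≤ N → p ^ v ∣ D) →
                        ∀ i → NonZero i → i ≤ N → i ∣ D
  ∣-from-prime-powers {D} N powers = <-rec _ go
    where
    go : ∀ i → (∀ {j} → j < i → NonZero j → j ≤ N → j ∣ D) → NonZero i → i ≤ N → i ∣ D
    go 1 _ _ _ = 1∣ D
    go i@(2+ _) rec _ i≤N
      with p , pr , p∣i ← prime-divisor i
      with v , m , eq , p∤m ← split-power {p} {{prime⇒nonTrivial pr}} i
      = subst (_∣ D) (trans (*-comm m (p ^ v)) (sym eq)) mpᵛ∣D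
      where
      instance
        _ = prime⇒nonTrivial pr
        _ = prime⇒nonZero pr
        m≢0 : NonZero m
        m≢0 = ≢-nonZero λ { refl → p∤m (p ∣0) }
      v≢0 : v ≢ 0
      v≢0 refl = p∤m (subst (p ∣_) (trans eq (+-identityʳ m)) p∣i)
      2≤pᵛ : 2 ≤ p ^ v
      2≤pᵛ = ≤-trans (nonTrivial⇒n>1 p) (subst (_≤ p ^ v) (^-identityʳ p) (^-monoʳ-≤ p (n≢0⇒n>0 v≢0)))
      m<i : m < i
      m<i = subst (m <_) (sym eq) (subst (_< p ^ v * m) (+-identityʳ m) (*-monoˡ-< m 2≤pᵛ))
      m∣D : m ∣ D
      m∣D = rec m<i m≢0 (≤-trans (<⇒≤ m<i) i≤N)
      mpᵛ∣D : m * p ^ v ∣ D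
      mpᵛ∣D = let divides d D≡dm = m∣D in
        subst (m * p ^ v ∣_) (trans (*-comm m d) (sym D≡dm)) (*-monoʳ-∣ m
          (prime-power-∣ pr v p∤m (subst (p ^ v ∣_) (trans D≡dm (*-comm d m))
            (powers p v pr (≤-trans (subst (p ^ v ≤_) (sym eq) (m≤m*n (p ^ v) m)) i≤N)))))

  primesBetween : ℕ → ℕ → List ℕ
  primesBetween B n = filter (λ p → B <? p ×-dec prime? p) (upTo (suc n))

  product≤^ : ∀ {n} (f : ℕ → ℕ) → (∀ p → f p ≤ n) → ∀ ps → product (map f ps) ≤ n ^ length ps
  product≤^ f f≤ []       = ≤-refl
  product≤^ f f≤ (p ∷ ps) = *-mono-≤ (f≤ p) (product≤^ f f≤ ps)

  -- The least common multiple of 1, …, n is at least 2 ^ ⌊(n - 1) / 2⌋, while it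
  -- divides the product, over the primes p ≤ n, of the largest power of p up to n.
  chebyshev : ∀ {n L} B → n < 2 ^ L → ∀ k → suc (k + k) ≤ n → k ≤ L * (B + length (primesBetween B n))
  chebyshev {n} {L} B n<2^L k 2k<n = ≮⇒≥ λ small → <⇒≱ (^-monoʳ-< 2 (s≤s (s≤s z≤n)) small) (begin
      2 ^ k                          ≤⟨ 2^k≤common-multiple k (∣-from-prime-powers (suc (k + k)) powers) ⟩
      D                              ≤⟨ product≤^ (λ p → topPower p n) (λ p → topPower≤ p n 1≤n) ps ⟩
      n ^ length ps                  ≤⟨ ^-monoˡ-≤ (length ps) (<⇒≤ n<2^L) ⟩
      (2 ^ L) ^ length ps            ≡⟨ ^-*-assoc 2 L (length ps) ⟩
      2 ^ (L * length ps)            ≡⟨ cong (λ l → 2 ^ (L * l)) length-ps ⟩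
      2 ^ (L * (B + length S))       ∎)
    where
    open ≤-Reasoning
    1≤n : 1 ≤ n
    1≤n = ≤-trans (s≤s z≤n) 2k<n
    S = primesBetween B n
    smalls = map suc (upTo B)
    ps = smalls ++ S
    length-ps : length ps ≡ B + length S
    length-ps = trans (length-++ smalls) (cong (_+ length S) (trans (length-map suc (upTo B)) (length-upTo B)))
    D = product (map (λ p → topPower p n) ps)
    factors≢0 : All NonZero (map (λ p → topPower p n) ps)
    factors≢0 = map⁺ (All.map (λ p≢0 → topPower≢0 _ n {{p≢0}}) (++⁺
      (map⁺ (All.universal _ (upTo B)))
      (All.tabulate λ p∈S → prime⇒nonZero (proj₂ (proj₂ (∈-filter⁻ (λ p → B <? p ×-dec prime? p) {xs = upTo (suc n)} p∈S))))))
    instance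
      D≢0 : NonZero D
      D≢0 = product≢0 factors≢0
    p∈ps : ∀ {p} → Prime p → p ≤ n → p ∈ ps
    p∈ps {zero}  pr _ = contradiction pr ¬prime[0]
    p∈ps {suc p} pr p≤n with B <? suc p
    ... | yes B<p = ∈-++⁺ʳ smalls (∈-filter⁺ (λ p → B <? p ×-dec prime? p) (∈-upTo⁺ (s≤s p≤n)) (B<p , pr))
    ... | no  B≮p = ∈-++⁺ˡ (∈-map⁺ suc (∈-upTo⁺ (≮⇒≥ B≮p)))
    powers : ∀ p v → Prime p → p ^ v ≤ suc (k + k) → p ^ v ∣ D
    powers p zero    pr _ = 1∣ D
    powers p (suc v) pr pᵛ≤ = ∣-trans (∣topPower p n {{prime⇒nonTrivial pr}} (suc v) (≤-trans pᵛ≤ 2k<n))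
      (∈⇒∣product (∈-map⁺ (λ p → topPower p n) (p∈ps pr
        (≤-trans (m≤m*n p (p ^ v) {{m^n≢0 p v {{prime⇒nonZero pr}}}}) (≤-trans pᵛ≤ 2k<n)))))

  -- Dirichlet approximation and partial fractions

  /-≡⇒∣-∣< : ∀ {m n q} .{{_ : NonZero q}} → m / q ≡ n / q → ∣ m - n ∣ < q
  /-≡⇒∣-∣< {m} {n} {q} eq = begin-strict
    ∣ m - n ∣                                        ≡⟨ cong₂ ∣_-_∣ (m≡m%n+[m/n]*n m q) (m≡m%n+[m/n]*n n q) ⟩
    ∣ m % q + m / q * q - n % q + n / q * q ∣        ≡⟨ cong (λ k → ∣ m % q + m / q * q - n % q + k * q ∣) eq ⟨
    ∣ m % q + m / q * q - n % q + m / q * q ∣        ≡⟨ cong₂ ∣_-_∣ (+-comm (m % q) _) (+-comm (n % q) _) ⟩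
    ∣ m / q * q + m % q - m / q * q + n % q ∣        ≡⟨ ∣m+n-m+o∣≡∣n-o∣ (m / q * q) (m % q) (n % q) ⟩
    ∣ m % q - n % q ∣                                ≤⟨ ∣m-n∣≤m⊔n (m % q) (n % q) ⟩
    m % q ⊔ n % q                                    <⟨ ⊔-lub (m%n<n m q) (m%n<n n q) ⟩
    q                                                ∎
    where open ≤-Reasoning

  ∣⊖∣≡∣-∣ : ∀ m n → ℤ.∣ m ℤ.⊖ n ∣ ≡ ∣ m - n ∣
  ∣⊖∣≡∣-∣ zero    zero    = refl
  ∣⊖∣≡∣-∣ zero    (suc n) = refl
  ∣⊖∣≡∣-∣ (suc m) zero    = refl
  ∣⊖∣≡∣-∣ (suc m) (suc n) = trans (cong ℤ.∣_∣ (ℤ.[1+m]⊖[1+n]≡m⊖n m n)) (∣⊖∣≡∣-∣ m n)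

  ∣+-+∣ : ∀ m n → ℤ.∣ + m ℤ.- + n ∣ ≡ ∣ m - n ∣
  ∣+-+∣ m n = trans (cong ℤ.∣_∣ (ℤ.[+m]-[+n]≡m⊖n m n)) (∣⊖∣≡∣-∣ m n)

  -- Integral form of Dirichlet's theorem for the rational `c / q`: the error of `w / z` is
  -- `r / (q z)`, with |r| < q / B.
  record DirichletApproximation (c : ℤ) (q B : ℕ) : Set where
    field
      z         : ℕ
      r w       : ℤ
      z≢0       : NonZero z
      z≤B       : z ≤ B
      remainder : c ℤ.* + z ≡ r ℤ.+ w ℤ.* + q
      small     : ℤ.∣ r ∣ * B < q

  module _ (c : ℤ) (q B : ℕ) .{{_ : NonZero q}} where

    private
      residue : ℕ → ℕ
      residue k = (c ℤ.* + k) ℤ.%ℕ q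

      ratio : ℕ → ℤ
      ratio k = (c ℤ.* + k) ℤ./ℕ q

      bucket< : .{{_ : NonZero B}} → ∀ k → residue k * B / q < B
      bucket< k = m<n*o⇒m/o<n (subst (residue k * B <_) (*-comm q B) (*-monoˡ-< B (ℤ.n%ℕd<d (c ℤ.* + k) q)))

    same-bucket : ∀ {i j} → i < j → j ≤ B → residue i * B / q ≡ residue j * B / q → DirichletApproximation c q B
    same-bucket {i} {j} i<j j≤B eq = record
      { z         = j ∸ i
      ; r         = + residue j ℤ.- + residue i
      ; w         = ratio j ℤ.- ratio i
      ; z≢0       = ≢-nonZero (m>n⇒m∸n≢0 i<j)
      ; z≤B       = ≤-trans (m∸n≤m j i) j≤B
      ; remainder = remainder
      ; small     = let open ≤-Reasoning in begin-strict
          ℤ.∣ + residue j ℤ.- + residue i ∣ * B  ≡⟨ cong (_* B) (∣+-+∣ (residue j) (residue i)) ⟩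
          ∣ residue j - residue i ∣ * B          ≡⟨ *-distribʳ-∣-∣ B (residue j) (residue i) ⟩
          ∣ residue j * B - residue i * B ∣      <⟨ /-≡⇒∣-∣< {residue j * B} (sym eq) ⟩
          q                                      ∎
      }
      where
      remainder : c ℤ.* + (j ∸ i) ≡ (+ residue j ℤ.- + residue i) ℤ.+ (ratio j ℤ.- ratio i) ℤ.* + q
      remainder = begin
        c ℤ.* + (j ∸ i)                           ≡⟨ cong (c ℤ.*_) (ℤ.⊖-≥ (<⇒≤ i<j)) ⟨
        c ℤ.* (j ℤ.⊖ i)                           ≡⟨ cong (c ℤ.*_) (ℤ.[+m]-[+n]≡m⊖n j i) ⟨
        c ℤ.* (+ j ℤ.- + i)                       ≡⟨ ring₁ c (+ j) (+ i) ⟩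
        c ℤ.* + j ℤ.- c ℤ.* + i                   ≡⟨ cong₂ ℤ._-_ (ℤ.a≡a%ℕn+[a/ℕn]*n (c ℤ.* + j) q) (ℤ.a≡a%ℕn+[a/ℕn]*n (c ℤ.* + i) q) ⟩
        (+ residue j ℤ.+ ratio j ℤ.* + q) ℤ.- (+ residue i ℤ.+ ratio i ℤ.* + q)
                                                  ≡⟨ ring₂ (+ residue j) (+ residue i) (ratio j) (ratio i) (+ q) ⟩
        (+ residue j ℤ.- + residue i) ℤ.+ (ratio j ℤ.- ratio i) ℤ.* + q ∎
        where
        open ≡-Reasoning
        ring₁ : ∀ c j i → c ℤ.* (j ℤ.- i) ≡ c ℤ.* j ℤ.- c ℤ.* i
        ring₁ = ℤ-Solver.solve-∀
        ring₂ : ∀ r s v w q → (r ℤ.+ v ℤ.* q) ℤ.- (s ℤ.+ w ℤ.* q) ≡ (r ℤ.- s) ℤ.+ (v ℤ.- w) ℤ.* q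
        ring₂ = ℤ-Solver.solve-∀

    -- Pigeonhole: the residues modulo q of the B + 1 multiples 0, c, ..., B c fall into B buckets
    -- of width q / B. Two multiples in the same bucket give z as the difference of their indices
    -- and r as the difference of their residues.
    dirichlet : .{{_ : NonZero B}} → DirichletApproximation c q B
    dirichlet with i , j , i<j , eq ← pigeonhole (n<1+n B) (λ i → fromℕ< (bucket< (toℕ i)))
      = same-bucket i<j (s≤s⁻¹ (toℕ<n j)) (fromℕ<-injective _ _ (bucket< (toℕ i)) (bucket< (toℕ j)) eq)

  bézout : ∀ {m n} → Coprime m n → ∃₂ λ u v → u ℤ.* + m ℤ.+ v ℤ.* + n ≡ + 1
  bézout {m} {n} co = go (coprime-Bézout co)
    where
    cast : ∀ {x y k l} → 1 + y * l ≡ x * k → + 1 ≡ + x ℤ.* + k ℤ.+ ℤ.- (+ y) ℤ.* + l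
    cast {x} {y} {k} {l} eq = begin
      + 1                                                       ≡⟨ ring (+ y) (+ l) ⟩
      (+ 1 ℤ.+ + y ℤ.* + l) ℤ.+ ℤ.- (+ y) ℤ.* + l               ≡⟨ cong (λ e → (+ 1 ℤ.+ e) ℤ.+ ℤ.- (+ y) ℤ.* + l) (ℤ.pos-* y l) ⟨
      + (1 + y * l) ℤ.+ ℤ.- (+ y) ℤ.* + l                       ≡⟨ cong (λ e → + e ℤ.+ ℤ.- (+ y) ℤ.* + l) eq ⟩
      + (x * k) ℤ.+ ℤ.- (+ y) ℤ.* + l                           ≡⟨ cong (ℤ._+ ℤ.- (+ y) ℤ.* + l) (ℤ.pos-* x k) ⟩
      + x ℤ.* + k ℤ.+ ℤ.- (+ y) ℤ.* + l                         ∎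
      where
      open ≡-Reasoning
      ring : ∀ y l → + 1 ≡ (+ 1 ℤ.+ y ℤ.* l) ℤ.+ ℤ.- y ℤ.* l
      ring = ℤ-Solver.solve-∀
    go : Bézout.Identity 1 m n → ∃₂ λ u v → u ℤ.* + m ℤ.+ v ℤ.* + n ≡ + 1
    go (Bézout.+- x y eq) = + x , ℤ.- (+ y) , sym (cast {x} {y} {m} {n} eq)
    go (Bézout.-+ x y eq) = ℤ.- (+ x) , + y ,
      trans (ℤ.+-comm (ℤ.- (+ x) ℤ.* + m) (+ y ℤ.* + n)) (sym (cast {y} {x} {n} {m} eq))

  -- The product of the Bézout identities for x, y and for x, z has the form v v′ y z + x e = 1.
  -- Only the term x e is left to be split, and multiplying it by s y + t z = 1 does so.
  partial-fractions : ∀ {x y z} → Coprime x y → Coprime x z → Coprime y z → ∀ w →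
    ∃ λ a → ∃₂ λ b c → a ℤ.* (+ y ℤ.* + z) ℤ.+ b ℤ.* (+ x ℤ.* + z) ℤ.+ c ℤ.* (+ x ℤ.* + y) ≡ w
  partial-fractions {x} {y} {z} xy xz yz w
    with u , v , uv ← bézout xy
    with u′ , v′ , uv′ ← bézout xz
    with s , t , st ← bézout yz =
    let e = u ℤ.* u′ ℤ.* + x ℤ.+ u ℤ.* v′ ℤ.* + z ℤ.+ v ℤ.* u′ ℤ.* + y in
    w ℤ.* v ℤ.* v′ , w ℤ.* e ℤ.* t , w ℤ.* e ℤ.* s ,
    trans (ring (+ x) (+ y) (+ z) w u v u′ v′ s t)
      (trans (cong₂ (λ f g → w ℤ.* (v ℤ.* v′ ℤ.* + y ℤ.* + z ℤ.+ f) ℤ.+ g) (cong (λ f → + x ℤ.* e ℤ.* f) st) refl)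
      (trans (ring′ (+ x) (+ y) (+ z) w u v u′ v′)
      (trans (cong₂ (λ f g → w ℤ.* (f ℤ.* g)) uv uv′) (ring″ w))))
    where
    ring : ∀ x y z w u v u′ v′ s t → let e = u ℤ.* u′ ℤ.* x ℤ.+ u ℤ.* v′ ℤ.* z ℤ.+ v ℤ.* u′ ℤ.* y in
      w ℤ.* v ℤ.* v′ ℤ.* (y ℤ.* z) ℤ.+ w ℤ.* e ℤ.* t ℤ.* (x ℤ.* z) ℤ.+ w ℤ.* e ℤ.* s ℤ.* (x ℤ.* y)
        ≡ w ℤ.* (v ℤ.* v′ ℤ.* y ℤ.* z ℤ.+ x ℤ.* e ℤ.* (s ℤ.* y ℤ.+ t ℤ.* z)) ℤ.+ + 0
    ring = ℤ-Solver.solve-∀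
    ring′ : ∀ x y z w u v u′ v′ → let e = u ℤ.* u′ ℤ.* x ℤ.+ u ℤ.* v′ ℤ.* z ℤ.+ v ℤ.* u′ ℤ.* y in
      w ℤ.* (v ℤ.* v′ ℤ.* y ℤ.* z ℤ.+ x ℤ.* e ℤ.* + 1) ℤ.+ + 0
        ≡ w ℤ.* ((u ℤ.* x ℤ.+ v ℤ.* y) ℤ.* (u′ ℤ.* x ℤ.+ v′ ℤ.* z))
    ring′ = ℤ-Solver.solve-∀
    ring″ : ∀ w → w ℤ.* (+ 1 ℤ.* + 1) ≡ w
    ring″ = ℤ-Solver.solve-∀

  distinct-primes-coprime : ∀ {x y} → Prime x → Prime y → x ≢ y → Coprime x y
  distinct-primes-coprime {x} {y} px py x≢y with <-cmp x y
  ... | tri< x<y _ _ = Coprime.sym (prime⇒coprime py {{prime⇒nonZero px}} x<y)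
  ... | tri≈ _ x≡y _ = contradiction x≡y x≢y
  ... | tri> _ _ y<x = prime⇒coprime px {{prime⇒nonZero py}} y<x

  -- Subtracting the equations shows that q divides a (t - t′), hence t - t′, as a is prime to q;
  -- equal quotients by q force |t - t′| < q.
  residue-determines : ∀ {a q t t′ r w w′} .{{_ : NonZero q}} → Coprime ℤ.∣ a ∣ q →
    a ℤ.* + t ≡ r ℤ.+ w ℤ.* + q → a ℤ.* + t′ ≡ r ℤ.+ w′ ℤ.* + q → t / q ≡ t′ / q → t ≡ t′
  residue-determines {a} {q} {t} {t′} {r} {w} {w′} co at at′ t/q = ∣m-n∣≡0⇒m≡n (≮0⇒≡0 (coprime-divisor (Coprime.sym co) q∣))
    where
    open ≡-Reasoning
    ring₁ : ∀ a t t′ → a ℤ.* (t ℤ.- t′) ≡ a ℤ.* t ℤ.- a ℤ.* t′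
    ring₁ = ℤ-Solver.solve-∀
    ring₂ : ∀ r w w′ q → (r ℤ.+ w ℤ.* q) ℤ.- (r ℤ.+ w′ ℤ.* q) ≡ (w ℤ.- w′) ℤ.* q
    ring₂ = ℤ-Solver.solve-∀
    q∣ : q ∣ ℤ.∣ a ∣ * ∣ t - t′ ∣
    q∣ = divides ℤ.∣ w ℤ.- w′ ∣ (begin
      ℤ.∣ a ∣ * ∣ t - t′ ∣                      ≡⟨ cong (ℤ.∣ a ∣ *_) (∣+-+∣ t t′) ⟨
      ℤ.∣ a ∣ * ℤ.∣ + t ℤ.- + t′ ∣              ≡⟨ ℤ.abs-* a (+ t ℤ.- + t′) ⟨
      ℤ.∣ a ℤ.* (+ t ℤ.- + t′) ∣                ≡⟨ cong ℤ.∣_∣ (ring₁ a (+ t) (+ t′)) ⟩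
      ℤ.∣ a ℤ.* + t ℤ.- a ℤ.* + t′ ∣            ≡⟨ cong₂ (λ u v → ℤ.∣ u ℤ.- v ∣) at at′ ⟩
      _                                         ≡⟨ cong ℤ.∣_∣ (ring₂ r w w′ (+ q)) ⟩
      ℤ.∣ (w ℤ.- w′) ℤ.* + q ∣                  ≡⟨ ℤ.abs-* (w ℤ.- w′) (+ q) ⟩
      ℤ.∣ w ℤ.- w′ ∣ * q                        ∎)
    ≮0⇒≡0 : q ∣ ∣ t - t′ ∣ → ∣ t - t′ ∣ ≡ 0
    ≮0⇒≡0 q∣d with ∣ t - t′ ∣ | /-≡⇒∣-∣< {t} {t′} {q} t/q
    ... | zero  | _   = refl
    ... | suc d | d<q = contradiction (∣⇒≤ q∣d) (<⇒≱ d<q)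

  -- The counting argument

  lookup-injective : ∀ {A : Set} {xs : List A} → Unique xs → ∀ {i j} → lookup xs i ≡ lookup xs j → i ≡ j
  lookup-injective (_  ∷ _)  {zero}  {zero}  _  = refl
  lookup-injective (x≢ ∷ _)  {zero}  {suc j} eq = contradiction eq (All.lookup x≢ (∈-lookup j))
  lookup-injective (x≢ ∷ _)  {suc i} {zero}  eq = contradiction (sym eq) (All.lookup x≢ (∈-lookup i))
  lookup-injective (_  ∷ xs) {suc i} {suc j} eq = cong suc (lookup-injective xs eq)

  record PrimeFamily (k B n : ℕ) : Set where
    field
      member    : Fin k → ℕ
      injective : ∀ {i j} → member i ≡ member j → i ≡ j
      isPrime   : ∀ i → Prime (member i)
      above     : ∀ i → B < member i
      below     : ∀ i → member i ≤ n

  many-primes : ∀ {n L B} → 1 ≤ L → 1 ≤ B → n < 2 ^ L → 8 * (L * B) ≤ n → PrimeFamily (suc B) B n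
  many-primes {n} {L} {B} 1≤L 1≤B n<2^L 8LB≤n = record
    { member    = λ i → lookup S (index i)
    ; injective = λ eq → inject≤-injective B<s B<s _ _ (lookup-injective (unique-filter⁺ P? (upTo⁺ (suc n))) eq)
    ; isPrime   = λ i → proj₂ (proj₂ (mem (index i)))
    ; above     = λ i → proj₁ (proj₂ (mem (index i)))
    ; below     = λ i → s≤s⁻¹ (∈-upTo⁻ (proj₁ (mem (index i))))
    }
    where
    P? = λ p → B <? p ×-dec prime? p
    S = primesBetween B n
    s = length S
    -- If (B , n] contained at most B primes, `chebyshev` would give k ≤ L (B + B) = 2 L B, so 3 is
    -- the least usable factor. It requires 2 k + 1 ≤ n, for which 7 L B ≤ n is enough.
    k = 3 * (L * B)
    1≤LB : 1 ≤ L * B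
    1≤LB = *-mono-≤ 1≤L 1≤B
    2k<n : suc (k + k) ≤ n
    2k<n = begin
      1 + (k + k)                        ≤⟨ +-monoˡ-≤ (k + k) 1≤LB ⟩
      L * B + (k + k)                    ≤⟨ m≤n+m _ (L * B) ⟩
      L * B + (L * B + (k + k))          ≡⟨ ring (L * B) ⟩
      8 * (L * B)                        ≤⟨ 8LB≤n ⟩
      n                                  ∎
      where
      open ≤-Reasoning
      ring : ∀ x → x + (x + (3 * x + 3 * x)) ≡ 8 * x
      ring = solve-∀
    B<s : B < s
    B<s = ≰⇒> λ s≤B → <⇒≱ (begin-strict
      L * (B + s)         ≤⟨ *-monoʳ-≤ L (+-monoʳ-≤ B s≤B) ⟩
      L * (B + B)         ≡⟨ *-distribˡ-+ L B B ⟩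
      L * B + L * B       <⟨ +-monoʳ-< (L * B) (m<m+n (L * B) 1≤LB) ⟩
      L * B + (L * B + L * B) ≡⟨ cong (λ z → L * B + (L * B + z)) (sym (+-identityʳ (L * B))) ⟩
      k                   ∎) (chebyshev {n} {L} B n<2^L k 2k<n)
      where open ≤-Reasoning
    index : Fin (suc B) → Fin s
    index i = inject≤ i B<s
    mem : ∀ j → lookup S j ∈ upTo (suc n) × (B < lookup S j × Prime (lookup S j))
    mem j = ∈-filter⁻ P? {xs = upTo (suc n)} (∈-lookup j)

  -- Serves as a cheap code: once t is known, a prime factor of t is determined by its position
  -- among the prime factors, which takes at most logarithmically many values.
  position : List ℕ → ℕ → ℕ
  position []       x = 0
  position (y ∷ ys) x with x ≟ y
  ... | yes _ = 0
  ... | no  _ = suc (position ys x)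

  position< : ∀ {x xs} → x ∈ xs → position xs x < length xs
  position< {x} {y ∷ ys} x∈ with x ≟ y | x∈
  ... | yes _   | _          = s≤s z≤n
  ... | no  x≢y | here x≡y   = contradiction x≡y x≢y
  ... | no  _   | there x∈ys = s≤s (position< x∈ys)

  position-injective : ∀ {x y xs} → x ∈ xs → y ∈ xs → position xs x ≡ position xs y → x ≡ y
  position-injective {x} {y} {z ∷ zs} x∈ y∈ eq with x ≟ z | y ≟ z | x∈ | y∈
  ... | yes refl | yes refl | _ | _ = refl
  ... | no x≢z | _ | here x≡z | _ = contradiction x≡z x≢z
  ... | no _ | no y≢z | there _ | here y≡z = contradiction y≡z y≢z
  ... | no _ | no _ | there x∈zs | there y∈zs = position-injective x∈zs y∈zs (suc-injective eq)

  2^length≤product : ∀ {ps} → All Prime ps → 2 ^ length ps ≤ product ps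
  2^length≤product []         = ≤-refl
  2^length≤product (pr ∷ prs) = *-mono-≤ (nonTrivial⇒n>1 _ {{prime⇒nonTrivial pr}}) (2^length≤product prs)

  primeFactors : ℕ → List ℕ
  primeFactors zero    = []
  primeFactors (suc n) = factors (factorise (suc n))

  ∈-primeFactors : ∀ {p n} .{{_ : NonZero n}} → Prime p → p ∣ n → p ∈ primeFactors n
  ∈-primeFactors {p} {suc n} pr p∣n = factorisationHasAllPrimeFactors pr
    (subst (p ∣_) isFactorisation p∣n) factorsPrime
    where open PrimeFactorisation (factorise (suc n)) hiding (factors)

  length-primeFactors : ∀ {n l} → n < 2 ^ l → length (primeFactors n) ≤ l
  length-primeFactors {zero}      _     = z≤n
  length-primeFactors {suc n} {l} n<2ˡ = ≮⇒≥ λ l< → <⇒≱ n<2ˡ (begin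
    2 ^ l                                  ≤⟨ ^-monoʳ-≤ 2 (<⇒≤ l<) ⟩
    2 ^ length (primeFactors (suc n))      ≤⟨ 2^length≤product factorsPrime ⟩
    product (primeFactors (suc n))         ≡⟨ isFactorisation ⟨
    suc n                                  ∎)
    where
    open ≤-Reasoning
    open PrimeFactorisation (factorise (suc n)) hiding (factors)

  signBit : ℤ → Fin 2
  signBit (+ _)    = zero
  signBit -[1+ _ ] = suc zero

  sign-abs-injective : ∀ {i j} → signBit i ≡ signBit j → ℤ.∣ i ∣ ≡ ℤ.∣ j ∣ → i ≡ j
  sign-abs-injective {+ _}      {+ _}      _ eq = cong +_ eq
  sign-abs-injective { -[1+ _ ]} { -[1+ _ ]} _ eq = cong -[1+_] (suc-injective eq)

  encode : ∀ {k l m n o} → Fin k × Fin l × Fin m × Fin n × Fin o → Fin (k * (l * (m * (n * o))))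
  encode (a , b , c , d , e) = combine a (combine b (combine c (combine d e)))

  encode-injective : ∀ {k l m n o} (x y : Fin k × Fin l × Fin m × Fin n × Fin o) → encode x ≡ encode y → x ≡ y
  encode-injective (a , b , c , d , e) (a′ , b′ , c′ , d′ , e′) eq =
    let eqᵃ , eq₁ = combine-injective a (combine b (combine c (combine d e))) a′ _ eq
        eqᵇ , eq₂ = combine-injective b (combine c (combine d e)) b′ _ eq₁
        eqᶜ , eq₃ = combine-injective c (combine d e) c′ _ eq₂
        eqᵈ , eqᵉ = combine-injective d e d′ e′ eq₃
    in cong₂ _,_ eqᵃ (cong₂ _,_ eqᵇ (cong₂ _,_ eqᶜ (cong₂ _,_ eqᵈ eqᵉ)))

  -- If r is large relative to z for all pairs x, y, then z is so small that x, y are determined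
  -- by r, the quotient of x y z by q, and the positions of x and y among the prime factors of
  -- x y z; there are fewer such data than pairs.
  module Search {a : ℤ} {q n B L R H K : ℕ}
    {{q≢0 : NonZero q}} {{n≢0 : NonZero n}}
    (a⊥q : Coprime ℤ.∣ a ∣ q) (n<2^L : n < 2 ^ L) (q≤RB : q ≤ R * B) (n²≤KHB : n * n ≤ K * (H * B))
    (primes : PrimeFamily (suc B) B n) (approximate : ∀ c → DirichletApproximation c q B) where

    open PrimeFamily primes

    -- `punchIn i` enumerates the indices other than i, so (i , j) runs through all ordered pairs of
    -- distinct primes of the family, (B + 1) B in number.
    first second : Fin (suc B) → Fin B → ℕ
    first  i j = member i
    second i j = member (punchIn i j)

    approximation : ∀ i j → DirichletApproximation (a ℤ.* + (first i j * second i j)) q B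
    approximation i j = approximate (a ℤ.* + (first i j * second i j))

    module _ (i : Fin (suc B)) (j : Fin B) where
      open DirichletApproximation (approximation i j) public

      -- Under this condition z cancels in the error |r| / (q x y z), which becomes at most H / (q x
      -- y) with x, y > B.
      Good : Set
      Good = ℤ.∣ r ∣ ≤ H * z

      t : ℕ
      t = first i j * second i j * z

      instance
        t≢0 : NonZero t
        t≢0 = m*n≢0 _ z {{m*n≢0 _ _ {{prime⇒nonZero (isPrime i)}} {{prime⇒nonZero (isPrime (punchIn i j))}}}} {{z≢0}}

      a*t : a ℤ.* + t ≡ r ℤ.+ w ℤ.* + q
      a*t = trans (trans (cong (a ℤ.*_) (ℤ.pos-* (first i j * second i j) z)) (sym (ℤ.*-assoc a _ (+ z)))) remainder

      t≤n²z : t ≤ n * n * z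
      t≤n²z = *-monoˡ-≤ z (*-mono-≤ (below i) (below (punchIn i j)))

      t<2^3L : t < 2 ^ (L + L + L)
      t<2^3L = begin-strict
        t                          ≤⟨ t≤n²z ⟩
        n * n * z                  ≤⟨ *-monoʳ-≤ (n * n) (≤-trans z≤B (<⇒≤ (<-≤-trans (above i) (below i)))) ⟩
        n * n * n                  <⟨ *-mono-< (*-mono-< n<2^L n<2^L) n<2^L ⟩
        2 ^ L * 2 ^ L * 2 ^ L      ≡⟨ cong (_* 2 ^ L) (^-distribˡ-+-* 2 L L) ⟨
        2 ^ (L + L) * 2 ^ L        ≡⟨ ^-distribˡ-+-* 2 (L + L) L ⟨
        2 ^ (L + L + L)            ∎
        where open ≤-Reasoning

      first∈ : first i j ∈ primeFactors t
      first∈ = ∈-primeFactors (isPrime i) (∣m⇒∣m*n z (m∣m*n (second i j)))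

      second∈ : second i j ∈ primeFactors t
      second∈ = ∈-primeFactors (isPrime (punchIn i j)) (∣m⇒∣m*n z (n∣m*n (first i j)))

      firstPosition secondPosition : ℕ
      firstPosition  = position (primeFactors t) (first i j)
      secondPosition = position (primeFactors t) (second i j)

      firstPosition< : firstPosition < L + L + L
      firstPosition< = <-≤-trans (position< first∈) (length-primeFactors t<2^3L)

      secondPosition< : secondPosition < L + L + L
      secondPosition< = <-≤-trans (position< second∈) (length-primeFactors t<2^3L)

      ∣r∣<R : ℤ.∣ r ∣ < R
      ∣r∣<R = *-cancelʳ-< B ℤ.∣ r ∣ R (<-≤-trans small q≤RB)

      -- A pair that is not good has H z < |r| < q / B, so t ≤ n² z yields t / q < n² / (H B) ≤ K.
      -- This is the one place where the failure of `Good` reduces the count.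
      quotient< : ¬ Good → t / q < K
      quotient< bad = *-cancelʳ-< (q * (H * B)) (t / q) K (begin-strict
        t / q * (q * (H * B))           ≡⟨ *-assoc (t / q) q (H * B) ⟨
        t / q * q * (H * B)             ≤⟨ *-monoˡ-≤ (H * B) (m/n*n≤m t q) ⟩
        t * (H * B)                     ≤⟨ *-monoˡ-≤ (H * B) t≤n²z ⟩
        n * n * z * (H * B)             ≡⟨ ring₁ n z H B ⟩
        n * n * (H * z * B)             ≤⟨ *-monoʳ-≤ (n * n) (*-monoˡ-≤ B (<⇒≤ (≰⇒> bad))) ⟩
        n * n * (ℤ.∣ r ∣ * B)           <⟨ *-monoʳ-< (n * n) {{m*n≢0 n n}} small ⟩
        n * n * q                       ≤⟨ *-monoˡ-≤ q n²≤KHB ⟩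
        K * (H * B) * q                 ≡⟨ ring₂ K H B q ⟩
        K * (q * (H * B))               ∎)
        where
        open ≤-Reasoning
        ring₁ : ∀ n z H B → n * n * z * (H * B) ≡ n * n * (H * z * B)
        ring₁ = solve-∀
        ring₂ : ∀ K H B q → K * (H * B) * q ≡ K * (q * (H * B))
        ring₂ = solve-∀

    ℓ : ℕ
    ℓ = L + L + L

    module _ (bad : ∀ i j → ¬ Good i j) where

      key : Fin (suc B) → Fin B → Fin 2 × Fin R × Fin K × Fin ℓ × Fin ℓ
      key i j = signBit (r i j) , fromℕ< (∣r∣<R i j) , fromℕ< (quotient< i j (bad i j)) ,
        fromℕ< (firstPosition< i j) , fromℕ< (secondPosition< i j)

      key-injective : ∀ i j i′ j′ → key i j ≡ key i′ j′ → (i , j) ≡ (i′ , j′)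
      key-injective i j i′ j′ eq = conclude i≡i′ same-second
        where
        sgn = cong proj₁ eq
        abs = cong (λ d → proj₁ (proj₂ d)) eq
        quo = cong (λ d → proj₁ (proj₂ (proj₂ d))) eq
        fst = cong (λ d → proj₁ (proj₂ (proj₂ (proj₂ d)))) eq
        snd = cong (λ d → proj₂ (proj₂ (proj₂ (proj₂ d)))) eq
        r≡ : r i j ≡ r i′ j′
        r≡ = sign-abs-injective sgn (fromℕ<-injective _ _ (∣r∣<R i j) (∣r∣<R i′ j′) abs)
        t≡ : t i j ≡ t i′ j′
        t≡ = residue-determines {a} {q} {r = r i′ j′} {w i j} {w i′ j′} a⊥q
          (subst (λ r → a ℤ.* + t i j ≡ r ℤ.+ w i j ℤ.* + q) r≡ (a*t i j)) (a*t i′ j′)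
          (fromℕ<-injective _ _ (quotient< i j (bad i j)) (quotient< i′ j′ (bad i′ j′)) quo)
        same-first : first i j ≡ first i′ j′
        same-first = position-injective
          (subst (λ t → first i j ∈ primeFactors t) t≡ (first∈ i j)) (first∈ i′ j′)
          (subst (λ t → position (primeFactors t) (first i j) ≡ firstPosition i′ j′) t≡
            (fromℕ<-injective _ _ (firstPosition< i j) (firstPosition< i′ j′) fst))
        same-second : second i j ≡ second i′ j′
        same-second = position-injective
          (subst (λ t → second i j ∈ primeFactors t) t≡ (second∈ i j)) (second∈ i′ j′)
          (subst (λ t → position (primeFactors t) (second i j) ≡ secondPosition i′ j′) t≡
            (fromℕ<-injective _ _ (secondPosition< i j) (secondPosition< i′ j′) snd))
        i≡i′ : i ≡ i′
        i≡i′ = injective same-first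
        conclude : i ≡ i′ → second i j ≡ second i′ j′ → (i , j) ≡ (i′ , j′)
        conclude refl eq = cong (i ,_) (punchIn-injective i j j′ (injective eq))

      pairs≤codes : suc B * B ≤ 2 * (R * (K * (ℓ * ℓ)))
      pairs≤codes = injective⇒≤ {f = λ k → encode (uncurry key (remQuot B k))} λ {k} {k′} eq → begin
        k                                       ≡⟨ combine-remQuot {suc B} B k ⟨
        uncurry combine (remQuot {suc B} B k)   ≡⟨ cong (uncurry combine) (key-injective _ _ _ _ (encode-injective _ _ eq)) ⟩
        uncurry combine (remQuot {suc B} B k′)  ≡⟨ combine-remQuot {suc B} B k′ ⟩
        k′                                      ∎
        where open ≡-Reasoning

    search : 2 * (R * (K * (ℓ * ℓ))) < suc B * B → ∃₂ Good
    search few-codes with any? (λ i → any? (λ j → ℤ.∣ r i j ∣ ≤? H * z i j))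
    ... | yes found = found
    ... | no  none  = contradiction (pairs≤codes λ i j good → none (i , j , good)) (<⇒≱ few-codes)

  -- The bound is |a / q - a₁ / q₁ - a₂ / q₂ - a₃ / q₃| ≤ W / (q n²), multiplied by q q₁ q₂ q₃ n².
  record ThreeFractions (a : ℤ) (q n W : ℕ) : Set where
    field
      q₁ q₂ q₃          : ℕ
      q₁≢0              : NonZero q₁
      q₂≢0              : NonZero q₂
      q₃≢0              : NonZero q₃
      q₁≤n              : q₁ ≤ n
      q₂≤n              : q₂ ≤ n
      q₃≤n              : q₃ ≤ n
      a₁ a₂ a₃          : ℤ

    numerator : ℤ
    numerator = a₁ ℤ.* (+ q₂ ℤ.* + q₃) ℤ.+ a₂ ℤ.* (+ q₁ ℤ.* + q₃) ℤ.+ a₃ ℤ.* (+ q₁ ℤ.* + q₂)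

    field
      bound : ℤ.∣ a ℤ.* + (q₁ * q₂ * q₃) ℤ.- numerator ℤ.* + q ∣ * (n * n) ≤ W * (q₁ * q₂ * q₃)

  module _ {a r w : ℤ} {q n W x y z : ℕ} where

    private
      cancel : ∀ r v → r ℤ.+ v ℤ.- v ≡ r
      cancel = ℤ-Solver.solve-∀

    coprime-three-fractions : NonZero x → NonZero y → NonZero z → x ≤ n → y ≤ n → z ≤ n →
      Coprime x y → Coprime x z → Coprime y z → a ℤ.* + (x * y * z) ≡ r ℤ.+ w ℤ.* + q →
      ℤ.∣ r ∣ * (n * n) ≤ W * (x * y * z) → ThreeFractions a q n W
    coprime-three-fractions x≢0 y≢0 z≢0 x≤ y≤ z≤ xy xz yz eq ≤W =
      let b , c , d , split = partial-fractions xy xz yz w in from-split b c d split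
      where
      from-split : ∀ b c d → b ℤ.* (+ y ℤ.* + z) ℤ.+ c ℤ.* (+ x ℤ.* + z) ℤ.+ d ℤ.* (+ x ℤ.* + y) ≡ w → ThreeFractions a q n W
      from-split b c d split = record
        { q₁ = x ; q₂ = y ; q₃ = z ; q₁≢0 = x≢0 ; q₂≢0 = y≢0 ; q₃≢0 = z≢0
        ; q₁≤n = x≤ ; q₂≤n = y≤ ; q₃≤n = z≤ ; a₁ = b ; a₂ = c ; a₃ = d
        ; bound = subst (λ u → ℤ.∣ u ∣ * (n * n) ≤ W * (x * y * z)) (sym
            (trans (cong₂ (λ u v → u ℤ.- v ℤ.* + q) eq split) (cancel r (w ℤ.* + q)))) ≤W
        }

  n<d*[1+n/d] : ∀ n d .{{_ : NonZero d}} → n < d * suc (n / d)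
  n<d*[1+n/d] n d = begin-strict
    n                       ≡⟨ m≡m%n+[m/n]*n n d ⟩
    n % d + n / d * d       <⟨ +-monoˡ-< (n / d * d) (m%n<n n d) ⟩
    suc (n / d) * d         ≡⟨ *-comm (suc (n / d)) d ⟩
    d * suc (n / d)         ∎
    where open ≤-Reasoning

  -- Choice of the parameters as polynomials in log n

  module Constants (L : ℕ) where

    -- M satisfies n ≤ M B once B ≥ 1. With R = 9 M² B and K = B / g the number of codes is exactly
    -- K g B ≤ B², which dictates g. As B ≤ 2 K g, the choice of H gives n² ≤ M² B² ≤ K H B. The
    -- first summand of W handles g ≤ B, where |r| n² ≤ H z M² x y; the second handles B < g, where
    -- q n² ≤ 9 n⁴ ≤ 9 (M g)⁴. The successor keeps W positive.
    M g H W : ℕ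
    M = 16 * L
    g = 2 * (9 * (M * M) * ((L + L + L) * (L + L + L)))
    H = 2 * (M * M) * g
    W = H * (M * M) + suc (9 * ((M * g) * (M * g) * ((M * g) * (M * g))))

  module _ {a : ℤ} {q n L : ℕ} {{q≢0 : NonZero q}} {{n≢0 : NonZero n}} {{L≢0 : NonZero L}}
    (a⊥q : Coprime ℤ.∣ a ∣ q) (n<2^L : n < 2 ^ L) (q≤9n² : q ≤ 9 * (n * n)) where

    open Constants L

    private
      instance
        8L≢0 : NonZero (8 * L)
        8L≢0 = m*n≢0 8 L
        M≢0 : NonZero M
        M≢0 = m*n≢0 16 L
        MM≢0 : NonZero (M * M)
        MM≢0 = m*n≢0 M M
        3L≢0 : NonZero (L + L + L)
        3L≢0 = >-nonZero (≤-trans (>-nonZero⁻¹ L) (m≤n+m L (L + L)))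
        g≢0 : NonZero g
        g≢0 = m*n≢0 2 (9 * (M * M) * ((L + L + L) * (L + L + L))) {{_}}
          {{m*n≢0 (9 * (M * M)) _ {{m*n≢0 9 (M * M)}} {{m*n≢0 (L + L + L) (L + L + L)}}}}

      B : ℕ
      B = n / (8 * L)

    large : g ≤ B → ThreeFractions a q n W
    large g≤B = from-good (search few)
      where
      open ≤-Reasoning
      instance
        B≢0 : NonZero B
        B≢0 = >-nonZero (≤-trans (>-nonZero⁻¹ g) g≤B)
      1≤B : 1 ≤ B
      1≤B = >-nonZero⁻¹ B
      R K : ℕ
      R = 9 * (M * M) * B
      K = B / g
      n≤MB : n ≤ M * B
      n≤MB = begin
        n                    <⟨ n<d*[1+n/d] n (8 * L) ⟩
        8 * L * suc B        ≤⟨ *-monoʳ-≤ (8 * L) (+-monoˡ-≤ B 1≤B) ⟩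
        8 * L * (B + B)      ≡⟨ ring L B ⟩
        M * B                ∎
        where
        ring : ∀ L B → 8 * L * (B + B) ≡ 16 * L * B
        ring = solve-∀
      n²≤ : n * n ≤ M * M * (B * B)
      n²≤ = begin
        n * n                ≤⟨ *-mono-≤ n≤MB n≤MB ⟩
        M * B * (M * B)      ≡⟨ [m*n]*[o*p]≡[m*o]*[n*p] M B M B ⟩
        M * M * (B * B)      ∎
      8LB≤n : 8 * (L * B) ≤ n
      8LB≤n = begin
        8 * (L * B)          ≡⟨ *-assoc 8 L B ⟨
        8 * L * B            ≡⟨ *-comm (8 * L) B ⟩
        B * (8 * L)          ≤⟨ m/n*n≤m n (8 * L) ⟩
        n                    ∎
      q≤RB : q ≤ R * B
      q≤RB = begin
        q                          ≤⟨ q≤9n² ⟩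
        9 * (n * n)                ≤⟨ *-monoʳ-≤ 9 n²≤ ⟩
        9 * (M * M * (B * B))      ≡⟨ ring M B ⟩
        R * B                      ∎
        where
        ring : ∀ M B → 9 * (M * M * (B * B)) ≡ 9 * (M * M) * B * B
        ring = solve-∀
      B≤2Kg : B ≤ (K + K) * g
      B≤2Kg = begin
        B                          <⟨ n<d*[1+n/d] B g ⟩
        g * suc K                  ≤⟨ *-monoʳ-≤ g (+-monoˡ-≤ K (m≥n⇒m/n>0 g≤B)) ⟩
        g * (K + K)                ≡⟨ *-comm g (K + K) ⟩
        (K + K) * g                ∎
      n²≤KHB : n * n ≤ K * (H * B)
      n²≤KHB = begin
        n * n                            ≤⟨ n²≤ ⟩
        M * M * (B * B)                  ≤⟨ *-monoʳ-≤ (M * M) (*-monoˡ-≤ B B≤2Kg) ⟩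
        M * M * ((K + K) * g * B)        ≡⟨ ring M K g B ⟩
        K * (H * B)                      ∎
        where
        ring : ∀ M K g B → M * M * ((K + K) * g * B) ≡ K * (2 * (M * M) * g * B)
        ring = solve-∀
      open Search {a} {q} {n} {B} {L} {R} {H} {K} a⊥q n<2^L q≤RB n²≤KHB
        (many-primes (>-nonZero⁻¹ L) 1≤B n<2^L 8LB≤n) (λ c → dirichlet c q B) using (search; Good; first; second; t; a*t; r; w; z; z≢0; z≤B)
      few : 2 * (R * (K * ((L + L + L) * (L + L + L)))) < suc B * B
      few = begin-strict
        2 * (R * (K * ((L + L + L) * (L + L + L))))                 ≡⟨ ring M B K (L + L + L) ⟩
        K * g * B                                                   ≤⟨ *-monoˡ-≤ B (m/n*n≤m B g) ⟩
        B * B                                                       <⟨ *-monoˡ-< B (n<1+n B) ⟩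
        suc B * B                                                   ∎
        where
        ring : ∀ M B K ℓ → 2 * (9 * (M * M) * B * (K * (ℓ * ℓ))) ≡ K * (2 * (9 * (M * M) * (ℓ * ℓ))) * B
        ring = solve-∀
      open PrimeFamily (many-primes (>-nonZero⁻¹ L) 1≤B n<2^L 8LB≤n)

      from-good : (∃₂ λ i j → Good i j) → ThreeFractions a q n W
      from-good (i , j , good) = coprime-three-fractions {r = r i j} {w i j}
        (prime⇒nonZero (isPrime i)) (prime⇒nonZero (isPrime (punchIn i j))) (z≢0 i j)
        (below i) (below (punchIn i j)) (≤-trans (<⇒≤ (z<member i)) (below i))
        (distinct-primes-coprime (isPrime i) (isPrime (punchIn i j)) (λ eq → punchInᵢ≢i i j (sym (injective eq))))
        (prime⇒coprime (isPrime i) {{z≢0 i j}} (z<member i))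
        (prime⇒coprime (isPrime (punchIn i j)) {{z≢0 i j}} (z<member (punchIn i j)))
        (a*t i j) (begin
          ℤ.∣ r i j ∣ * (n * n)                 ≤⟨ *-mono-≤ good n²≤ ⟩
          H * z i j * (M * M * (B * B))         ≤⟨ *-monoʳ-≤ (H * z i j) (*-monoʳ-≤ (M * M) (*-mono-≤ (<⇒≤ (above i)) (<⇒≤ (above (punchIn i j))))) ⟩
          H * z i j * (M * M * (first i j * second i j)) ≡⟨ ring H (z i j) (M * M) (first i j * second i j) ⟩
          H * (M * M) * t i j                   ≤⟨ *-monoˡ-≤ (t i j) (m≤m+n (H * (M * M)) _) ⟩
          W * t i j                             ∎)
        where
        z<member : ∀ k → z i j < member k
        z<member k = ≤-<-trans (z≤B i j) (above k)
        ring : ∀ H z N u → H * z * (N * u) ≡ H * N * (u * z)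
        ring = solve-∀

    -- Here n ≤ M g is itself bounded by a power of log n, so three integers suffice: all
    -- denominators are 1, r is the remainder of a modulo q, and W absorbs q n².
    small : B < g → ThreeFractions a q n W
    small B<g = coprime-three-fractions {r = + (a ℤ.%ℕ q)} {a ℤ./ℕ q}
      _ _ _ (>-nonZero⁻¹ n) (>-nonZero⁻¹ n) (>-nonZero⁻¹ n)
      (Coprime.1-coprimeTo 1) (Coprime.1-coprimeTo 1) (Coprime.1-coprimeTo 1)
      (trans (ℤ.*-identityʳ a) (ℤ.a≡a%ℕn+[a/ℕn]*n a q)) (begin
        (a ℤ.%ℕ q) * (n * n)             ≤⟨ *-monoˡ-≤ (n * n) (≤-trans (<⇒≤ (ℤ.n%ℕd<d a q)) q≤9n²) ⟩
        9 * (n * n) * (n * n)            ≤⟨ *-mono-≤ (*-monoʳ-≤ 9 (*-mono-≤ n≤Mg n≤Mg)) (*-mono-≤ n≤Mg n≤Mg) ⟩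
        9 * (M * g * (M * g)) * (M * g * (M * g)) ≡⟨ *-assoc 9 (M * g * (M * g)) (M * g * (M * g)) ⟩
        9 * (M * g * (M * g) * (M * g * (M * g))) ≤⟨ ≤-trans (n≤1+n _) (m≤n+m _ (H * (M * M))) ⟩
        W                                ≡⟨ *-identityʳ W ⟨
        W * 1                            ∎)
      where
      open ≤-Reasoning
      n≤Mg : n ≤ M * g
      n≤Mg = begin
        n                    <⟨ n<d*[1+n/d] n (8 * L) ⟩
        8 * L * suc B        ≤⟨ *-mono-≤ (*-monoˡ-≤ L (m≤m+n 8 8)) B<g ⟩
        M * g                ∎

    three-fractions : ThreeFractions a q n W
    three-fractions = decide (g ≤? B)
      where
      decide : Dec (g ≤ B) → ThreeFractions a q n W
      decide (yes g≤B) = large g≤B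
      decide (no  g≰B) = small (≰⇒> g≰B)

  -- Polynomial growth

  record Polynomial (f : ℕ → ℕ) : Set where
    constructor bounded
    field
      c k   : ℕ
      bound : ∀ n .{{_ : NonZero n}} → f n ≤ c * n ^ k

  const-polynomial : ∀ c → Polynomial (λ _ → c)
  const-polynomial c = bounded c 0 λ _ → ≤-reflexive (sym (*-identityʳ c))

  id-polynomial : Polynomial (λ n → n)
  id-polynomial = bounded 1 1 λ n → ≤-reflexive (sym (trans (+-identityʳ (n * 1)) (*-identityʳ n)))

  *-polynomial : ∀ {f g} → Polynomial f → Polynomial g → Polynomial (λ n → f n * g n)
  *-polynomial {f} {g} (bounded c k f≤) (bounded d l g≤) = bounded (c * d) (k + l) λ n → begin
    f n * g n                    ≤⟨ *-mono-≤ (f≤ n) (g≤ n) ⟩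
    c * n ^ k * (d * n ^ l)      ≡⟨ [m*n]*[o*p]≡[m*o]*[n*p] c (n ^ k) d (n ^ l) ⟩
    c * d * (n ^ k * n ^ l)      ≡⟨ cong (c * d *_) (^-distribˡ-+-* n k l) ⟨
    c * d * n ^ (k + l)          ∎
    where open ≤-Reasoning

  +-polynomial : ∀ {f g} → Polynomial f → Polynomial g → Polynomial (λ n → f n + g n)
  +-polynomial {f} {g} (bounded c k f≤) (bounded d l g≤) = bounded (c + d) (k + l) λ n → begin
    f n + g n                            ≤⟨ +-mono-≤ (f≤ n) (g≤ n) ⟩
    c * n ^ k + d * n ^ l                ≤⟨ +-mono-≤ (*-monoʳ-≤ c (^-monoʳ-≤ n (m≤m+n k l))) (*-monoʳ-≤ d (^-monoʳ-≤ n (m≤n+m l k))) ⟩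
    c * n ^ (k + l) + d * n ^ (k + l)    ≡⟨ *-distribʳ-+ (n ^ (k + l)) c d ⟨
    (c + d) * n ^ (k + l)                ∎
    where open ≤-Reasoning

  ^-polynomial : ∀ {f} → Polynomial f → ∀ m → Polynomial (λ n → f n ^ m)
  ^-polynomial p zero    = const-polynomial 1
  ^-polynomial p (suc m) = *-polynomial p (^-polynomial p m)

  ^-distribʳ-* : ∀ m x y → (x * y) ^ m ≡ x ^ m * y ^ m
  ^-distribʳ-* zero    x y = refl
  ^-distribʳ-* (suc m) x y = trans (cong (x * y *_) (^-distribʳ-* m x y)) ([m*n]*[o*p]≡[m*o]*[n*p] x y (x ^ m) (y ^ m))

  -- With j = n / k rounded down, n < k (1 + j) ≤ k 2 ^ j, and the k-th power of 2 ^ j is at most 2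
  -- ^ n.
  n^k≤k^k*2^n : ∀ n k .{{_ : NonZero k}} → n ^ k ≤ k ^ k * 2 ^ n
  n^k≤k^k*2^n n k = begin
    n ^ k                            ≤⟨ ^-monoˡ-≤ k (≤-trans (<⇒≤ (n<d*[1+n/d] n k)) (*-monoʳ-≤ k (n<2^n (n / k)))) ⟩
    (k * 2 ^ (n / k)) ^ k            ≡⟨ ^-distribʳ-* k k (2 ^ (n / k)) ⟩
    k ^ k * (2 ^ (n / k)) ^ k        ≡⟨ cong (k ^ k *_) (^-*-assoc 2 (n / k) k) ⟩
    k ^ k * 2 ^ (n / k * k)          ≤⟨ *-monoʳ-≤ (k ^ k) (^-monoʳ-≤ 2 (m/n*n≤m n k)) ⟩
    k ^ k * 2 ^ n                    ∎
    where open ≤-Reasoning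

  polynomial≤C*2^n : ∀ {f} → Polynomial f → ∃ λ C → ∀ n .{{_ : NonZero n}} → f n ≤ C * 2 ^ n
  polynomial≤C*2^n {f} (bounded c k f≤) = c * suc k ^ suc k , λ n → begin
    f n                                  ≤⟨ f≤ n ⟩
    c * n ^ k                            ≤⟨ *-monoʳ-≤ c (^-monoʳ-≤ n (n≤1+n k)) ⟩
    c * n ^ suc k                        ≤⟨ *-monoʳ-≤ c (n^k≤k^k*2^n n (suc k)) ⟩
    c * (suc k ^ suc k * 2 ^ n)          ≡⟨ *-assoc c (suc k ^ suc k) (2 ^ n) ⟨
    c * suc k ^ suc k * 2 ^ n            ∎
    where open ≤-Reasoning

  W-polynomial : Polynomial Constants.W
  W-polynomial = +-polynomial (*-polynomial poly-H MM)
    (+-polynomial (const-polynomial 1) (*-polynomial (const-polynomial 9) (*-polynomial Mg² Mg²)))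
    where
    open Constants
    poly-M : Polynomial M
    poly-M = *-polynomial (const-polynomial 16) id-polynomial
    MM : Polynomial (λ L → M L * M L)
    MM = *-polynomial poly-M poly-M
    3L : Polynomial (λ L → L + L + L)
    3L = +-polynomial (+-polynomial id-polynomial id-polynomial) id-polynomial
    poly-g : Polynomial g
    poly-g = *-polynomial (const-polynomial 2) (*-polynomial (*-polynomial (const-polynomial 9) MM) (*-polynomial 3L 3L))
    poly-H : Polynomial H
    poly-H = *-polynomial (*-polynomial (const-polynomial 2) MM) poly-g
    Mg : Polynomial (λ L → M L * g L)
    Mg = *-polynomial poly-M poly-g
    Mg² : Polynomial (λ L → M L * g L * (M L * g L))
    Mg² = *-polynomial Mg Mg

  bits : ∀ n .{{_ : NonZero n}} → ∃ λ L → NonZero L × n < 2 ^ L × 2 ^ L ≤ 2 * n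
  bits 1 = 1 , _ , ≤-refl , ≤-refl
  bits (suc n@(suc _)) with bits n
  ... | L , L≢0 , n<2^L , 2^L≤2n with suc n <? 2 ^ L
  ...   | yes h = L , L≢0 , h , ≤-trans 2^L≤2n (*-monoʳ-≤ 2 (n≤1+n n))
  ...   | no  h = suc L , _ , ≤-<-trans n<2^L (^-monoʳ-< 2 (s≤s (s≤s z≤n)) (n<1+n L)) , *-monoʳ-≤ 2 (≮⇒≥ h)

  -- For fixed m, `W ^ m` is a polynomial in L, hence at most a constant times 2 ^ L ≤ 2 n. So W
  -- grows at most like n ^ (1 / m), with a constant depending on m alone.
  subpolynomial-three-fractions : ∀ m → ∃ λ C → NonZero C × (∀ n .{{_ : NonZero n}} → ∃ λ W → NonZero W × W ^ m ≤ C * n ×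
    (∀ a q .{{_ : NonZero q}} → Coprime ℤ.∣ a ∣ q → q ≤ 9 * (n * n) → ThreeFractions a q n W))
  subpolynomial-three-fractions m = suc C * 2 , _ , λ n → at n (bits n)
    where
    open ≤-Reasoning
    open Constants
    W^m≤C2^L : ∃ λ C → ∀ L .{{_ : NonZero L}} → W L ^ m ≤ C * 2 ^ L
    W^m≤C2^L = polynomial≤C*2^n (^-polynomial W-polynomial m)
    C : ℕ
    C = proj₁ W^m≤C2^L
    at : ∀ n .{{_ : NonZero n}} → (∃ λ L → NonZero L × n < 2 ^ L × 2 ^ L ≤ 2 * n) →
      ∃ λ W → NonZero W × W ^ m ≤ suc C * 2 * n ×
        (∀ a q .{{_ : NonZero q}} → Coprime ℤ.∣ a ∣ q → q ≤ 9 * (n * n) → ThreeFractions a q n W)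
    at n (L , L≢0 , n<2^L , 2^L≤2n) =
      W L , >-nonZero (≤-trans (s≤s z≤n) (m≤n+m _ (H L * (M L * M L)))) , (begin
        W L ^ m              ≤⟨ proj₂ W^m≤C2^L L {{L≢0}} ⟩
        C * 2 ^ L            ≤⟨ *-mono-≤ (n≤1+n C) 2^L≤2n ⟩
        suc C * (2 * n)      ≡⟨ *-assoc (suc C) 2 n ⟨
        suc C * 2 * n        ∎) ,
      λ a q a⊥q q≤ → three-fractions {{≢-nonZero (≢-nonZero⁻¹ q)}} {{≢-nonZero (≢-nonZero⁻¹ n)}} {{L≢0}} a⊥q n<2^L q≤

  -- The exponent is 2 (1 + m) - 1, so after taking roots this reads (3 n) ^ (2 - 1 / (1 + m)) ≤ 9 C
  -- n² / W. The missing factor 3 n is supplied by W ^ (1 + m) ≤ C n.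
  power-comparison : ∀ m {C n W} .{{_ : NonZero C}} → W ^ suc m ≤ C * n →
    (3 * n) ^ suc (m + m) * W ^ suc m ≤ (9 * C * (n * n)) ^ suc m
  power-comparison m {C} {n} {W} W≤ = begin
    x ^ suc (m + m) * W ^ suc m            ≤⟨ *-monoʳ-≤ (x ^ suc (m + m)) W≤ ⟩
    x ^ suc (m + m) * (C * n)              ≤⟨ *-monoʳ-≤ (x ^ suc (m + m)) (*-mono-≤ (m≤m*n C (C ^ m) {{m^n≢0 C m}}) (m≤n*m n 3)) ⟩
    x ^ suc (m + m) * (C ^ suc m * x)      ≡⟨ ring (x ^ suc (m + m)) (C ^ suc m) x ⟩
    C ^ suc m * (x * x ^ suc (m + m))      ≡⟨ cong (λ k → C ^ suc m * x ^ suc k) (+-suc m m) ⟨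
    C ^ suc m * x ^ (suc m + suc m)        ≡⟨ cong (C ^ suc m *_) (^-distribˡ-+-* x (suc m) (suc m)) ⟩
    C ^ suc m * (x ^ suc m * x ^ suc m)    ≡⟨ cong (C ^ suc m *_) (^-distribʳ-* (suc m) x x) ⟨
    C ^ suc m * (x * x) ^ suc m            ≡⟨ ^-distribʳ-* (suc m) C (x * x) ⟨
    (C * (x * x)) ^ suc m                  ≡⟨ cong (_^ suc m) (ring′ C n) ⟩
    (9 * C * (n * n)) ^ suc m              ∎
    where
    open ≤-Reasoning
    x = 3 * n
    ring : ∀ u c x → u * (c * x) ≡ c * (x * u)
    ring = solve-∀
    ring′ : ∀ C n → C * (3 * n * (3 * n)) ≡ 9 * C * (n * n)
    ring′ = solve-∀

open import Defs
open import Data.Nat.Base as ℕ using (ℕ; zero; suc)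
import Data.Nat.Coprimality as Coprimality
import Data.Nat.Properties as ℕ
open import Data.Nat.Tactic.RingSolver using () renaming (solve-∀ to ℕ-solve-∀)
open import Data.Integer.Base as ℤ using (ℤ; +_; -[1+_])
open import Data.Integer.GCD using (gcd)
import Data.Integer.Properties as ℤ
open import Data.Rational.Base as ℚ using (ℚ; 0ℚ; 1ℚ; toℚᵘ)
import Data.Rational.Properties as ℚ
open import Data.Rational.Solver using (module +-*-Solver)
import Data.Rational.Unnormalised.Base as ℚᵘ
import Data.Rational.Unnormalised.Properties as ℚᵘ
open import Data.Product using (∃; ∃₂; Σ-syntax; _×_; _,_; proj₁; proj₂)
open import Data.Sum using (inj₁; inj₂)
open import Relation.Binary.PropositionalEquality
open import Relation.Nullary using (yes; no)
open Arithmetic using (ThreeFractions; subpolynomial-three-fractions; power-comparison)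
open Rational renaming (_^_ to _^ℚ_)
open +-*-Solver using (solve; _:+_; _:*_; _:=_; :-_; con; _:-_)

-- Reals

ι : ℤ → ℚ
ι z = z ℚ./ 1

ι-+ : ∀ x y → ι (x ℤ.+ y) ≡ ι x ℚ.+ ι y
ι-+ x y = sym (/-+ x y 0)

ι-neg : ∀ x → ι (ℤ.- x) ≡ ℚ.- ι x
ι-neg (+ zero)   = refl
ι-neg (+ suc _)  = refl
ι-neg -[1+ n ]   = sym (neg-involutive (ι (+ suc n)))

ι-- : ∀ x y → ι (x ℤ.- y) ≡ ι x ℚ.- ι y
ι-- x y = trans (ι-+ x (ℤ.- y)) (cong (ι x ℚ.+_) (ι-neg y))

ι-* : ∀ x y → ι (x ℤ.* y) ≡ ι x ℚ.* ι y
ι-* x y = ℚ.toℚᵘ-injective (begin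
  toℚᵘ (ι (x ℤ.* y))                      ≈⟨ ℚ.toℚᵘ-fromℚᵘ (ℚᵘ.mkℚᵘ (x ℤ.* y) 0) ⟩
  ℚᵘ.mkℚᵘ x 0 ℚᵘ.* ℚᵘ.mkℚᵘ y 0            ≈⟨ ℚᵘ.*-cong (ℚ.toℚᵘ-fromℚᵘ (ℚᵘ.mkℚᵘ x 0)) (ℚ.toℚᵘ-fromℚᵘ (ℚᵘ.mkℚᵘ y 0)) ⟨
  toℚᵘ (ι x) ℚᵘ.* toℚᵘ (ι y)              ≈⟨ ℚ.toℚᵘ-homo-* (ι x) (ι y) ⟨
  toℚᵘ (ι x ℚ.* ι y)                      ∎)
  where open ℚᵘ.≃-Reasoning

ι-sum : ∀ a b c x y z → ι (a ℤ.* x ℤ.+ b ℤ.* y ℤ.+ c ℤ.* z) ≡ ι a ℚ.* ι x ℚ.+ ι b ℚ.* ι y ℚ.+ ι c ℚ.* ι z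
ι-sum a b c x y z = trans (ι-+ (a ℤ.* x ℤ.+ b ℤ.* y) (c ℤ.* z)) (cong₂ ℚ._+_
  (trans (ι-+ (a ℤ.* x) (b ℤ.* y)) (cong₂ ℚ._+_ (ι-* a x) (ι-* b y))) (ι-* c z))

fromℕ-* : ∀ m n → fromℕ (m ℕ.* n) ≡ fromℕ m ℚ.* fromℕ n
fromℕ-* m n = trans (cong ι (ℤ.pos-* m n)) (ι-* (+ m) (+ n))

fromℕ-^ : ∀ m k → fromℕ (m ℕ.^ k) ≡ fromℕ m ^ℚ k
fromℕ-^ m zero    = refl
fromℕ-^ m (suc k) = trans (fromℕ-* m (m ℕ.^ k)) (cong (fromℕ m ℚ.*_) (fromℕ-^ m k))

ι-mono-≤ : ∀ {x y} → x ℤ.≤ y → ι x ℚ.≤ ι y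
ι-mono-≤ {x} {y} x≤y with x ℤ.<? y
... | yes x<y = ℚ.<⇒≤ (/-mono-< x y 0 x<y)
... | no  x≮y = ℚ.≤-reflexive (cong ι (ℤ.≤-antisym x≤y (ℤ.≮⇒≥ x≮y)))

fromℕ-mono-≤ : ∀ {m n} → m ℕ.≤ n → fromℕ m ℚ.≤ fromℕ n
fromℕ-mono-≤ m≤n = ι-mono-≤ (ℤ.+≤+ m≤n)

fromℕ-mono-< : ∀ {m n} → m ℕ.< n → fromℕ m ℚ.< fromℕ n
fromℕ-mono-< {m} {n} m<n = /-mono-< (+ m) (+ n) 0 (ℤ.+<+ m<n)

fromℕ-pos : ∀ n .{{_ : ℕ.NonZero n}} → 0ℚ ℚ.< fromℕ n
fromℕ-pos (suc n) = 0<fromℕ n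

∣ι∣ : ∀ x → ℚ.∣ ι x ∣ ≡ fromℕ ℤ.∣ x ∣
∣ι∣ (+ n)    = ℚ.0≤p⇒∣p∣≡p (0≤fromℕ n)
∣ι∣ -[1+ n ] = trans (ℚ.∣-p∣≡∣p∣ (fromℕ (suc n))) (ℚ.0≤p⇒∣p∣≡p (0≤fromℕ (suc n)))

∣p∣≥p : ∀ p → p ℚ.≤ ℚ.∣ p ∣
∣p∣≥p p with ℚ.≤-total 0ℚ p
... | inj₁ 0≤p = ℚ.≤-reflexive (sym (ℚ.0≤p⇒∣p∣≡p 0≤p))
... | inj₂ p≤0 = ℚ.≤-trans p≤0 (ℚ.0≤∣p∣ p)

∣p∣≥-p : ∀ p → ℚ.- p ℚ.≤ ℚ.∣ p ∣
∣p∣≥-p p = subst (ℚ.- p ℚ.≤_) (ℚ.∣-p∣≡∣p∣ p) (∣p∣≥p (ℚ.- p))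

/*fromℕ : ∀ x q .{{_ : ℕ.NonZero q}} → (x ℚ./ q) ℚ.* fromℕ q ≡ ι x
/*fromℕ x (suc q) = /-*-cancel x q

-- Three fractions over the rationals

module _ {a : ℤ} {q n W : ℕ} {{q≢0 : ℕ.NonZero q}} (F : ThreeFractions a q n W) where

  open ThreeFractions F

  private
    instance
      _ = q₁≢0
      _ = q₂≢0
      _ = q₃≢0

    Q : ℕ
    Q = q₁ ℕ.* q₂ ℕ.* q₃

    instance
      Q≢0 : ℕ.NonZero Q
      Q≢0 = ℕ.m*n≢0 (q₁ ℕ.* q₂) q₃ {{ℕ.m*n≢0 q₁ q₂}}

  defect : ℚ
  defect = a ℚ./ q ℚ.- a₁ ℚ./ q₁ ℚ.- a₂ ℚ./ q₂ ℚ.- a₃ ℚ./ q₃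

  private
    v : ℤ
    v = a ℤ.* + Q ℤ.- numerator ℤ.* + q

    defect*qQ : defect ℚ.* (fromℕ q ℚ.* fromℕ Q) ≡ ι v
    defect*qQ = begin
      defect ℚ.* (𝕢 ℚ.* fromℕ Q)   ≡⟨ cong (λ z → defect ℚ.* (𝕢 ℚ.* z)) fromℕ-Q ⟩
      defect ℚ.* (𝕢 ℚ.* (x ℚ.* y ℚ.* z))
        ≡⟨ solve 8 (λ e f g h 𝕢 x y z → (e :- f :- g :- h) :* (𝕢 :* (x :* y :* z)) :=
             (e :* 𝕢) :* (x :* y :* z) :- ((f :* x) :* (y :* z) :+ (g :* y) :* (x :* z) :+ (h :* z) :* (x :* y)) :* 𝕢)
             refl (a ℚ./ q) (a₁ ℚ./ q₁) (a₂ ℚ./ q₂) (a₃ ℚ./ q₃) 𝕢 x y z ⟩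
      (a ℚ./ q ℚ.* 𝕢) ℚ.* (x ℚ.* y ℚ.* z) ℚ.- ((a₁ ℚ./ q₁ ℚ.* x) ℚ.* (y ℚ.* z) ℚ.+ (a₂ ℚ./ q₂ ℚ.* y) ℚ.* (x ℚ.* z) ℚ.+ (a₃ ℚ./ q₃ ℚ.* z) ℚ.* (x ℚ.* y)) ℚ.* 𝕢
        ≡⟨ cong₂ (λ A N → A ℚ.* (x ℚ.* y ℚ.* z) ℚ.- N ℚ.* 𝕢) (/*fromℕ a q)
             (cong₂ ℚ._+_ (cong₂ ℚ._+_ (cong₂ ℚ._*_ (/*fromℕ a₁ q₁) (sym (ι-* (+ q₂) (+ q₃)))) (cong₂ ℚ._*_ (/*fromℕ a₂ q₂) (sym (ι-* (+ q₁) (+ q₃)))))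
               (cong₂ ℚ._*_ (/*fromℕ a₃ q₃) (sym (ι-* (+ q₁) (+ q₂))))) ⟩
      ι a ℚ.* (x ℚ.* y ℚ.* z) ℚ.- (ι a₁ ℚ.* ι (+ q₂ ℤ.* + q₃) ℚ.+ ι a₂ ℚ.* ι (+ q₁ ℤ.* + q₃) ℚ.+ ι a₃ ℚ.* ι (+ q₁ ℤ.* + q₂)) ℚ.* 𝕢
        ≡⟨ cong₂ (λ A N → ι a ℚ.* A ℚ.- N ℚ.* 𝕢) (sym fromℕ-Q) (sym ι-numerator) ⟩
      ι a ℚ.* fromℕ Q ℚ.- ι numerator ℚ.* 𝕢   ≡⟨ cong₂ ℚ._-_ (sym (ι-* a (+ Q))) (sym (ι-* numerator (+ q))) ⟩
      ι (a ℤ.* + Q) ℚ.- ι (numerator ℤ.* + q)  ≡⟨ sym (ι-- (a ℤ.* + Q) (numerator ℤ.* + q)) ⟩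
      ι v                                      ∎
      where
      open ≡-Reasoning
      𝕢 = fromℕ q
      x = fromℕ q₁
      y = fromℕ q₂
      z = fromℕ q₃
      fromℕ-Q : fromℕ Q ≡ x ℚ.* y ℚ.* z
      fromℕ-Q = trans (fromℕ-* (q₁ ℕ.* q₂) q₃) (cong (ℚ._* z) (fromℕ-* q₁ q₂))
      ι-numerator : ι numerator ≡ ι a₁ ℚ.* ι (+ q₂ ℤ.* + q₃) ℚ.+ ι a₂ ℚ.* ι (+ q₁ ℤ.* + q₃) ℚ.+ ι a₃ ℚ.* ι (+ q₁ ℤ.* + q₂)
      ι-numerator = ι-sum a₁ a₂ a₃ (+ q₂ ℤ.* + q₃) (+ q₁ ℤ.* + q₃) (+ q₁ ℤ.* + q₂)

  defect-bound : ℚ.∣ defect ∣ ℚ.* (fromℕ q ℚ.* fromℕ (n ℕ.* n)) ℚ.≤ fromℕ W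
  defect-bound = cancel-≤ (fromℕ-pos Q) (begin
    ∣D∣ ℚ.* (fromℕ q ℚ.* fromℕ (n ℕ.* n)) ℚ.* fromℕ Q
      ≡⟨ solve 4 (λ d q n Q → d :* (q :* n) :* Q := d :* (q :* Q) :* n) refl ∣D∣ (fromℕ q) (fromℕ (n ℕ.* n)) (fromℕ Q) ⟩
    ∣D∣ ℚ.* (fromℕ q ℚ.* fromℕ Q) ℚ.* fromℕ (n ℕ.* n)      ≡⟨ cong (ℚ._* fromℕ (n ℕ.* n)) ∣defect∣*qQ ⟩
    fromℕ ℤ.∣ v ∣ ℚ.* fromℕ (n ℕ.* n)                      ≡⟨ fromℕ-* ℤ.∣ v ∣ (n ℕ.* n) ⟨
    fromℕ (ℤ.∣ v ∣ ℕ.* (n ℕ.* n))                          ≤⟨ fromℕ-mono-≤ bound ⟩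
    fromℕ (W ℕ.* Q)                                        ≡⟨ fromℕ-* W Q ⟩
    fromℕ W ℚ.* fromℕ Q                                    ∎)
    where
    open ℚ.≤-Reasoning
    ∣D∣ = ℚ.∣ defect ∣
    0≤qQ : 0ℚ ℚ.≤ fromℕ q ℚ.* fromℕ Q
    0≤qQ = ℚ.<⇒≤ (*-pos (fromℕ-pos q) (fromℕ-pos Q))
    ∣defect∣*qQ : ∣D∣ ℚ.* (fromℕ q ℚ.* fromℕ Q) ≡ fromℕ ℤ.∣ v ∣
    ∣defect∣*qQ = trans (cong (∣D∣ ℚ.*_) (sym (ℚ.0≤p⇒∣p∣≡p 0≤qQ)))
      (trans (sym (ℚ.∣p*q∣≡∣p∣*∣q∣ defect _)) (trans (cong ℚ.∣_∣ defect*qQ) (∣ι∣ v)))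

-- Cuts shifted by rationals and the triangle inequality

<-moveˡ : ∀ {p} q {r} → p ℚ.+ q ℚ.< r → p ℚ.< r ℚ.- q
<-moveˡ {p} q {r} h = subst (ℚ._< r ℚ.- q) (solve 2 (λ p q → p :+ q :- q := p) refl p q) (ℚ.+-monoˡ-< (ℚ.- q) h)

<-moveʳ : ∀ {p} q {r} → p ℚ.< r ℚ.+ q → p ℚ.- q ℚ.< r
<-moveʳ {p} q {r} h = subst (p ℚ.- q ℚ.<_) (solve 2 (λ r q → r :+ q :- q := r) refl r q) (ℚ.+-monoˡ-< (ℚ.- q) h)

module _ (x : ℝ) (e : ℚ) where

  lower-minus⁻ : ∀ {r} → Lower (x - fromℚ e) r → Lower x (r ℚ.+ e)
  lower-minus⁻ {r} (a , b , a<x , e<-b , r<a+b) = lower-closed x (begin-strict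
    r ℚ.+ e                     <⟨ ℚ.+-mono-< r<a+b e<-b ⟩
    a ℚ.+ b ℚ.+ ℚ.- b           ≡⟨ solve 2 (λ a b → a :+ b :- b := a) refl a b ⟩
    a                           ∎) a<x
    where open ℚ.≤-Reasoning

  upper-minus⁻ : ∀ {r} → Upper (x - fromℚ e) r → Upper x (r ℚ.+ e)
  upper-minus⁻ {r} (a , b , x<a , -b<e , a+b<r) = upper-closed x (begin-strict
    a                           ≡⟨ solve 2 (λ a b → a :+ b :- b := a) refl a b ⟨
    a ℚ.+ b ℚ.+ ℚ.- b           <⟨ ℚ.+-mono-< a+b<r -b<e ⟩
    r ℚ.+ e                     ∎) x<a
    where open ℚ.≤-Reasoning

  -- The cut of a sum demands strict inequalities throughout: openness moves r + e up to some a
  -- still below x, and density puts c between e and a - r.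
  lower-minus⁺ : ∀ {r} → Lower x (r ℚ.+ e) → Lower (x - fromℚ e) r
  lower-minus⁺ {r} l = enlarge (lower-open x l)
    where
    choose : ∀ {a} → Lower x a → (∃ λ c → e ℚ.< c × c ℚ.< a ℚ.- r) → Lower (x - fromℚ e) r
    choose {a} a<x (c , e<c , c<a-r) = a , ℚ.- c , a<x , subst (e ℚ.<_) (sym (neg-involutive c)) e<c ,
      subst (ℚ._< a ℚ.- c) (solve 2 (λ a r → a :- (a :- r) := r) refl a r) (ℚ.+-monoʳ-< a (ℚ.neg-antimono-< c<a-r))
    enlarge : (∃ λ a → r ℚ.+ e ℚ.< a × Lower x a) → Lower (x - fromℚ e) r
    enlarge (a , r+e<a , a<x) = choose a<x (dense (<-moveˡ r (subst (ℚ._< a) (ℚ.+-comm r e) r+e<a)))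

  upper-minus⁺ : ∀ {r} → Upper x (r ℚ.+ e) → Upper (x - fromℚ e) r
  upper-minus⁺ {r} u = shrink (upper-open x u)
    where
    choose : ∀ {a} → Upper x a → (∃ λ c → a ℚ.- r ℚ.< c × c ℚ.< e) → Upper (x - fromℚ e) r
    choose {a} x<a (c , a-r<c , c<e) = a , ℚ.- c , x<a , subst (ℚ._< e) (sym (neg-involutive c)) c<e ,
      subst (a ℚ.- c ℚ.<_) (solve 2 (λ a r → a :- (a :- r) := r) refl a r) (ℚ.+-monoʳ-< a (ℚ.neg-antimono-< a-r<c))
    shrink : (∃ λ a → a ℚ.< r ℚ.+ e × Upper x a) → Upper (x - fromℚ e) r
    shrink (a , a<r+e , x<a) = choose x<a (dense (<-moveʳ r (subst (a ℚ.<_) (ℚ.+-comm r e) a<r+e)))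

-- Everything subtracted from α is rational, so each branch of the absolute value is a shifted bound
-- on α itself. The shifts differ by D, and D ≤ |D| settles one branch, -D ≤ |D| the other.
abs-triangle : ∀ α {e e₁ e₂ e₃ r} → Lower ∣ α - fromℚ e₁ - fromℚ e₂ - fromℚ e₃ ∣ r →
  Lower ∣ α - fromℚ e ∣ (r ℚ.- ℚ.∣ e ℚ.- e₁ ℚ.- e₂ ℚ.- e₃ ∣)
abs-triangle α {e} {e₁} {e₂} {e₃} {r} = λ where
    (inj₁ l) → inj₁ (lower-minus⁺ α e (lower-≤ α lower-bound
      (lower-minus⁻ α e₁ (lower-minus⁻ (α - fromℚ e₁) e₂ (lower-minus⁻ (α - fromℚ e₁ - fromℚ e₂) e₃ l)))))
    (inj₂ u) → inj₂ (upper-minus⁺ α e (upper-≤ α upper-bound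
      (upper-minus⁻ α e₁ (upper-minus⁻ (α - fromℚ e₁) e₂ (upper-minus⁻ (α - fromℚ e₁ - fromℚ e₂) e₃ u)))))
  where
  open ℚ.≤-Reasoning
  D = e ℚ.- e₁ ℚ.- e₂ ℚ.- e₃
  lower-bound : r ℚ.- ℚ.∣ D ∣ ℚ.+ e ℚ.≤ r ℚ.+ e₃ ℚ.+ e₂ ℚ.+ e₁
  lower-bound = begin
    r ℚ.- ℚ.∣ D ∣ ℚ.+ e         ≡⟨ solve 3 (λ r d e → r :- d :+ e := r :+ e :- d) refl r ℚ.∣ D ∣ e ⟩
    r ℚ.+ e ℚ.- ℚ.∣ D ∣         ≤⟨ ℚ.+-monoʳ-≤ (r ℚ.+ e) (ℚ.neg-antimono-≤ (∣p∣≥p D)) ⟩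
    r ℚ.+ e ℚ.- D               ≡⟨ solve 5 (λ r e f g h → r :+ e :- (e :- f :- g :- h) := r :+ h :+ g :+ f) refl r e e₁ e₂ e₃ ⟩
    r ℚ.+ e₃ ℚ.+ e₂ ℚ.+ e₁      ∎
  upper-bound : ℚ.- r ℚ.+ e₃ ℚ.+ e₂ ℚ.+ e₁ ℚ.≤ ℚ.- (r ℚ.- ℚ.∣ D ∣) ℚ.+ e
  upper-bound = begin
    ℚ.- r ℚ.+ e₃ ℚ.+ e₂ ℚ.+ e₁      ≡⟨ solve 5 (λ r e f g h → :- r :+ h :+ g :+ f := :- r :+ e :+ :- (e :- f :- g :- h)) refl r e e₁ e₂ e₃ ⟩
    ℚ.- r ℚ.+ e ℚ.+ ℚ.- D           ≤⟨ ℚ.+-monoʳ-≤ (ℚ.- r ℚ.+ e) (∣p∣≥-p D) ⟩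
    ℚ.- r ℚ.+ e ℚ.+ ℚ.∣ D ∣         ≡⟨ solve 3 (λ r d e → :- r :+ e :+ d := :- (r :- d) :+ e) refl r ℚ.∣ D ∣ e ⟩
    ℚ.- (r ℚ.- ℚ.∣ D ∣) ℚ.+ e       ∎

-- Quotients with denominator q Y

*-<1-mono : ∀ {r c d u} → r ℚ.< c → c ℚ.* u ℚ.< 1ℚ → 0ℚ ℚ.< d → d ℚ.≤ u → r ℚ.* d ℚ.< 1ℚ
*-<1-mono {r} {c} {d} {u} r<c cu<1 0<d d≤u with ℚ.≤-total 0ℚ r
... | inj₂ r≤0 = ℚ.≤-<-trans (subst (r ℚ.* d ℚ.≤_) (ℚ.*-zeroˡ d) (*ʳ-≤ (ℚ.<⇒≤ 0<d) r≤0)) 0<1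
... | inj₁ 0≤r = ℚ.≤-<-trans (*-mono-≤ 0≤r (ℚ.<⇒≤ 0<d) (ℚ.<⇒≤ r<c) d≤u) cu<1

-- To put r below the product of k and 1 / u, strictly smaller factors are needed. Choose max(r u,
-- 0) < f < g < k and c = f / (g u): then c u = f / g < 1 and g c = f / u > r. The maximum with 0
-- makes f, and so c, positive.
factor-below : ∀ {r u k} → 0ℚ ℚ.< u → 0ℚ ℚ.< k → r ℚ.* u ℚ.< k →
  ∃₂ λ g c → 0ℚ ℚ.< g × g ℚ.< k × 0ℚ ℚ.< c × c ℚ.* u ℚ.< 1ℚ × r ℚ.< g ℚ.* c
factor-below {r} {u} {k} 0<u 0<k ru<k = first (dense (⊔< ru<k 0<k))
  where
  Goal = ∃₂ λ g c → 0ℚ ℚ.< g × g ℚ.< k × 0ℚ ℚ.< c × c ℚ.* u ℚ.< 1ℚ × r ℚ.< g ℚ.* c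
  third : ∀ {f g} → 0ℚ ℚ.< f → r ℚ.* u ℚ.< f → f ℚ.< g → g ℚ.< k → (∃ λ c → c ℚ.* (g ℚ.* u) ≡ f) → Goal
  third {f} {g} 0<f ru<f f<g g<k (c , eq) = g , c , 0<g , g<k , quot-pos (*-pos 0<g 0<u) eq 0<f ,
    cancel-< 0<g (subst₂ ℚ._<_ (trans (sym eq) (solve 3 (λ c g u → c :* (g :* u) := c :* u :* g) refl c g u))
      (sym (ℚ.*-identityˡ g)) f<g) ,
    cancel-< 0<u (subst (r ℚ.* u ℚ.<_) (trans (sym eq) (solve 3 (λ c g u → c :* (g :* u) := g :* c :* u) refl c g u)) ru<f)
    where
    0<g : 0ℚ ℚ.< g
    0<g = ℚ.<-trans 0<f f<g
  second : ∀ {f} → r ℚ.* u ℚ.⊔ 0ℚ ℚ.< f → (∃ λ g → f ℚ.< g × g ℚ.< k) → Goal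
  second {f} max<f (g , f<g , g<k) = third 0<f (ℚ.≤-<-trans (ℚ.p≤p⊔q (r ℚ.* u) 0ℚ) max<f) f<g g<k
    (quot f (*-pos (ℚ.<-trans 0<f f<g) 0<u))
    where
    0<f : 0ℚ ℚ.< f
    0<f = ℚ.≤-<-trans (ℚ.p≤q⊔p (r ℚ.* u) 0ℚ) max<f
  first : (∃ λ f → r ℚ.* u ℚ.⊔ 0ℚ ℚ.< f × f ℚ.< k) → Goal
  first (f , max<f , f<k) = second max<f (dense f<k)

module _ {q : ℕ} .{{q≢0 : ℕ.NonZero q}} {Y : ℝ} (0<Y : 0ℝ < Y) (0<qY : 0ℝ < fromℤ (+ q) * Y) where

  private
    0<q : 0ℚ ℚ.< fromℕ q
    0<q = fromℕ-pos q

    0<upper : ∀ {d} → Upper Y d → 0ℚ ℚ.< d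
    0<upper Y<d = let _ , 0<a , a<Y = positive-point 0<Y in ℚ.<-trans 0<a (lower<upper Y a<Y Y<d)

    lower-0 : Lower Y 0ℚ
    lower-0 = let _ , 0<a , a<Y = positive-point 0<Y in lower-closed Y 0<a a<Y

  upper-* : ∀ {d} → Upper Y d → Upper (fromℤ (+ q) * Y) (fromℕ q ℚ.* d)
  upper-* {d} Y<d = shrink (upper-open Y Y<d)
    where
    Goal = Upper (fromℤ (+ q) * Y) (fromℕ q ℚ.* d)
    0<qd : 0ℚ ℚ.< fromℕ q ℚ.* d
    0<qd = *-pos 0<q (0<upper Y<d)
    corners : ∀ {d′ t} → Upper Y d′ → fromℕ q ℚ.* d′ ℚ.< t → t ℚ.< fromℕ q ℚ.* d → (∃ λ b → b ℚ.* d′ ≡ t) → Goal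
    corners {d′} {t} Y<d′ qd′<t t<qd (b , bd′≡t) =
      -- With both lower ends 0, three corner products vanish and the fourth is b d′ = t < q d. The
      -- end b = t / d′ exceeds q because q d′ < t.
      box {a = 0ℚ} {b} {0ℚ} {d′} 0<q (cancel-< (0<upper Y<d′) (subst (fromℕ q ℚ.* d′ ℚ.<_) (sym bd′≡t) qd′<t)) lower-0 Y<d′ ,
      ⊔< (⊔< 0<qd (subst (ℚ._< fromℕ q ℚ.* d) (sym (ℚ.*-zeroʳ b)) 0<qd))
         (⊔< (subst (ℚ._< fromℕ q ℚ.* d) (sym (ℚ.*-zeroˡ d′)) 0<qd) (subst (ℚ._< fromℕ q ℚ.* d) (sym bd′≡t) t<qd))
    between-products : ∀ {d′} → Upper Y d′ → (∃ λ t → fromℕ q ℚ.* d′ ℚ.< t × t ℚ.< fromℕ q ℚ.* d) → Goal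
    between-products Y<d′ (t , qd′<t , t<qd) = corners Y<d′ qd′<t t<qd (quot t (0<upper Y<d′))
    shrink : (∃ λ d′ → d′ ℚ.< d × Upper Y d′) → Goal
    shrink (d′ , d′<d , Y<d′) = between-products Y<d′ (dense (ℚ.*-monoʳ-<-pos (fromℕ q) {{ℚ.positive 0<q}} d′<d))

  upper-*⁻ : ∀ {u} → Upper (fromℤ (+ q) * Y) u → ∃ λ d → Upper Y d × fromℕ q ℚ.* d ℚ.< u
  upper-*⁻ (B , max<u) = Box.d B , Box.y<d B ,
    ℚ.≤-<-trans (Box.≤max B (ℚ.<⇒≤ (Box.a<x B)) (ℚ.<⇒≤ (Box.x<b B)) (ℚ.<⇒≤ (lower<upper Y (Box.c<y B) (Box.y<d B))) ℚ.≤-refl) max<u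

  lower-/ : ∀ {k d r} .{{_ : ℕ.NonZero k}} → Upper Y d → r ℚ.* (fromℕ q ℚ.* d) ℚ.< fromℕ k →
            Lower ((fromℤ (+ k) / (fromℤ (+ q) * Y)) {{0<qY}}) r
  lower-/ {k} {d} {r} Y<d ru<k = from-factors (factor-below (*-pos 0<q (0<upper Y<d)) (fromℕ-pos k) ru<k)
    where
    1/y : ℝ
    1/y = reciprocal (fromℤ (+ q) * Y) {{0<qY}}
    from-factors : (∃₂ λ g c → 0ℚ ℚ.< g × g ℚ.< fromℕ k × 0ℚ ℚ.< c × c ℚ.* (fromℕ q ℚ.* d) ℚ.< 1ℚ × r ℚ.< g ℚ.* c) →
                   Lower (fromℤ (+ k) * 1/y) r
    from-factors (g , c , 0<g , g<k , 0<c , cu<1 , r<gc) = from-upper (upper-inhabited 1/y)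
      where
      c<1/y : Lower 1/y c
      c<1/y = fromℕ q ℚ.* d , upper-* Y<d , cu<1
      g≤k+1 : g ℚ.≤ fromℕ k ℚ.+ 1ℚ
      g≤k+1 = ℚ.<⇒≤ (ℚ.<-trans g<k (p<p+d 0<1))
      corner : ∀ {x z} → g ℚ.≤ x → c ℚ.≤ z → r ℚ.< x ℚ.* z
      corner g≤x c≤z = ℚ.<-≤-trans r<gc (*-mono-≤ (ℚ.<⇒≤ 0<g) (ℚ.<⇒≤ 0<c) g≤x c≤z)
      from-upper : ∃ (Upper 1/y) → Lower (fromℤ (+ k) * 1/y) r
      from-upper (e , 1/y<e) =
        let c≤e = ℚ.<⇒≤ (lower<upper 1/y c<1/y 1/y<e) in
        -- Any upper ends serve: g and c are positive, so every corner product is at least g c.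
        box {a = g} {fromℕ k ℚ.+ 1ℚ} {c} {e} g<k (p<p+d 0<1) c<1/y 1/y<e ,
        <⊓ (<⊓ (corner ℚ.≤-refl ℚ.≤-refl) (corner g≤k+1 ℚ.≤-refl)) (<⊓ (corner ℚ.≤-refl c≤e) (corner g≤k+1 c≤e))

  -- The estimate is stated for all positive d′ ≤ d because d will be replaced by its minimum with a
  -- second upper bound.
  lower-1/ : ∀ {r} → Lower ((1ℝ / (fromℤ (+ q) * Y)) {{0<qY}}) r →
             ∃ λ d → Upper Y d × (∀ {d′} → 0ℚ ℚ.< d′ → d′ ℚ.≤ d → r ℚ.* (fromℕ q ℚ.* d′) ℚ.< 1ℚ)
  lower-1/ {r} (B , r<min) = from-reciprocal (Box.c<y B)
    where
    1/y : ℝ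
    1/y = reciprocal (fromℤ (+ q) * Y) {{0<qY}}
    -- The point 1 lies in the first interval of the box, so the minimum is at most 1 times c.
    r<c : r ℚ.< Box.c B
    r<c = subst (r ℚ.<_) (ℚ.*-identityˡ (Box.c B)) (ℚ.<-≤-trans r<min
      (Box.min≤ B (ℚ.<⇒≤ (Box.a<x B)) (ℚ.<⇒≤ (Box.x<b B)) ℚ.≤-refl
        (ℚ.<⇒≤ (lower<upper 1/y (Box.c<y B) (Box.y<d B)))))
    from-reciprocal : Lower 1/y (Box.c B) →
      ∃ λ d → Upper Y d × (∀ {d′} → 0ℚ ℚ.< d′ → d′ ℚ.≤ d → r ℚ.* (fromℕ q ℚ.* d′) ℚ.< 1ℚ)
    from-reciprocal (u , y<u , cu<1) =
      let d , Y<d , qd<u = upper-*⁻ y<u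
      in d , Y<d , λ {d′} 0<d′ d′≤d → *-<1-mono r<c cu<1 (*-pos 0<q 0<d′)
           (ℚ.≤-trans (*-mono-≤ (ℚ.<⇒≤ 0<q) (ℚ.<⇒≤ 0<d′) ℚ.≤-refl d′≤d) (ℚ.<⇒≤ qd<u))

-- Rational bounds for exponents

upper-minus : ∀ x ε {a η p} → Upper x a → Lower ε η → a ℚ.- η ℚ.< p → Upper (x - ε) p
upper-minus x ε {a} {η} x<a η<ε a-η<p = a , ℚ.- η , x<a , subst (Lower ε) (sym (neg-involutive η)) η<ε , a-η<p

upper-minus-positive : ∀ x {ε p} → 0ℝ < ε → Upper x p → Upper (x - ε) p
upper-minus-positive x {ε} {p} 0<ε x<p = shrink (upper-open x x<p) (positive-point 0<ε)
  where
  shrink : (∃ λ a → a ℚ.< p × Upper x a) → (∃ λ η → 0ℚ ℚ.< η × Lower ε η) → Upper (x - ε) p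
  shrink (a , a<p , x<a) (η , 0<η , η<ε) = upper-minus x ε x<a η<ε (ℚ.<-trans (p-d<p 0<η) a<p)

2-ε<2 : ∀ {ε} → 0ℝ < ε → Upper (2ℝ - ε) (fromℕ 2)
2-ε<2 {ε} 0<ε = from-point (positive-point 0<ε)
  where
  from-point : (∃ λ η → 0ℚ ℚ.< η × Lower ε η) → Upper (2ℝ - ε) (fromℕ 2)
  from-point (η , 0<η , η<ε) = from-gap (dense (p<p+d {p = fromℕ 2} 0<η))
    where
    from-gap : (∃ λ a → fromℕ 2 ℚ.< a × a ℚ.< fromℕ 2 ℚ.+ η) → Upper (2ℝ - ε) (fromℕ 2)
    from-gap (a , 2<a , a<2+η) = upper-minus 2ℝ ε 2<a η<ε (<-moveʳ η a<2+η)

reciprocal-below : ∀ {η} → 0ℚ ℚ.< η → ∃ λ m → + 1 ℚ./ suc m ℚ.< η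
reciprocal-below {η} 0<η = from-inverse (quot 1ℚ 0<η)
  where
  from-inverse : (∃ λ u → u ℚ.* η ≡ 1ℚ) → ∃ λ m → + 1 ℚ./ suc m ℚ.< η
  from-inverse (u , uη≡1) = from-bound (archimedean u)
    where
    from-bound : (∃ λ m → u ℚ.< fromℕ (suc m)) → ∃ λ m → + 1 ℚ./ suc m ℚ.< η
    from-bound (m , u<m) = m , cancel-< (0<fromℕ m)
      (subst₂ ℚ._<_ (trans uη≡1 (sym (/-*-cancel (+ 1) m))) (ℚ.*-comm (fromℕ (suc m)) η) (*ʳ-< 0<η u<m))

-- Choose m with 1 / (1 + m) < ε; the stated fraction is 2 - 1 / (1 + m). Since m is chosen before
-- x, it serves every exponent 2 - ε′ at once, and the final constant depends on ε only.
exponent-gap : ∀ {ε} → 0ℝ < ε → ∃ λ m → ∀ x → Upper x (fromℕ 2) → Upper (x - ε) (+ suc (m ℕ.+ m) ℚ./ suc m)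
exponent-gap {ε} 0<ε = from-point (positive-point 0<ε)
  where
  from-point : (∃ λ η → 0ℚ ℚ.< η × Lower ε η) → ∃ λ m → ∀ x → Upper x (fromℕ 2) → Upper (x - ε) (+ suc (m ℕ.+ m) ℚ./ suc m)
  from-point (η , 0<η , η<ε) = from-denominator (reciprocal-below 0<η)
    where
    from-denominator : (∃ λ m → + 1 ℚ./ suc m ℚ.< η) → ∃ λ m → ∀ x → Upper x (fromℕ 2) → Upper (x - ε) (+ suc (m ℕ.+ m) ℚ./ suc m)
    from-denominator (m , 1/m<η) = m , λ x x<2 → upper-minus x ε {fromℕ 2} x<2 η<ε (<-moveʳ η
      (subst (ℚ._< s ℚ.+ η) s+1/m≡2 (ℚ.+-monoʳ-< s 1/m<η)))
      where
      s = + suc (m ℕ.+ m) ℚ./ suc m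
      ring : ∀ m → (1 ℕ.+ (m ℕ.+ m) ℕ.+ 1) ℕ.* 1 ≡ 2 ℕ.* (1 ℕ.+ m)
      ring = ℕ-solve-∀
      s+1/m≡2 : s ℚ.+ + 1 ℚ./ suc m ≡ fromℕ 2
      s+1/m≡2 = trans (/-+ (+ suc (m ℕ.+ m)) (+ 1) m) (/-≡ (+ (suc (m ℕ.+ m) ℕ.+ 1)) (+ 2) m 0
        (trans (sym (ℤ.pos-* (suc (m ℕ.+ m) ℕ.+ 1) 1)) (trans (cong +_ (ring m)) (ℤ.pos-* 2 (suc m)))))

-- Upper bounds for real powers, and an approximate integer part

module _ {x : ℝ} {{1≤x : 1ℝ ≤ x}} where

  upper-power : ∀ {s b t r} i m → 0ℚ ℚ.< t → Upper s (+ i ℚ./ suc m) → Upper x b →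
                b ^ℚ i ℚ.≤ t ^ℚ suc m → t ℚ.< r → Upper (x ^ s) r
  upper-power {t = t} i m 0<t s<i/m x<b bⁱ≤tᵐ t<r = t , t<r ,
    -- For j = 0 the lower bound of x enters only through its zeroth power, so ½ will do.
    above {i = i} {0} {m} 0<t s<i/m 0<½ (_≤_.⊆ 1≤x ½<1) x<b (subst (_ ℚ.≤_) (sym (ℚ.*-identityʳ _)) bⁱ≤tᵐ)

  -- `Above` refers to the exponent only through a rational upper bound, so the witness for s′ is
  -- reused unchanged for s.
  upper-power-antimono : ∀ {s s′ r} → (∀ {p} → Upper s′ p → Upper s p) → Upper (x ^ s′) r → Upper (x ^ s) r
  upper-power-antimono f (t , t<r , above {i} {j} {m} 0<t s<e 0<a a<x x<b ≤power) =
    t , t<r , above {i = i} {j} {m} 0<t (f s<e) 0<a a<x x<b ≤power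

  -- The exact integer part of a cut cannot be decided, but `grid` finds an integer k with k < x < k
  -- + 2. If k ≥ 1, then n = k and k + 2 ≤ 3 k; otherwise n = 1 works, as 1 ≤ x < 3. This is the
  -- origin of the factor 3, and of 9 in q ≤ 9 n².
  floor : ∃ λ n → ℕ.NonZero n × fromℤ (+ n) ≤ x × Upper x (fromℕ (3 ℕ.* n))
  floor = from-grid (grid x 0)
    where
    x<3 : ∀ {k} → k ℤ.≤ + 3 → Upper x (ι k) → Upper x (fromℕ 3)
    x<3 k≤3 = upper-≤ x (ι-mono-≤ k≤3)
    from-lower : ∀ k → Lower x (ι k) → Upper x (ι (+ 2 ℤ.+ k)) → ∃ λ n → ℕ.NonZero n × fromℤ (+ n) ≤ x × Upper x (fromℕ (3 ℕ.* n))
    from-lower (+ zero)    l u = 1 , _ , 1≤x , x<3 (ℤ.+≤+ (ℕ.s≤s (ℕ.s≤s ℕ.z≤n))) u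
    from-lower (+ suc n)   l u = suc n , _ , lower-⊆ (λ r<n → lower-closed x r<n l) , upper-≤ x (fromℕ-mono-≤ 2+n≤3n) u
      where
      ring : ∀ n → 3 ℕ.+ n ℕ.+ (n ℕ.+ n) ≡ 3 ℕ.* (1 ℕ.+ n)
      ring = ℕ-solve-∀
      2+n≤3n : 3 ℕ.+ n ℕ.≤ 3 ℕ.* suc n
      2+n≤3n = subst (3 ℕ.+ n ℕ.≤_) (ring n) (ℕ.m≤m+n (3 ℕ.+ n) (n ℕ.+ n))
    from-lower -[1+ k ]    l u = 1 , _ , 1≤x , x<3 (ℤ.≤-trans (ℤ.+-monoʳ-≤ (+ 2) (ℤ.-≤+ {k} {0})) (ℤ.+≤+ (ℕ.s≤s (ℕ.s≤s ℕ.z≤n)))) u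
    from-grid : (∃₂ λ i j → Lower x (ι (i ℤ.⊖ j)) × Upper x (ι (2 ℕ.+ i ℤ.⊖ j))) → ∃ λ n → ℕ.NonZero n × fromℤ (+ n) ≤ x × Upper x (fromℕ (3 ℕ.* n))
    from-grid (i , j , l , u) = from-lower (i ℤ.⊖ j) l (subst (λ k → Upper x (ι k)) (sym (ℤ.distribʳ-⊖-+-pos 2 i j)) u)

  ≤power⇒≤9n² : ∀ {s q n} .{{_ : ℕ.NonZero n}} → Upper s (fromℕ 2) → Upper x (fromℕ (3 ℕ.* n)) → fromℤ (+ q) ≤ x ^ s → q ℕ.≤ 9 ℕ.* (n ℕ.* n)
  ≤power⇒≤9n² {s} {q} {n} s<2 x<3n q≤ = ℕ.≮⇒≥ λ 9n²<q →
    let r , 9n²<r , l = lower-open (x ^ s) (_≤_.⊆ q≤ (fromℕ-mono-< 9n²<q)) in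
    disjoint (x ^ s) l (upper-power 2 0 (fromℕ-pos (9 ℕ.* (n ℕ.* n)) {{ℕ.m*n≢0 9 (n ℕ.* n) {{_}} {{ℕ.m*n≢0 n n}}}})
      s<2 x<3n (ℚ.≤-reflexive square) 9n²<r)
    where
    open ≡-Reasoning
    ring : ∀ n → 3 ℕ.* n ℕ.* (3 ℕ.* n) ≡ 9 ℕ.* (n ℕ.* n)
    ring = ℕ-solve-∀
    square : fromℕ (3 ℕ.* n) ^ℚ 2 ≡ fromℕ (9 ℕ.* (n ℕ.* n)) ^ℚ 1
    square = begin
      fromℕ (3 ℕ.* n) ℚ.* (fromℕ (3 ℕ.* n) ℚ.* 1ℚ)       ≡⟨ solve 1 (λ z → z :* (z :* con 1ℚ) := (z :* z) :* con 1ℚ) refl (fromℕ (3 ℕ.* n)) ⟩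
      fromℕ (3 ℕ.* n) ℚ.* fromℕ (3 ℕ.* n) ℚ.* 1ℚ         ≡⟨ cong (ℚ._* 1ℚ) (fromℕ-* (3 ℕ.* n) (3 ℕ.* n)) ⟨
      fromℕ (3 ℕ.* n ℕ.* (3 ℕ.* n)) ℚ.* 1ℚ               ≡⟨ cong (λ k → fromℕ k ℚ.* 1ℚ) (ring n) ⟩
      fromℕ (9 ℕ.* (n ℕ.* n)) ℚ.* 1ℚ                     ∎

-- Thus t = 9 C n² / W is an upper bound for N ^ s when N < 3 n and s < 2 - 1 / (1 + m).
power-bound : ∀ m {C n W t} .{{_ : ℕ.NonZero C}} .{{_ : ℕ.NonZero W}} → W ℕ.^ suc m ℕ.≤ C ℕ.* n →
  t ℚ.* fromℕ W ≡ fromℕ (9 ℕ.* C ℕ.* (n ℕ.* n)) → fromℕ (3 ℕ.* n) ^ℚ suc (m ℕ.+ m) ℚ.≤ t ^ℚ suc m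
power-bound m {C} {n} {W} {t} W≤ tW≡ = cancel-≤ (^-pos (fromℕ-pos W) (suc m)) (begin
  fromℕ (3 ℕ.* n) ^ℚ k ℚ.* fromℕ W ^ℚ suc m                   ≡⟨ cong₂ ℚ._*_ (fromℕ-^ (3 ℕ.* n) k) (fromℕ-^ W (suc m)) ⟨
  fromℕ ((3 ℕ.* n) ℕ.^ k) ℚ.* fromℕ (W ℕ.^ suc m)             ≡⟨ fromℕ-* ((3 ℕ.* n) ℕ.^ k) (W ℕ.^ suc m) ⟨
  fromℕ ((3 ℕ.* n) ℕ.^ k ℕ.* W ℕ.^ suc m)                     ≤⟨ fromℕ-mono-≤ (power-comparison m {C} {n} {W} W≤) ⟩
  fromℕ ((9 ℕ.* C ℕ.* (n ℕ.* n)) ℕ.^ suc m)                   ≡⟨ fromℕ-^ (9 ℕ.* C ℕ.* (n ℕ.* n)) (suc m) ⟩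
  fromℕ (9 ℕ.* C ℕ.* (n ℕ.* n)) ^ℚ suc m                      ≡⟨ cong (_^ℚ suc m) tW≡ ⟨
  (t ℚ.* fromℕ W) ^ℚ suc m                                    ≡⟨ ^-distrib-* t (fromℕ W) (suc m) ⟩
  t ^ℚ suc m ℚ.* fromℕ W ^ℚ suc m                             ∎)
  where
  open ℚ.≤-Reasoning
  k = suc (m ℕ.+ m)

-- The final error estimate

Supply : (m C : ℕ) → Set
Supply m C = ∀ n .{{_ : ℕ.NonZero n}} → ∃ λ W → ℕ.NonZero W × W ℕ.^ suc m ℕ.≤ C ℕ.* n ×
  (∀ a q .{{_ : ℕ.NonZero q}} → Coprimality.Coprime ℤ.∣ a ∣ q → q ℕ.≤ 9 ℕ.* (n ℕ.* n) → ThreeFractions a q n W)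

-- The 1 pays for |α - a / q| and the rest for the defect. The factor 2 arises because upper cuts
-- are strict: N ^ s is bounded by t + t instead of t = 9 C n² / W.
constant : ℕ → ℕ
constant C = suc (2 ℕ.* (9 ℕ.* C))

module _ {N α s s′ : ℝ} {m C : ℕ} {{1≤N : 1ℝ ≤ N}} (s′<s : ∀ {p} → Upper s′ p → Upper s p)
  (gap : Upper s (+ suc (m ℕ.+ m) ℚ./ suc m)) {{C≢0 : ℕ.NonZero C}} {a : ℤ} {q : ℕ} {{q≢0 : ℕ.NonZero q}}
  {0<y : 0ℝ < fromℤ (+ q) * N ^ s} {0<y′ : 0ℝ < fromℤ (+ q) * N ^ s′} where

  private
    0<Nˢ : 0ℝ < N ^ s
    0<Nˢ = ^-positive

  upper-N^s : ∀ {n W t} .{{_ : ℕ.NonZero n}} .{{_ : ℕ.NonZero W}} → Upper N (fromℕ (3 ℕ.* n)) → W ℕ.^ suc m ℕ.≤ C ℕ.* n →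
    t ℚ.* fromℕ W ≡ fromℕ (9 ℕ.* C ℕ.* (n ℕ.* n)) → Upper (N ^ s) (t ℚ.+ t)
  upper-N^s {n} {W} {t} N<3n W≤ tW≡ = upper-power {s = s} {fromℕ (3 ℕ.* n)} {t} (suc (m ℕ.+ m)) m 0<t gap N<3n
    (power-bound m {C} {n} {W} {t} W≤ tW≡) (p<p+d 0<t)
    where
    0<t : 0ℚ ℚ.< t
    0<t = quot-pos (fromℕ-pos W) {t} tW≡ (fromℕ-pos (9 ℕ.* C ℕ.* (n ℕ.* n))
      {{ℕ.m*n≢0 (9 ℕ.* C) (n ℕ.* n) {{ℕ.m*n≢0 9 C}} {{ℕ.m*n≢0 n n}}}})

  defect-small : ∀ {n W t} .{{_ : ℕ.NonZero W}} (F : ThreeFractions a q n W) →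
    t ℚ.* fromℕ W ≡ fromℕ (9 ℕ.* C ℕ.* (n ℕ.* n)) → ℚ.∣ defect F ∣ ℚ.* (fromℕ q ℚ.* (t ℚ.+ t)) ℚ.≤ fromℕ (2 ℕ.* (9 ℕ.* C))
  defect-small {n} {W} {t} F tW≡ = cancel-≤ (fromℕ-pos W) (begin
    D ℚ.* (fromℕ q ℚ.* (t ℚ.+ t)) ℚ.* fromℕ W
      ≡⟨ solve 4 (λ D q t W → D :* (q :* (t :+ t)) :* W := D :* (q :* (t :* W)) :+ D :* (q :* (t :* W))) refl D (fromℕ q) t (fromℕ W) ⟩
    D ℚ.* (fromℕ q ℚ.* (t ℚ.* fromℕ W)) ℚ.+ D ℚ.* (fromℕ q ℚ.* (t ℚ.* fromℕ W))
      ≡⟨ cong (λ u → D ℚ.* (fromℕ q ℚ.* u) ℚ.+ D ℚ.* (fromℕ q ℚ.* u)) (trans tW≡ (fromℕ-* (9 ℕ.* C) (n ℕ.* n))) ⟩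
    D ℚ.* (fromℕ q ℚ.* (fromℕ (9 ℕ.* C) ℚ.* fromℕ (n ℕ.* n))) ℚ.+ D ℚ.* (fromℕ q ℚ.* (fromℕ (9 ℕ.* C) ℚ.* fromℕ (n ℕ.* n)))
      ≡⟨ solve 4 (λ D q c n → D :* (q :* (c :* n)) :+ D :* (q :* (c :* n)) := (c :+ c) :* (D :* (q :* n))) refl D (fromℕ q) (fromℕ (9 ℕ.* C)) (fromℕ (n ℕ.* n)) ⟩
    (fromℕ (9 ℕ.* C) ℚ.+ fromℕ (9 ℕ.* C)) ℚ.* (D ℚ.* (fromℕ q ℚ.* fromℕ (n ℕ.* n)))
      ≤⟨ *-mono-≤ 0≤2c 0≤Dqn² ℚ.≤-refl (defect-bound F) ⟩
    (fromℕ (9 ℕ.* C) ℚ.+ fromℕ (9 ℕ.* C)) ℚ.* fromℕ W     ≡⟨ cong (ℚ._* fromℕ W) 2c≡ ⟨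
    fromℕ (2 ℕ.* (9 ℕ.* C)) ℚ.* fromℕ W                   ∎)
    where
    open ℚ.≤-Reasoning
    D = ℚ.∣ defect F ∣
    2c≡ : fromℕ (2 ℕ.* (9 ℕ.* C)) ≡ fromℕ (9 ℕ.* C) ℚ.+ fromℕ (9 ℕ.* C)
    2c≡ = trans (cong (λ k → fromℕ (9 ℕ.* C ℕ.+ k)) (ℕ.+-identityʳ (9 ℕ.* C))) (fromℕ-+ (9 ℕ.* C) (9 ℕ.* C))
    0≤2c : 0ℚ ℚ.≤ fromℕ (9 ℕ.* C) ℚ.+ fromℕ (9 ℕ.* C)
    0≤2c = subst (0ℚ ℚ.≤_) 2c≡ (0≤fromℕ (2 ℕ.* (9 ℕ.* C)))
    0≤Dqn² : 0ℚ ℚ.≤ D ℚ.* (fromℕ q ℚ.* fromℕ (n ℕ.* n))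
    0≤Dqn² = *-mono-≤ {0ℚ} {0ℚ} ℚ.≤-refl ℚ.≤-refl (ℚ.0≤∣p∣ (defect F)) (*-mono-≤ {0ℚ} {0ℚ} ℚ.≤-refl ℚ.≤-refl (0≤fromℕ q) (0≤fromℕ (n ℕ.* n)))

  -- If r is below the left side, then r - D is below |α - a / q|, where D is the absolute defect.
  -- Hence (r - D) q d′ < 1 for a suitable upper bound d′ of N ^ s, and adding D q d′ gives r q d′ <
  -- `constant C`, which places r in the desired lower cut.
  error-bound : ∀ {n W e₁ e₂ e₃} .{{_ : ℕ.NonZero n}} .{{_ : ℕ.NonZero W}} → Upper N (fromℕ (3 ℕ.* n)) → W ℕ.^ suc m ℕ.≤ C ℕ.* n →
    (F : ThreeFractions a q n W) → defect F ≡ a ℚ./ q ℚ.- e₁ ℚ.- e₂ ℚ.- e₃ →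
    ∣ α - fromℚ (a ℚ./ q) ∣ ≤ (1ℝ / (fromℤ (+ q) * N ^ s′)) {{0<y′}} →
    ∣ α - fromℚ e₁ - fromℚ e₂ - fromℚ e₃ ∣ ≤ (fromℤ (+ constant C) / (fromℤ (+ q) * N ^ s)) {{0<y}}
  error-bound {n} {W} {e₁} {e₂} {e₃} N<3n W≤ F defect≡ α≈ = lower-⊆ λ {r} r< →
    from-scale r (_≤_.⊆ α≈ (subst (λ d → Lower ∣ α - fromℚ (a ℚ./ q) ∣ (r ℚ.- ℚ.∣ d ∣)) (sym defect≡) (abs-triangle α {a ℚ./ q} {e₁} {e₂} {e₃} {r} r<)))
      (quot (fromℕ (9 ℕ.* C ℕ.* (n ℕ.* n))) (fromℕ-pos W))
    where
    D = ℚ.∣ defect F ∣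
    Goal : ℚ → Set
    Goal r = Lower ((fromℤ (+ constant C) / (fromℤ (+ q) * N ^ s)) {{0<y}}) r
    combine : ∀ {r t d} → t ℚ.* fromℕ W ≡ fromℕ (9 ℕ.* C ℕ.* (n ℕ.* n)) → Upper (N ^ s′) d →
      (∀ {d′} → 0ℚ ℚ.< d′ → d′ ℚ.≤ d → (r ℚ.- D) ℚ.* (fromℕ q ℚ.* d′) ℚ.< 1ℚ) → Goal r
    combine {r} {t} {d} tW≡ N<d small = lower-/ {q} {N ^ s} 0<Nˢ 0<y {constant C} {d′} {r} N<d′ (begin-strict
      r ℚ.* (fromℕ q ℚ.* d′)                                            ≡⟨ solve 4 (λ r D q d → r :* (q :* d) := (r :- D) :* (q :* d) :+ D :* (q :* d)) refl r D (fromℕ q) d′ ⟩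
      (r ℚ.- D) ℚ.* (fromℕ q ℚ.* d′) ℚ.+ D ℚ.* (fromℕ q ℚ.* d′)        <⟨ ℚ.+-mono-<-≤ (small 0<d′ (ℚ.p⊓q≤p d (t ℚ.+ t))) bounded-defect ⟩
      fromℕ 1 ℚ.+ fromℕ (2 ℕ.* (9 ℕ.* C))                              ≡⟨ fromℕ-+ 1 (2 ℕ.* (9 ℕ.* C)) ⟨
      fromℕ (constant C)                                               ∎)
      where
      open ℚ.≤-Reasoning
      -- The hypothesis on α controls (r - D) q d, while the size of n controls D q (t + t). Both d
      -- and t + t bound N ^ s from above, so their minimum satisfies both estimates.
      d′ = d ℚ.⊓ (t ℚ.+ t)
      N<d′ : Upper (N ^ s) d′
      N<d′ = upper-⊓ (N ^ s) (upper-power-antimono {s = s} {s′} s′<s N<d) (upper-N^s {n} {W} {t} N<3n W≤ tW≡)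
      0<d′ : 0ℚ ℚ.< d′
      0<d′ = let _ , 0<c , c<N = positive-point 0<Nˢ in ℚ.<-trans 0<c (lower<upper (N ^ s) c<N N<d′)
      bounded-defect : D ℚ.* (fromℕ q ℚ.* d′) ℚ.≤ fromℕ (2 ℕ.* (9 ℕ.* C))
      bounded-defect = ℚ.≤-trans
        (*-mono-≤ (ℚ.0≤∣p∣ (defect F)) (ℚ.<⇒≤ (*-pos (fromℕ-pos q) 0<d′)) ℚ.≤-refl
          (*-mono-≤ (0≤fromℕ q) (ℚ.<⇒≤ 0<d′) ℚ.≤-refl (ℚ.p⊓q≤q d (t ℚ.+ t))))
        (defect-small {n} {W} {t} F tW≡)
    from-scale : ∀ r → Lower ((1ℝ / (fromℤ (+ q) * N ^ s′)) {{0<y′}}) (r ℚ.- D) → (∃ λ t → t ℚ.* fromℕ W ≡ fromℕ (9 ℕ.* C ℕ.* (n ℕ.* n))) → Goal r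
    from-scale r l (t , tW≡) = from-upper (lower-1/ {q} {N ^ s′} ^-positive 0<y′ {r ℚ.- D} l)
      where
      from-upper : (∃ λ d → Upper (N ^ s′) d × (∀ {d′} → 0ℚ ℚ.< d′ → d′ ℚ.≤ d → (r ℚ.- D) ℚ.* (fromℕ q ℚ.* d′) ℚ.< 1ℚ)) → Goal r
      from-upper (d , N<d , small) = combine {r} {t} {d} tW≡ N<d small

  Conclusion : Set
  Conclusion = Σ[ a₁ ∈ ℤ ] Σ[ a₂ ∈ ℤ ] Σ[ a₃ ∈ ℤ ]
    Σ[ q₁ ∈ ℕ ] Σ[ q₂ ∈ ℕ ] Σ[ q₃ ∈ ℕ ]
    Σ[ q₁≢0 ∈ ℕ.NonZero q₁ ] Σ[ q₂≢0 ∈ ℕ.NonZero q₂ ] Σ[ q₃≢0 ∈ ℕ.NonZero q₃ ]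
    ( fromℤ (+ q₁) ≤ N × fromℤ (+ q₂) ≤ N × fromℤ (+ q₃) ≤ N
    × ∣ α - fromℚ ((a₁ ℚ./ q₁) {{q₁≢0}}) - fromℚ ((a₂ ℚ./ q₂) {{q₂≢0}}) - fromℚ ((a₃ ℚ./ q₃) {{q₃≢0}}) ∣
    ≤ (fromℤ (+ constant C) / (fromℤ (+ q) * N ^ s)) {{0<y}} )

  approximation : Supply m C → Upper s′ (fromℕ 2) → fromℤ (+ q) ≤ N ^ s′ → gcd a (+ q) ≡ + 1 →
    ∣ α - fromℚ (a ℚ./ q) ∣ ≤ (1ℝ / (fromℤ (+ q) * N ^ s′)) {{0<y′}} → Conclusion
  approximation supply s′<2 q≤ a⊥q α≈ = from-floor floor
    where
    from-floor : (∃ λ n → ℕ.NonZero n × fromℤ (+ n) ≤ N × Upper N (fromℕ (3 ℕ.* n))) → Conclusion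
    from-floor (n , n≢0 , n≤N , N<3n) = from-supply (supply n {{n≢0}})
      where
      below-N : ∀ {k} → k ℕ.≤ n → fromℤ (+ k) ≤ N
      below-N k≤n = lower-⊆ λ r<k → _≤_.⊆ n≤N (ℚ.<-≤-trans r<k (fromℕ-mono-≤ k≤n))
      from-supply : (∃ λ W → ℕ.NonZero W × W ℕ.^ suc m ℕ.≤ C ℕ.* n ×
        (∀ a q .{{_ : ℕ.NonZero q}} → Coprimality.Coprime ℤ.∣ a ∣ q → q ℕ.≤ 9 ℕ.* (n ℕ.* n) → ThreeFractions a q n W)) → Conclusion
      from-supply (W , W≢0 , W≤ , fractions) = from-fractions
        (fractions a q (Coprimality.gcd≡1⇒coprime (ℤ.+-injective a⊥q)) (≤power⇒≤9n² {N} {{1≤N}} {s′} {q} {n} {{n≢0}} s′<2 N<3n q≤))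
        where
        from-fractions : ThreeFractions a q n W → Conclusion
        from-fractions F = a₁ , a₂ , a₃ , q₁ , q₂ , q₃ , q₁≢0 , q₂≢0 , q₃≢0 , below-N q₁≤n , below-N q₂≤n , below-N q₃≤n ,
          error-bound {n} {W} {{n≢0}} {{W≢0}} N<3n W≤ F refl α≈
          where open ThreeFractions F

theorem3 : (ε : ℝ) → 0ℝ < ε →
    Σ[ C ∈ ℝ ] (0ℝ < C × (
    (ε′ N α : ℝ) → 0ℝ < ε′ → {{1≤N : 1ℝ ≤ N}} →
    (a : ℤ) (q : ℕ) {{q≢0 : ℕ.NonZero q}} →
    fromℤ (+ q) ≤ N ^ (2ℝ - ε′) →
    gcd a (+ q) ≡ + 1 →
    ∣ α - fromℚ (a ℚ./ q) ∣ ≤ 1ℝ / (fromℤ (+ q) * N ^ (2ℝ - ε′)) →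
    Σ[ a₁ ∈ ℤ ] Σ[ a₂ ∈ ℤ ] Σ[ a₃ ∈ ℤ ]
    Σ[ q₁ ∈ ℕ ] Σ[ q₂ ∈ ℕ ] Σ[ q₃ ∈ ℕ ]
    Σ[ q₁≢0 ∈ ℕ.NonZero q₁ ] Σ[ q₂≢0 ∈ ℕ.NonZero q₂ ] Σ[ q₃≢0 ∈ ℕ.NonZero q₃ ]
    ( fromℤ (+ q₁) ≤ N × fromℤ (+ q₂) ≤ N × fromℤ (+ q₃) ≤ N
    × ∣ α - fromℚ ((a₁ ℚ./ q₁) {{q₁≢0}}) - fromℚ ((a₂ ℚ./ q₂) {{q₂≢0}}) - fromℚ ((a₃ ℚ./ q₃) {{q₃≢0}}) ∣
    ≤ C / (fromℤ (+ q) * N ^ (2ℝ - ε′ - ε)) )))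
theorem3 ε 0<ε = let m , gap = exponent-gap 0<ε
                     C , C≢0 , supply = subpolynomial-three-fractions (suc m)
  in fromℤ (+ constant C) , fromℕ-positive ,
     λ ε′ N α 0<ε′ a q q≤ a⊥q α≈ → approximation {m = m} {C} (upper-minus-positive (2ℝ - ε′) 0<ε) (gap (2ℝ - ε′) (2-ε<2 0<ε′)) {{C≢0}} {a}
       supply (2-ε<2 0<ε′) q≤ a⊥q α≈
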